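{- For a positive integer $t$ let $p_t(n)$ be defined by $\sum_{n\ge 0}p_t(n)q^n=\prod_{i\ge 1}(1-q^i)^{ -t}$. Then the congruence of formal power series $$q\sum_{n=0}^{\infty}p_t(an+b)q^n\equiv \frac{1}{\prod_{i=1}^{\infty}(1-q^i)^{at}}+\frac{1}{\prod_{i=1}^{\infty}(1-q^{ai})^t}\pmod 2$$ holds for each of the following twelve triples $(a,b,t)$: $$(5,4,1),(7,5,1),(11,6,1),(13,6,1),(17,5,1),(19,4,1),(23,1,1),(3,2,3),(5,2,3),(7,1,3),(5,0,5),(3,0,9).$$
   Context: Two power series $\sum a(n)q^n$ and $\sum b(n)q^n$ (with integer coefficients) are congruent modulo $2$ if $a(n)\equiv b(n)\pmod 2$ for every integer $n$. -}

module Defs where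

open import Data.Nat as ℕ using (ℕ; zero; suc; _∸_; _%_)
open import Data.Integer using (ℤ; +_; _-_)
import Data.Integer as ℤ
open import Data.Integer.Divisibility using (_∣_)

-- Formal power series with integer coefficients: n ↦ coefficient of q^n.
PS : Set
PS = ℕ → ℤ

sumTo : ℕ → (ℕ → ℤ) → ℤ
sumTo zero    h = h 0
sumTo (suc n) h = sumTo n h ℤ.+ h (suc n)

one : PS
one zero    = + 1
one (suc _) = + 0

_⊛_ : PS → PS → PS
(f ⊛ g) n = sumTo n (λ k → f k ℤ.* g (n ∸ k))

_⊕_ : PS → PS → PS
(f ⊕ g) n = f n ℤ.+ g n

qShift : PS → PS
qShift f zero    = + 0
qShift f (suc n) = f n

-- 1/(1 - q^d) = Σ_k q^{dk}, for d ≥ 1 (junk value 0 for d = 0, never used)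
geom : ℕ → PS
geom zero    n = + 0
geom (suc m) n with n % suc m
... | zero  = + 1
... | suc _ = + 0

prodUpTo : ℕ → (ℕ → PS) → PS
prodUpTo zero    F = one
prodUpTo (suc k) F = prodUpTo k F ⊛ F (suc k)

powPS : PS → ℕ → PS
powPS f zero    = one
powPS f (suc t) = powPS f t ⊛ f

-- etaInvPow d t = 1 / ∏_{i ≥ 1} (1 - q^{d i})^t  (for d ≥ 1).
-- The coefficient of q^n only depends on the factors with i ≤ n
-- (for i > n the factor is 1 + O(q^{n+1})), so we compute it from
-- the finite product ∏_{i=1}^{n}.
etaInvPow : ℕ → ℕ → PS
etaInvPow d t n = powPS (prodUpTo n (λ i → geom (d ℕ.* i))) t n

p : ℕ → ℕ → ℤ
p t n = etaInvPow 1 t n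

_≡₂_ : PS → PS → Set
f ≡₂ g = ∀ n → (+ 2) ∣ (f n - g n)

infix 4 _≡₂_

{-# OPTIONS --safe #-}
-- Put E = q η(q²⁴) mod 2, with η = ∏ (1 - qⁱ). After q ↦ q²⁴ and division by a power of q, the congruence says that
-- the sum of x⁻ᵗ over the a + 1 series x = E(qᵃ), E(ζⁱ q^(1/a)) equals E⁻ᵃᵗ. These are the roots of an equation
-- F(E, x) = x^(a+1) + … + E x + E^(a+1) = 0, the reduction modulo 2 of Schläfli's modular equation of degree a, and
-- Newton's identities for F give the power sum.
--
-- To prove F(E(q), E(qᵃ)) = 0, start from η³ = η(q³) + q η(q⁹)³ mod 2, which follows from the triangular and
-- pentagonal number theorems. It shows that r = q η(q⁹)³ / η(q³) satisfies r³ = r(q³) + r(q³)² + r(q³)³ and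
-- E = r + r⁴. An equation P(r(q), r(qᵃ)) = 0 compatible with this functional equation then holds as soon as it holds
-- to low order, and F(E(q), E(qᵃ)) = 0 follows from it. For a = 3 the same argument is applied to q η(q⁸)³.
module Submission where

open import Algebra.Bundles using (CommutativeSemiring; RawRing)
import Algebra.Properties.CommutativeSemiring.Exp as Exp
import Algebra.Solver.Ring as RingSolver
open import Algebra.Solver.Ring.AlmostCommutativeRing using (AlmostCommutativeRing; fromCommutativeSemiring; _-Raw-AlmostCommutative⟶_)
open import Algebra.Structures.Biased using (isCommutativeSemiringˡ)
open import Data.Bool using (Bool; true; false; _∧_; T)
open import Data.Bool.Properties using (T-∧)
open import Data.Integer as ℤ using (ℤ; +_; -[1+_]; ∣_∣)
import Data.Integer.Divisibility as ℤ∣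
import Data.Integer.Properties as ℤₚ
open import Data.List using (List; []; _∷_; _++_; map; foldr; replicate; length; applyUpTo; take; drop; filter)
open import Data.List.Membership.Propositional using (_∈_)
import Data.List.Properties as Listₚ
open import Data.List.Relation.Unary.All using (All; []; _∷_)
import Data.List.Relation.Unary.All.Properties as Allₚ
open import Data.List.Relation.Unary.AllPairs using (AllPairs; []; _∷_)
import Data.List.Relation.Unary.AllPairs.Properties as AllPairsₚ
open import Data.List.Relation.Unary.Any using (here; there)
open import Data.Maybe using (Maybe; just; nothing)
open import Data.Nat as ℕ using (ℕ; zero; suc; s≤s; z≤n; parity; _∸_; _%_)
open import Data.Nat.Coprimality using (Coprime; coprime-Bézout; prime⇒coprime)
open import Data.Nat.DivMod using ([m+n]%n≡m%n; m<n⇒m%n≡m)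
open import Data.Nat.Divisibility using (divides)
open import Data.Nat.GCD using (module Bézout)
open import Data.Nat.Primality using (Prime; prime?)
import Data.Nat.Properties as ℕₚ
open import Data.Nat.Tactic.RingSolver using (solve-∀)
open import Data.Parity.Base as ℙ using (Parity; 0ℙ; 1ℙ)
import Data.Parity.Properties as ℙₚ
open import Data.Product using (_×_; _,_; proj₁; proj₂; ∃)
open import Data.Sum using (inj₁; inj₂)
open import Function using (_∘_; id)
open import Function.Bundles using (Equivalence)
open import Level using (0ℓ)
open import Relation.Binary.PropositionalEquality as ≡ using (_≡_)
open import Relation.Binary.Structures using (IsEquivalence)
open import Relation.Nullary.Decidable using (from-yes)

-- The admissible exponents t are read off from F. If F has no terms in x², ..., xᵗ, then the first
-- t power sums of the inverse roots are those of a linear polynomial, whence the single power E⁻ᵃᵗ;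
-- this allows t up to 5 for a = 5 and up to 3 for a = 7. The value of b is forced by the exponents
-- of q: (a² - 1)t = 24(a - b). For a = 3 the series E is useless, since E(ζq) = ζE(q) when ζ³ = 1.
-- The cube of η brings 24 down to 8, and its equation x⁴ + xy + y⁴ = 0 gives t = 3 and t = 9.
-- Fractional powers of q are avoided by the substitution q ↦ qᵃ, and negative ones by the factor
-- q^(a²). The roots of unity live in 𝔽₂[ζ]/(1 + ζ + ... + ζ^(a - 1)), which is not a domain for a =
-- 7, for instance; so roots count as distinct only if their difference is not a zero divisor. This
-- is where the primality of a enters: it makes 1 + ζᵏ a unit for 0 < k < a.

record CharTwoRing : Set₁ where
  field
    commutativeSemiring : CommutativeSemiring 0ℓ 0ℓ
  open CommutativeSemiring commutativeSemiring public
  open Exp commutativeSemiring public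
  field
    x+x≈0 : ∀ x → x + x ≈ 0#

𝔽₂ : CharTwoRing
𝔽₂ = record
  { commutativeSemiring = ℙₚ.+-*-commutativeSemiring
  ; x+x≈0               = λ { 0ℙ → ≡.refl ; 1ℙ → ≡.refl }
  }

module CharTwo (K : CharTwoRing) where
  open CharTwoRing K
  open import Relation.Binary.Reasoning.Setoid setoid

  ⟨_⟩ : Parity → Carrier
  ⟨ 0ℙ ⟩ = 0#
  ⟨ 1ℙ ⟩ = 1#

  ⟨⟩-+ : ∀ x y → ⟨ x ℙ.+ y ⟩ ≈ ⟨ x ⟩ + ⟨ y ⟩
  ⟨⟩-+ 0ℙ y  = sym (+-identityˡ _)
  ⟨⟩-+ 1ℙ 0ℙ = sym (+-identityʳ _)
  ⟨⟩-+ 1ℙ 1ℙ = sym (x+x≈0 _)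

  ⟨⟩-* : ∀ x y → ⟨ x ℙ.* y ⟩ ≈ ⟨ x ⟩ * ⟨ y ⟩
  ⟨⟩-* 0ℙ y = sym (zeroˡ _)
  ⟨⟩-* 1ℙ y = sym (*-identityˡ _)

  private
    coefficients : RawRing 0ℓ 0ℓ
    coefficients = record
      { Carrier = Parity ; _≈_ = _≡_ ; _+_ = ℙ._+_ ; _*_ = ℙ._*_ ; -_ = id ; 0# = 0ℙ ; 1# = 1ℙ }

    almostCommutativeRing : AlmostCommutativeRing 0ℓ 0ℓ
    almostCommutativeRing = fromCommutativeSemiring commutativeSemiring

    coefficientMap : coefficients -Raw-AlmostCommutative⟶ almostCommutativeRing
    coefficientMap = record
      { ⟦_⟧ = ⟨_⟩ ; +-homo = ⟨⟩-+ ; *-homo = ⟨⟩-* ; -‿homo = λ _ → refl ; 0-homo = refl ; 1-homo = refl }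

    _coeff≟_ : ∀ x y → Maybe (⟨ x ⟩ ≈ ⟨ y ⟩)
    0ℙ coeff≟ 0ℙ = just refl
    1ℙ coeff≟ 1ℙ = just refl
    _  coeff≟ _  = nothing

  -- Coefficients are parities and negation is the identity, so equal monomials cancel in pairs and
  -- the solver proves identities that hold only in characteristic two.
  module Solver = RingSolver coefficients almostCommutativeRing coefficientMap _coeff≟_

  x+y≈0⇒x≈y : ∀ {x y} → x + y ≈ 0# → x ≈ y
  x+y≈0⇒x≈y {x} {y} x+y≈0 = begin
    x            ≈⟨ solve 2 (λ x y → x := (x :+ y) :+ y) refl x y ⟩
    (x + y) + y  ≈⟨ +-congʳ x+y≈0 ⟩
    0# + y       ≈⟨ +-identityˡ y ⟩
    y            ∎
    where open Solver

  x≈y⇒x+y≈0 : ∀ {x y} → x ≈ y → x + y ≈ 0#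
  x≈y⇒x+y≈0 {x} {y} x≈y = trans (+-congʳ x≈y) (x+x≈0 y)

record Hom (K L : CharTwoRing) : Set where
  private
    module K = CharTwoRing K
    module L = CharTwoRing L
  field
    apply  : K.Carrier → L.Carrier
    cong   : ∀ {x y} → x K.≈ y → apply x L.≈ apply y
    +-homo : ∀ x y → apply (x K.+ y) L.≈ apply x L.+ apply y
    *-homo : ∀ x y → apply (x K.* y) L.≈ apply x L.* apply y
    0-homo : apply K.0# L.≈ L.0#
    1-homo : apply K.1# L.≈ L.1#

  ^-homo : ∀ x n → apply (x K.^ n) L.≈ apply x L.^ n
  ^-homo x zero    = 1-homo
  ^-homo x (suc n) = L.trans (*-homo x (x K.^ n)) (L.*-congˡ (^-homo x n))

-- Formal power series in characteristic two

module Series (K : CharTwoRing) where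
  open CharTwoRing K
  open import Relation.Binary.Reasoning.Setoid setoid
  open import Algebra.Properties.CommutativeSemigroup +-commutativeSemigroup using (interchange)

  Seq : Set
  Seq = ℕ → Carrier

  infix 4 _≋_
  record _≋_ (f g : Seq) : Set where
    constructor ext
    field at : ∀ n → f n ≈ g n
  open _≋_ public

  infixr 5 _▹_
  _▹_ : Carrier → Seq → Seq
  (x ▹ f) zero    = x
  (x ▹ f) (suc n) = f n

  0ₛ : Seq
  0ₛ _ = 0#

  1ₛ : Seq
  1ₛ = 1# ▹ 0ₛ

  X : Seq
  X = 0# ▹ 1ₛ

  infixl 6 _+ₛ_
  infixl 7 _*ₛ_
  _+ₛ_ _*ₛ_ : Seq → Seq → Seq
  (f +ₛ g) n = f n + g n
  (f *ₛ g) zero    = f 0 * g 0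
  (f *ₛ g) (suc n) = f 0 * g (suc n) + ((f ∘ suc) *ₛ g) n

  *ₛ-cong : ∀ n {f f′ g g′} → (∀ k → f k ≈ f′ k) → (∀ k → g k ≈ g′ k) → (f *ₛ g) n ≈ (f′ *ₛ g′) n
  *ₛ-cong zero    p q = *-cong (p 0) (q 0)
  *ₛ-cong (suc n) p q = +-cong (*-cong (p 0) (q (suc n))) (*ₛ-cong n (p ∘ suc) q)

  zeroₛ : ∀ n g → (0ₛ *ₛ g) n ≈ 0#
  zeroₛ zero    g = zeroˡ _
  zeroₛ (suc n) g = trans (+-cong (zeroˡ _) (zeroₛ n g)) (+-identityˡ _)

  identityₛ : ∀ n g → (1ₛ *ₛ g) n ≈ g n
  identityₛ zero    g = *-identityˡ _
  identityₛ (suc n) g = trans (+-cong (*-identityˡ _) (zeroₛ n g)) (+-identityʳ _)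

  distribₛ : ∀ n h f g → ((f +ₛ g) *ₛ h) n ≈ (f *ₛ h) n + (g *ₛ h) n
  distribₛ zero    h f g = distribʳ _ _ _
  distribₛ (suc n) h f g = trans (+-cong (distribʳ _ _ _) (distribₛ n h (f ∘ suc) (g ∘ suc))) (interchange _ _ _ _)

  scaleₛ : ∀ n x f g → ((λ k → x * f k) *ₛ g) n ≈ x * (f *ₛ g) n
  scaleₛ zero    x f g = *-assoc _ _ _
  scaleₛ (suc n) x f g = trans (+-cong (*-assoc _ _ _) (scaleₛ n x (f ∘ suc) g)) (sym (distribˡ _ _ _))

  assocₛ : ∀ n f g h → ((f *ₛ g) *ₛ h) n ≈ (f *ₛ (g *ₛ h)) n
  assocₛ zero    f g h = *-assoc _ _ _
  assocₛ (suc n) f g h = begin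
    f 0 * g 0 * h (suc n) + (((λ k → f 0 * g (suc k)) +ₛ ((f ∘ suc) *ₛ g)) *ₛ h) n
      ≈⟨ +-cong (*-assoc _ _ _) (distribₛ n h _ _) ⟩
    f 0 * (g 0 * h (suc n)) + (((λ k → f 0 * g (suc k)) *ₛ h) n + (((f ∘ suc) *ₛ g) *ₛ h) n)
      ≈⟨ +-congˡ (+-cong (scaleₛ n (f 0) (g ∘ suc) h) (assocₛ n (f ∘ suc) g h)) ⟩
    f 0 * (g 0 * h (suc n)) + (f 0 * ((g ∘ suc) *ₛ h) n + ((f ∘ suc) *ₛ (g *ₛ h)) n)
      ≈⟨ +-assoc _ _ _ ⟨
    f 0 * (g 0 * h (suc n)) + f 0 * ((g ∘ suc) *ₛ h) n + ((f ∘ suc) *ₛ (g *ₛ h)) n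
      ≈⟨ +-congʳ (distribˡ _ _ _) ⟨
    f 0 * (g *ₛ h) (suc n) + ((f ∘ suc) *ₛ (g *ₛ h)) n ∎

  -- The product is defined by peeling its left factor; being able to peel the right one too makes
  -- commutativity a plain induction.
  *ₛ-sucʳ : ∀ n f g → (f *ₛ g) (suc n) ≈ g 0 * f (suc n) + (f *ₛ (g ∘ suc)) n
  *ₛ-sucʳ zero    f g = trans (+-comm _ _) (+-congʳ (*-comm _ _))
  *ₛ-sucʳ (suc n) f g = begin
    f 0 * g (2 ℕ.+ n) + ((f ∘ suc) *ₛ g) (suc n)                            ≈⟨ +-congˡ (*ₛ-sucʳ n (f ∘ suc) g) ⟩
    f 0 * g (2 ℕ.+ n) + (g 0 * f (2 ℕ.+ n) + ((f ∘ suc) *ₛ (g ∘ suc)) n)    ≈⟨ +-assoc _ _ _ ⟨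
    f 0 * g (2 ℕ.+ n) + g 0 * f (2 ℕ.+ n) + ((f ∘ suc) *ₛ (g ∘ suc)) n      ≈⟨ +-congʳ (+-comm _ _) ⟩
    g 0 * f (2 ℕ.+ n) + f 0 * g (2 ℕ.+ n) + ((f ∘ suc) *ₛ (g ∘ suc)) n      ≈⟨ +-assoc _ _ _ ⟩
    g 0 * f (2 ℕ.+ n) + (f *ₛ (g ∘ suc)) (suc n)                            ∎

  commₛ : ∀ n f g → (f *ₛ g) n ≈ (g *ₛ f) n
  commₛ zero    f g = *-comm _ _
  commₛ (suc n) f g = trans (*ₛ-sucʳ n f g) (+-congˡ (commₛ n f (g ∘ suc)))

  series : CharTwoRing
  series = record
    { commutativeSemiring = record
      { Carrier = Seq ; _≈_ = _≋_ ; _+_ = _+ₛ_ ; _*_ = _*ₛ_ ; 0# = 0ₛ ; 1# = 1ₛ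
      ; isCommutativeSemiring = isCommutativeSemiringˡ record
        { +-isCommutativeMonoid = record
          { isMonoid = record
            { isSemigroup = record
              { isMagma = record
                { isEquivalence = isEquivalenceₛ
                ; ∙-cong = λ p q → ext λ n → +-cong (at p n) (at q n) }
              ; assoc = λ f g h → ext λ n → +-assoc _ _ _ }
            ; identity = (λ f → ext λ n → +-identityˡ _) , (λ f → ext λ n → +-identityʳ _) }
          ; comm = λ f g → ext λ n → +-comm _ _ }
        ; *-isCommutativeMonoid = record
          { isMonoid = record
            { isSemigroup = record
              { isMagma = record
                { isEquivalence = isEquivalenceₛ
                ; ∙-cong = λ p q → ext λ n → *ₛ-cong n (at p) (at q) }
              ; assoc = λ f g h → ext λ n → assocₛ n f g h }
            ; identity = (λ f → ext λ n → identityₛ n f)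
                       , (λ f → ext λ n → trans (commₛ n f 1ₛ) (identityₛ n f)) }
          ; comm = λ f g → ext λ n → commₛ n f g }
        ; distribʳ = λ h f g → ext λ n → distribₛ n h f g
        ; zeroˡ = λ g → ext λ n → zeroₛ n g
        }
      }
    ; x+x≈0 = λ f → ext λ n → x+x≈0 (f n)
    }
    where
    isEquivalenceₛ : IsEquivalence _≋_
    isEquivalenceₛ = record
      { refl  = ext λ n → refl
      ; sym   = λ p → ext λ n → sym (at p n)
      ; trans = λ p q → ext λ n → trans (at p n) (at q n) }

  module S = CharTwoRing series

  X*-zero : ∀ f → (X *ₛ f) 0 ≈ 0#
  X*-zero f = zeroˡ _

  X*-suc : ∀ f n → (X *ₛ f) (suc n) ≈ f n
  X*-suc f n = trans (+-cong (zeroˡ _) (identityₛ n f)) (+-identityˡ _)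

  X*f≋0▹f : ∀ f → X *ₛ f ≋ 0# ▹ f
  X*f≋0▹f f = ext λ { zero → X*-zero f ; (suc n) → X*-suc f n }

  X^-coefficient : ∀ k f n → (X S.^ k *ₛ f) (k ℕ.+ n) ≈ f n
  X^-coefficient zero    f n = identityₛ n f
  X^-coefficient (suc k) f n = begin
    (X *ₛ X S.^ k *ₛ f) (suc k ℕ.+ n)    ≈⟨ assocₛ (suc k ℕ.+ n) X (X S.^ k) f ⟩
    (X *ₛ (X S.^ k *ₛ f)) (suc k ℕ.+ n)  ≈⟨ X*-suc (X S.^ k *ₛ f) (k ℕ.+ n) ⟩
    (X S.^ k *ₛ f) (k ℕ.+ n)             ≈⟨ X^-coefficient k f n ⟩
    f n                                  ∎

  infix 4 _≋[_]_
  _≋[_]_ : Seq → ℕ → Seq → Set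
  f ≋[ n ] g = ∀ {k} → k ℕ.< n → f k ≈ g k

  *ₛ-cong[] : ∀ {n f f′ g g′} → f ≋[ n ] f′ → g ≋[ n ] g′ → f *ₛ g ≋[ n ] f′ *ₛ g′
  *ₛ-cong[] p q {zero}  0<n = *-cong (p 0<n) (q 0<n)
  *ₛ-cong[] {suc n} p q {suc k} (s≤s k<n) =
    +-cong (*-cong (p (s≤s z≤n)) (q (s≤s k<n)))
           (*ₛ-cong[] {n} (λ j<n → p (s≤s j<n)) (λ j<n → q (ℕₚ.m<n⇒m<1+n j<n)) k<n)

  ^-cong[] : ∀ {n f g} t → f ≋[ n ] g → f S.^ t ≋[ n ] g S.^ t
  ^-cong[] zero    p _ = refl
  ^-cong[] (suc t) p   = *ₛ-cong[] p (^-cong[] t p)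

  ≋⇒≋[] : ∀ {n f g} → f ≋ g → f ≋[ n ] g
  ≋⇒≋[] p {k} _ = at p k

  trans[] : ∀ {n f g h} → f ≋[ n ] g → g ≋[ n ] h → f ≋[ n ] h
  trans[] p q k<n = trans (p k<n) (q k<n)

  sym[] : ∀ {n f g} → f ≋[ n ] g → g ≋[ n ] f
  sym[] p k<n = sym (p k<n)

  ≤-≋[] : ∀ {m n f g} → m ℕ.≤ n → f ≋[ n ] g → f ≋[ m ] g
  ≤-≋[] m≤n p k<m = p (ℕₚ.<-≤-trans k<m m≤n)

  ≋[]⇒≋ : ∀ {f g} → (∀ n → f ≋[ suc n ] g) → f ≋ g
  ≋[]⇒≋ p = ext λ n → p n ℕₚ.≤-refl

  *ₛ-lowest : ∀ n f g → f ≋[ n ] 0ₛ → (f *ₛ g) n ≈ f n * g 0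
  *ₛ-lowest zero    f g p = refl
  *ₛ-lowest (suc n) f g p = begin
    f 0 * g (suc n) + ((f ∘ suc) *ₛ g) n  ≈⟨ +-cong (*-congʳ (p (s≤s z≤n))) (*ₛ-lowest n (f ∘ suc) g (λ k<n → p (s≤s k<n))) ⟩
    0# * g (suc n) + f (suc n) * g 0      ≈⟨ +-congʳ (zeroˡ _) ⟩
    0# + f (suc n) * g 0                  ≈⟨ +-identityˡ _ ⟩
    f (suc n) * g 0                       ∎

  *ₛ-vanish : ∀ {n f} g → f ≋[ n ] 0ₛ → f *ₛ g ≋[ n ] 0ₛ
  *ₛ-vanish g p = trans[] (*ₛ-cong[] p (λ _ → refl)) (λ {k} _ → zeroₛ k g)

  X^*-vanish : ∀ k f → X S.^ k *ₛ f ≋[ k ] 0ₛ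
  X^*-vanish k f = *ₛ-vanish {f = X S.^ k} f (X^-vanish k)
    where
    X^-vanish : ∀ k → X S.^ k ≋[ k ] 0ₛ
    X^-vanish (suc k) {zero}  _         = X*-zero (X S.^ k)
    X^-vanish (suc k) {suc n} (s≤s n<k) = trans (X*-suc (X S.^ k) n) (X^-vanish k n<k)

  -- The lowest coefficient of the product is that of `f` times `g 0`, which a unit cannot
  -- annihilate; the induction has already removed the coefficients of `f` below it.
  cancel-unit : ∀ {n f g u} → g 0 * u ≈ 1# → f *ₛ g ≋[ n ] 0ₛ → f ≋[ n ] 0ₛ
  cancel-unit {suc n} {f} {g} {u} gu≈1 p {k} k<1+n with ℕₚ.m<1+n⇒m<n∨m≡n k<1+n
  ... | inj₁ k<n    = cancel-unit {n} gu≈1 (≤-≋[] (ℕₚ.n≤1+n n) p) k<n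
  ... | inj₂ ≡.refl = begin
    f k               ≈⟨ *-identityʳ _ ⟨
    f k * 1#          ≈⟨ *-congˡ gu≈1 ⟨
    f k * (g 0 * u)   ≈⟨ *-assoc _ _ _ ⟨
    f k * g 0 * u     ≈⟨ *-congʳ (*ₛ-lowest k f g (cancel-unit {k} gu≈1 (≤-≋[] (ℕₚ.n≤1+n k) p))) ⟨
    (f *ₛ g) k * u    ≈⟨ *-congʳ (p ℕₚ.≤-refl) ⟩
    0# * u            ≈⟨ zeroˡ u ⟩
    0#                ∎

  -- spread m f c is q^c f(q^(1+m)).
  spread : ℕ → Seq → ℕ → Seq
  spread m f zero    zero    = f 0
  spread m f zero    (suc n) = spread m (f ∘ suc) m n
  spread m f (suc c) zero    = 0#
  spread m f (suc c) (suc n) = spread m f c n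

  -- f(q^d) for d ≥ 1; the value 0 for d = 0 is junk.
  sub : ℕ → Seq → Seq
  sub zero    f = 0ₛ
  sub (suc m) f = spread m f 0

  spread-cong : ∀ m {f g} → f ≋ g → ∀ c n → spread m f c n ≈ spread m g c n
  spread-cong m f≋g zero    zero    = at f≋g 0
  spread-cong m f≋g zero    (suc n) = spread-cong m (ext (at f≋g ∘ suc)) m n
  spread-cong m f≋g (suc c) zero    = refl
  spread-cong m f≋g (suc c) (suc n) = spread-cong m f≋g c n

  spread-+ : ∀ m f g c n → spread m (f +ₛ g) c n ≈ spread m f c n + spread m g c n
  spread-+ m f g zero    zero    = refl
  spread-+ m f g zero    (suc n) = spread-+ m (f ∘ suc) (g ∘ suc) m n
  spread-+ m f g (suc c) zero    = sym (+-identityˡ _)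
  spread-+ m f g (suc c) (suc n) = spread-+ m f g c n

  spread-scale : ∀ m x f c n → spread m (λ k → x * f k) c n ≈ x * spread m f c n
  spread-scale m x f zero    zero    = refl
  spread-scale m x f zero    (suc n) = spread-scale m x (f ∘ suc) m n
  spread-scale m x f (suc c) zero    = sym (zeroʳ _)
  spread-scale m x f (suc c) (suc n) = spread-scale m x f c n

  spread-0 : ∀ m c n → spread m 0ₛ c n ≈ 0#
  spread-0 m zero    zero    = refl
  spread-0 m zero    (suc n) = spread-0 m m n
  spread-0 m (suc c) zero    = refl
  spread-0 m (suc c) (suc n) = spread-0 m c n

  spread-* : ∀ m f g c n → (spread m f c *ₛ spread m g 0) n ≈ spread m (f *ₛ g) c n
  spread-* m f g zero    zero    = refl
  spread-* m f g zero    (suc n) = begin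
    f 0 * spread m (g ∘ suc) m n + (spread m (f ∘ suc) m *ₛ spread m g 0) n
      ≈⟨ +-cong (sym (spread-scale m (f 0) (g ∘ suc) m n)) (spread-* m (f ∘ suc) g m n) ⟩
    spread m (λ k → f 0 * g (suc k)) m n + spread m ((f ∘ suc) *ₛ g) m n
      ≈⟨ spread-+ m _ _ m n ⟨
    spread m ((f *ₛ g) ∘ suc) m n ∎
  spread-* m f g (suc c) zero    = zeroˡ _
  spread-* m f g (suc c) (suc n) = trans (+-congʳ (zeroˡ _)) (trans (+-identityˡ _) (spread-* m f g c n))

  subHom : ℕ → Hom series series
  subHom m = record
    { apply  = sub (suc m)
    ; cong   = λ f≋g → ext (spread-cong m f≋g 0)
    ; +-homo = λ f g → ext (spread-+ m f g 0)
    ; *-homo = λ f g → ext λ n → sym (spread-* m f g 0 n)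
    ; 0-homo = ext (spread-0 m 0)
    ; 1-homo = ext λ { zero → refl ; (suc n) → spread-0 m m n }
    }

  spread-spread : ∀ m k f c j n → spread m (spread k f c) j n ≈ spread (m ℕ.+ k ℕ.* suc m) f (j ℕ.+ c ℕ.* suc m) n
  spread-spread m k f c       (suc j) zero    = refl
  spread-spread m k f c       (suc j) (suc n) = spread-spread m k f c j n
  spread-spread m k f zero    zero    zero    = refl
  spread-spread m k f zero    zero    (suc n) = spread-spread m k (f ∘ suc) k m n
  spread-spread m k f (suc c) zero    zero    = refl
  spread-spread m k f (suc c) zero    (suc n) = spread-spread m k f c m n

  sub-sub : ∀ m k f → sub (suc m) (sub (suc k) f) ≋ sub (suc k ℕ.* suc m) f
  sub-sub m k f = ext (spread-spread m k f 0 0)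

  sub-comm : ∀ m k f → sub (suc m) (sub (suc k) f) ≋ sub (suc k) (sub (suc m) f)
  sub-comm m k f = S.trans (sub-sub m k f)
    (≡.subst (λ d → sub d f ≋ sub (suc k) (sub (suc m) f)) (ℕₚ.*-comm (suc m) (suc k)) (S.sym (sub-sub k m f)))

  spread-coefficient : ∀ m f c n → spread m f c (c ℕ.+ n ℕ.* suc m) ≈ f n
  spread-coefficient m f (suc c) n       = spread-coefficient m f c n
  spread-coefficient m f zero    zero    = refl
  spread-coefficient m f zero    (suc n) = spread-coefficient m (f ∘ suc) m n

  sub-coefficient : ∀ m f n → sub (suc m) f (n ℕ.* suc m) ≈ f n
  sub-coefficient m f = spread-coefficient m f 0

  spread-cong[] : ∀ m {k f g} c → f ≋[ k ] g → spread m f c ≋[ c ℕ.+ k ℕ.* suc m ] spread m g c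
  spread-cong[] m (suc c)      p {zero}  _        = refl
  spread-cong[] m (suc c)      p {suc n} (s≤s n<) = spread-cong[] m c p n<
  spread-cong[] m {suc k} zero p {zero}  _        = p (s≤s z≤n)
  spread-cong[] m {suc k} zero p {suc n} (s≤s n<) = spread-cong[] m {k} m (λ j<k → p (s≤s j<k)) n<

  sub-vanish : ∀ m {k f} → f ≋[ k ] 0ₛ → sub (suc m) f ≋[ k ℕ.* suc m ] 0ₛ
  sub-vanish m p {n} n< = trans (spread-cong[] m 0 p n<) (spread-0 m 0 n)

  sub-cong[] : ∀ m {k f g} → f ≋[ k ] g → sub (suc m) f ≋[ k ] sub (suc m) g
  sub-cong[] m {k} {f} {g} p = ≤-≋[] {f = sub (suc m) f} {sub (suc m) g} (ℕₚ.m≤m*n k (suc m)) (spread-cong[] m 0 p)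

  spread-strip : ∀ m f c n → spread m f c (c ℕ.+ n) ≈ spread m f 0 n
  spread-strip m f zero    n = refl
  spread-strip m f (suc c) n = spread-strip m f c n

  spread-X : ∀ m f c n → spread m f c n ≈ (X S.^ c *ₛ sub (suc m) f) n
  spread-X m f zero    n       = sym (identityₛ n _)
  spread-X m f (suc c) zero    = sym (trans (assocₛ 0 X (X S.^ c) (sub (suc m) f)) (X*-zero (X S.^ c *ₛ sub (suc m) f)))
  spread-X m f (suc c) (suc n) = begin
    spread m f c n                             ≈⟨ spread-X m f c n ⟩
    (X S.^ c *ₛ sub (suc m) f) n               ≈⟨ X*-suc (X S.^ c *ₛ sub (suc m) f) n ⟨
    (X *ₛ (X S.^ c *ₛ sub (suc m) f)) (suc n)  ≈⟨ assocₛ (suc n) X (X S.^ c) (sub (suc m) f) ⟨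
    (X *ₛ X S.^ c *ₛ sub (suc m) f) (suc n)    ∎

  sub-X* : ∀ m f → sub (suc m) (X *ₛ f) ≋ X S.^ suc m *ₛ sub (suc m) f
  sub-X* m f = S.trans (Hom.cong (subHom m) (X*f≋0▹f f))
    (ext λ { zero    → sym (trans (assocₛ 0 X (X S.^ m) (sub (suc m) f)) (X*-zero (X S.^ m *ₛ sub (suc m) f)))
           ; (suc n) → spread-X m f (suc m) (suc n) })

  sub-X : ∀ m → sub (suc m) X ≋ X S.^ suc m
  sub-X m = S.trans (Hom.cong (subHom m) (S.sym (S.*-identityʳ X)))
    (S.trans (sub-X* m 1ₛ) (S.trans (S.*-congˡ {X S.^ suc m} (Hom.1-homo (subHom m))) (S.*-identityʳ (X S.^ suc m))))

  1+X^≋[]1 : ∀ i → 1ₛ +ₛ X S.^ i ≋[ i ] 1ₛ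
  1+X^≋[]1 i {k} k<i = trans (+-congˡ (trans (at (S.sym (S.*-identityʳ (X S.^ i))) k) (X^*-vanish i 1ₛ k<i))) (+-identityʳ _)

  product : (ℕ → Seq) → ℕ → ℕ → Seq
  product F s zero    = 1ₛ
  product F s (suc k) = product F s k *ₛ F (suc (s ℕ.+ k))

  product-head : ∀ F s k → product F s (suc k) ≋ F (suc s) *ₛ product F (suc s) k
  product-head F s zero    = S.trans (S.*-identityˡ _) (S.trans (S.reflexive (≡.cong (F ∘ suc) (ℕₚ.+-identityʳ s))) (S.sym (S.*-identityʳ _)))
  product-head F s (suc k) = S.trans (S.*-cong (product-head F s k) (S.reflexive (≡.cong (F ∘ suc) (ℕₚ.+-suc s k)))) (S.*-assoc (F (suc s)) _ _)

  product-* : ∀ F G s k → product (λ i → F i *ₛ G i) s k ≋ product F s k *ₛ product G s k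
  product-* F G s zero    = S.sym (S.*-identityˡ 1ₛ)
  product-* F G s (suc k) = S.trans (S.*-congʳ {F n *ₛ G n} (product-* F G s k)) (interchange-* (product F s k) (product G s k) (F n) (G n))
    where
    n = suc (s ℕ.+ k)
    open import Algebra.Properties.CommutativeSemigroup S.*-commutativeSemigroup renaming (interchange to interchange-*)

  product-cong : ∀ {F G} → (∀ i → F (suc i) ≋ G (suc i)) → ∀ s k → product F s k ≋ product G s k
  product-cong p s zero    = S.refl
  product-cong p s (suc k) = S.*-cong (product-cong p s k) (p (s ℕ.+ k))

  product-1 : ∀ s k → product (λ _ → 1ₛ) s k ≋ 1ₛ
  product-1 s zero    = S.refl
  product-1 s (suc k) = S.trans (S.*-identityʳ (product (λ _ → 1ₛ) s k)) (product-1 s k)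

  product-hom : ∀ (h : Hom series series) F s k → Hom.apply h (product F s k) ≋ product (Hom.apply h ∘ F) s k
  product-hom h F s zero    = Hom.1-homo h
  product-hom h F s (suc k) = S.trans (Hom.*-homo h (product F s k) _) (S.*-congʳ {Hom.apply h (F (suc (s ℕ.+ k)))} (product-hom h F s k))

  limit : (ℕ → Seq) → Seq
  limit F n = product F 0 n n

  -- The factor `F (suc n)` is 1 below order `suc n`, so multiplying by it changes no coefficient up
  -- to n, and reading the n-th coefficient off the n-th partial product loses nothing.
  limit-approx : ∀ F → (∀ i → F i ≋[ i ] 1ₛ) → ∀ n → limit F ≋[ suc n ] product F 0 n
  limit-approx F F≋1 zero    {zero} _ = refl
  limit-approx F F≋1 zero    {suc k} (s≤s ())
  limit-approx F F≋1 (suc n) {k} k<2+n with ℕₚ.m<1+n⇒m<n∨m≡n k<2+n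
  ... | inj₂ ≡.refl = refl
  ... | inj₁ k<1+n  = begin
    limit F k                             ≈⟨ limit-approx F F≋1 n k<1+n ⟩
    product F 0 n k                       ≈⟨ at (S.*-identityʳ (product F 0 n)) k ⟨
    (product F 0 n *ₛ 1ₛ) k               ≈⟨ *ₛ-cong[] {f = product F 0 n} (λ _ → refl) (F≋1 (suc n)) k<1+n ⟨
    (product F 0 n *ₛ F (suc n)) k        ∎

-- Reflection of polynomial identities

-- Polynomials in x over 𝔽₂, and in y over 𝔽₂[x], lowest coefficient first.
Poly₁ Poly₂ : Set
Poly₁ = List Parity
Poly₂ = List Poly₁

infixl 6 _⊕₁_ _⊕₂_
infixl 7 _⊗₁_ _⊗₂_

_⊕₁_ _⊗₁_ : Poly₁ → Poly₁ → Poly₁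
[]      ⊕₁ q       = q
(c ∷ p) ⊕₁ []      = c ∷ p
(c ∷ p) ⊕₁ (d ∷ q) = (c ℙ.+ d) ∷ (p ⊕₁ q)
[]       ⊗₁ q = []
(0ℙ ∷ p) ⊗₁ q = 0ℙ ∷ (p ⊗₁ q)
(1ℙ ∷ p) ⊗₁ q = q ⊕₁ (0ℙ ∷ (p ⊗₁ q))

_⊕₂_ _⊗₂_ : Poly₂ → Poly₂ → Poly₂
[]      ⊕₂ q       = q
(r ∷ p) ⊕₂ []      = r ∷ p
(r ∷ p) ⊕₂ (s ∷ q) = (r ⊕₁ s) ∷ (p ⊕₂ q)
[]      ⊗₂ q = []
(r ∷ p) ⊗₂ q = map (r ⊗₁_) q ⊕₂ ([] ∷ (p ⊗₂ q))

compose₁ : Poly₁ → Poly₂ → Poly₂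
compose₁ []      a = []
compose₁ (c ∷ p) a = ((c ∷ []) ∷ []) ⊕₂ a ⊗₂ compose₁ p a

compose : Poly₂ → Poly₂ → Poly₂ → Poly₂
compose []      a b = []
compose (r ∷ p) a b = compose₁ r a ⊕₂ b ⊗₂ compose p a b

monomial : ℕ → ℕ → Poly₂
monomial i j = replicate j [] ++ (replicate i 0ℙ ++ 1ℙ ∷ []) ∷ []

fromMonomials : List (ℕ × ℕ) → Poly₂
fromMonomials = foldr (λ ij → monomial (proj₁ ij) (proj₂ ij) ⊕₂_) []

isZero₁ : Poly₁ → Bool
isZero₁ []       = true
isZero₁ (0ℙ ∷ p) = isZero₁ p
isZero₁ (1ℙ ∷ p) = false

isZero₂ : Poly₂ → Bool
isZero₂ []      = true
isZero₂ (r ∷ p) = isZero₁ r ∧ isZero₂ p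

everyThird : ∀ {A : Set} → List A → List A
everyThird (x ∷ _ ∷ _ ∷ xs) = x ∷ everyThird xs
everyThird (x ∷ _)          = x ∷ []
everyThird []               = []

private
  splitLast : Poly₁ → Poly₂ → Poly₂ × Poly₁
  splitLast r []      = [] , r
  splitLast r (s ∷ p) = let (i , l) = splitLast s p in r ∷ i , l

  -- Division by the polynomial that is monic in y with lower coefficients d; only its output is checked.
  divide : Poly₂ → Poly₂ → Poly₂ × Poly₂
  divide d []      = [] , map (λ _ → []) d
  divide d (c ∷ p) with divide d p
  -- The candidate remainder c + y·r has one coefficient too many; the last one, `l`, moves to the
  -- quotient and is eliminated with the monic divisor.
  ... | q , r with splitLast c r
  ...   | i , l = l ∷ q , i ⊕₂ map (l ⊗₁_) d

quotient : Poly₂ → Poly₂ → Poly₂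
quotient p []      = []
quotient p (r ∷ d) = proj₁ (divide (proj₁ (splitLast r d)) p)

module Evaluation (K : CharTwoRing) where
  open CharTwoRing K
  open CharTwo K
  open import Relation.Binary.Reasoning.Setoid setoid

  eval₁ : Poly₁ → Carrier → Carrier
  eval₁ []      x = 0#
  eval₁ (c ∷ p) x = ⟨ c ⟩ + x * eval₁ p x

  eval₂ : Poly₂ → Carrier → Carrier → Carrier
  eval₂ []      x y = 0#
  eval₂ (r ∷ p) x y = eval₁ r x + y * eval₂ p x y

  eval₁-⊕ : ∀ p q x → eval₁ (p ⊕₁ q) x ≈ eval₁ p x + eval₁ q x
  eval₁-⊕ []      q       x = sym (+-identityˡ _)
  eval₁-⊕ (c ∷ p) []      x = sym (+-identityʳ _)
  eval₁-⊕ (c ∷ p) (d ∷ q) x = begin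
    ⟨ c ℙ.+ d ⟩ + x * eval₁ (p ⊕₁ q) x              ≈⟨ +-cong (⟨⟩-+ c d) (*-congˡ (eval₁-⊕ p q x)) ⟩
    ⟨ c ⟩ + ⟨ d ⟩ + x * (eval₁ p x + eval₁ q x)
      ≈⟨ solve 5 (λ c d x p q → (c :+ d) :+ x :* (p :+ q) := (c :+ x :* p) :+ (d :+ x :* q)) refl _ _ _ _ _ ⟩
    (⟨ c ⟩ + x * eval₁ p x) + (⟨ d ⟩ + x * eval₁ q x) ∎
    where open Solver

  eval₁-⊗ : ∀ p q x → eval₁ (p ⊗₁ q) x ≈ eval₁ p x * eval₁ q x
  eval₁-⊗ []       q x = sym (zeroˡ _)
  eval₁-⊗ (0ℙ ∷ p) q x = begin
    0# + x * eval₁ (p ⊗₁ q) x          ≈⟨ +-congˡ (*-congˡ (eval₁-⊗ p q x)) ⟩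
    0# + x * (eval₁ p x * eval₁ q x)   ≈⟨ solve 3 (λ x p q → con 0ℙ :+ x :* (p :* q) := (con 0ℙ :+ x :* p) :* q) refl _ _ _ ⟩
    (0# + x * eval₁ p x) * eval₁ q x   ∎
    where open Solver
  eval₁-⊗ (1ℙ ∷ p) q x = begin
    eval₁ (q ⊕₁ (0ℙ ∷ (p ⊗₁ q))) x                ≈⟨ eval₁-⊕ q _ x ⟩
    eval₁ q x + (0# + x * eval₁ (p ⊗₁ q) x)         ≈⟨ +-congˡ (+-congˡ (*-congˡ (eval₁-⊗ p q x))) ⟩
    eval₁ q x + (0# + x * (eval₁ p x * eval₁ q x))
      ≈⟨ solve 3 (λ x p q → q :+ (con 0ℙ :+ x :* (p :* q)) := (con 1ℙ :+ x :* p) :* q) refl _ _ _ ⟩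
    (1# + x * eval₁ p x) * eval₁ q x              ∎
    where open Solver

  eval-⊕ : ∀ p q x y → eval₂ (p ⊕₂ q) x y ≈ eval₂ p x y + eval₂ q x y
  eval-⊕ []      q       x y = sym (+-identityˡ _)
  eval-⊕ (r ∷ p) []      x y = sym (+-identityʳ _)
  eval-⊕ (r ∷ p) (s ∷ q) x y = begin
    eval₁ (r ⊕₁ s) x + y * eval₂ (p ⊕₂ q) x y                  ≈⟨ +-cong (eval₁-⊕ r s x) (*-congˡ (eval-⊕ p q x y)) ⟩
    eval₁ r x + eval₁ s x + y * (eval₂ p x y + eval₂ q x y)
      ≈⟨ solve 5 (λ c d x p q → (c :+ d) :+ x :* (p :+ q) := (c :+ x :* p) :+ (d :+ x :* q)) refl _ _ _ _ _ ⟩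
    (eval₁ r x + y * eval₂ p x y) + (eval₁ s x + y * eval₂ q x y) ∎
    where open Solver

  eval-map : ∀ r q x y → eval₂ (map (r ⊗₁_) q) x y ≈ eval₁ r x * eval₂ q x y
  eval-map r []      x y = sym (zeroʳ _)
  eval-map r (s ∷ q) x y = begin
    eval₁ (r ⊗₁ s) x + y * eval₂ (map (r ⊗₁_) q) x y            ≈⟨ +-cong (eval₁-⊗ r s x) (*-congˡ (eval-map r q x y)) ⟩
    eval₁ r x * eval₁ s x + y * (eval₁ r x * eval₂ q x y)
      ≈⟨ solve 4 (λ r s y q → r :* s :+ y :* (r :* q) := r :* (s :+ y :* q)) refl _ _ _ _ ⟩
    eval₁ r x * (eval₁ s x + y * eval₂ q x y)                   ∎
    where open Solver

  eval-⊗ : ∀ p q x y → eval₂ (p ⊗₂ q) x y ≈ eval₂ p x y * eval₂ q x y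
  eval-⊗ []      q x y = sym (zeroˡ _)
  eval-⊗ (r ∷ p) q x y = begin
    eval₂ (map (r ⊗₁_) q ⊕₂ ([] ∷ (p ⊗₂ q))) x y               ≈⟨ eval-⊕ (map (r ⊗₁_) q) _ x y ⟩
    eval₂ (map (r ⊗₁_) q) x y + (0# + y * eval₂ (p ⊗₂ q) x y)    ≈⟨ +-cong (eval-map r q x y) (+-congˡ (*-congˡ (eval-⊗ p q x y))) ⟩
    eval₁ r x * eval₂ q x y + (0# + y * (eval₂ p x y * eval₂ q x y))
      ≈⟨ solve 4 (λ r q y p → r :* q :+ (con 0ℙ :+ y :* (p :* q)) := (r :+ y :* p) :* q) refl _ _ _ _ ⟩
    (eval₁ r x + y * eval₂ p x y) * eval₂ q x y                 ∎
    where open Solver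

  eval₁-cong : ∀ p {x x′} → x ≈ x′ → eval₁ p x ≈ eval₁ p x′
  eval₁-cong []      e = refl
  eval₁-cong (c ∷ p) e = +-congˡ (*-cong e (eval₁-cong p e))

  eval-cong : ∀ p {x x′ y y′} → x ≈ x′ → y ≈ y′ → eval₂ p x y ≈ eval₂ p x′ y′
  eval-cong []      d e = refl
  eval-cong (r ∷ p) d e = +-cong (eval₁-cong r d) (*-cong e (eval-cong p d e))

  eval-compose₁ : ∀ p a x y → eval₂ (compose₁ p a) x y ≈ eval₁ p (eval₂ a x y)
  eval-compose₁ []      a x y = refl
  eval-compose₁ (c ∷ p) a x y = begin
    eval₂ (((c ∷ []) ∷ []) ⊕₂ a ⊗₂ compose₁ p a) x y
      ≈⟨ eval-⊕ ((c ∷ []) ∷ []) (a ⊗₂ compose₁ p a) x y ⟩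
    (⟨ c ⟩ + x * 0# + y * 0#) + eval₂ (a ⊗₂ compose₁ p a) x y
      ≈⟨ +-cong (solve 3 (λ c x y → c :+ x :* con 0ℙ :+ y :* con 0ℙ := c) refl _ _ _) (eval-⊗ a (compose₁ p a) x y) ⟩
    ⟨ c ⟩ + eval₂ a x y * eval₂ (compose₁ p a) x y
      ≈⟨ +-congˡ (*-congˡ (eval-compose₁ p a x y)) ⟩
    ⟨ c ⟩ + eval₂ a x y * eval₁ p (eval₂ a x y) ∎
    where open Solver

  eval-compose : ∀ p a b x y → eval₂ (compose p a b) x y ≈ eval₂ p (eval₂ a x y) (eval₂ b x y)
  eval-compose []      a b x y = refl
  eval-compose (r ∷ p) a b x y = begin
    eval₂ (compose₁ r a ⊕₂ b ⊗₂ compose p a b) x y               ≈⟨ eval-⊕ (compose₁ r a) _ x y ⟩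
    eval₂ (compose₁ r a) x y + eval₂ (b ⊗₂ compose p a b) x y     ≈⟨ +-cong (eval-compose₁ r a x y) (eval-⊗ b _ x y) ⟩
    eval₁ r (eval₂ a x y) + eval₂ b x y * eval₂ (compose p a b) x y
      ≈⟨ +-congˡ (*-congˡ (eval-compose p a b x y)) ⟩
    eval₁ r (eval₂ a x y) + eval₂ b x y * eval₂ p (eval₂ a x y) (eval₂ b x y) ∎

  isZero₁-sound : ∀ p x → T (isZero₁ p) → eval₁ p x ≈ 0#
  isZero₁-sound []       x _ = refl
  isZero₁-sound (0ℙ ∷ p) x h = trans (+-identityˡ _) (trans (*-congˡ (isZero₁-sound p x h)) (zeroʳ _))

  isZero-sound : ∀ p x y → T (isZero₂ p) → eval₂ p x y ≈ 0#
  isZero-sound []      x y _ = refl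
  isZero-sound (r ∷ p) x y h with Equivalence.to T-∧ h
  ... | hr , hp = begin
    eval₁ r x + y * eval₂ p x y  ≈⟨ +-cong (isZero₁-sound r x hr) (*-congˡ (isZero-sound p x y hp)) ⟩
    0# + y * 0#                  ≈⟨ trans (+-identityˡ _) (zeroʳ _) ⟩
    0#                           ∎

  eval₁-monomial : ∀ i x → eval₁ (replicate i 0ℙ ++ 1ℙ ∷ []) x ≈ x ^ i
  eval₁-monomial zero    x = trans (+-congˡ (zeroʳ x)) (+-identityʳ 1#)
  eval₁-monomial (suc i) x = trans (+-identityˡ _) (*-congˡ (eval₁-monomial i x))

  eval-monomial : ∀ i j x y → eval₂ (monomial i j) x y ≈ x ^ i * y ^ j
  eval-monomial i zero    x y = begin
    eval₁ (replicate i 0ℙ ++ 1ℙ ∷ []) x + y * 0#  ≈⟨ +-cong (eval₁-monomial i x) (zeroʳ y) ⟩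
    x ^ i + 0#                                    ≈⟨ +-identityʳ _ ⟩
    x ^ i                                         ≈⟨ *-identityʳ _ ⟨
    x ^ i * 1#                                    ∎
  eval-monomial i (suc j) x y = begin
    0# + y * eval₂ (monomial i j) x y  ≈⟨ +-congˡ (*-congˡ (eval-monomial i j x y)) ⟩
    0# + y * (x ^ i * y ^ j)           ≈⟨ solve 3 (λ y a b → con 0ℙ :+ y :* (a :* b) := a :* (y :* b)) refl y (x ^ i) (y ^ j) ⟩
    x ^ i * (y * y ^ j)                ∎
    where open Solver

module _ {K L : CharTwoRing} (h : Hom K L) where
  open Hom h renaming (apply to φ; cong to φ-cong)
  open CharTwoRing L
  private
    module K = CharTwo K
    module L = CharTwo L
    module EK = Evaluation K
    module EL = Evaluation L
    module RK = CharTwoRing K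

  ⟨⟩-hom : ∀ c → φ K.⟨ c ⟩ ≈ L.⟨ c ⟩
  ⟨⟩-hom 0ℙ = 0-homo
  ⟨⟩-hom 1ℙ = 1-homo

  eval₁-hom : ∀ p x → φ (EK.eval₁ p x) ≈ EL.eval₁ p (φ x)
  eval₁-hom []      x = 0-homo
  eval₁-hom (c ∷ p) x = trans (+-homo K.⟨ c ⟩ _) (+-cong (⟨⟩-hom c) (trans (*-homo x _) (*-congˡ (eval₁-hom p x))))

  eval₂-hom : ∀ p x y → φ (EK.eval₂ p x y) ≈ EL.eval₂ p (φ x) (φ y)
  eval₂-hom []      x y = 0-homo
  eval₂-hom (r ∷ p) x y = trans (+-homo (EK.eval₁ r x) _) (+-cong (eval₁-hom r x) (trans (*-homo y _) (*-congˡ (eval₂-hom p x y))))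

-- Newton's identities

module Monic (K : CharTwoRing) where
  open CharTwoRing K

  -- The monic polynomial y^n + … with the given lower coefficients.
  evalMonic : List Carrier → Carrier → Carrier
  evalMonic []       y = 1#
  evalMonic (f ∷ fs) y = f + y * evalMonic fs y

  -- The quotient of a monic polynomial by y - c.
  deflate : Carrier → List Carrier → List Carrier
  deflate c (f ∷ fs@(_ ∷ _)) = evalMonic fs c ∷ deflate c fs
  deflate c _                = []

  coefficient : List Carrier → ℕ → Carrier
  coefficient []       zero    = 1#
  coefficient []       (suc n) = 0#
  coefficient (f ∷ fs) zero    = f
  coefficient (f ∷ fs) (suc n) = coefficient fs n

  Regular : Carrier → Set
  Regular c = ∀ x → c * x ≈ 0# → x ≈ 0#

  deflate-length : ∀ c f fs → length (deflate c (f ∷ fs)) ≡ length fs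
  deflate-length c f []       = ≡.refl
  deflate-length c f (g ∷ fs) = ≡.cong suc (deflate-length c g fs)

  regular-cancel : ∀ {c x y} → Regular c → c * x ≈ c * y → x ≈ y
  regular-cancel {c} {x} {y} reg cx≈cy = x+y≈0⇒x≈y (reg (x + y) (trans (distribˡ c x y) (x≈y⇒x+y≈0 cx≈cy)))
    where open CharTwo K

module _ {K L : CharTwoRing} (h : Hom K L) where
  open Hom h renaming (apply to φ; cong to φ-cong)
  open CharTwoRing L
  open CharTwo L using (module Solver)
  open import Relation.Binary.Reasoning.Setoid setoid
  private
    module K = CharTwoRing K
    module MK = Monic K
    module ML = Monic L

  product-of-roots : List K.Carrier → Carrier → Carrier
  product-of-roots cs y = foldr (λ c z → (y + φ c) * z) 1# cs

  -- Synthetic division with remainder. The point `y` may lie in a larger ring than the root `c`,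
  -- because it will be a formal variable over the ring of the roots.
  evalMonic-deflate : ∀ c f fs y → ML.evalMonic (map φ (f ∷ fs)) y ≈
    (y + φ c) * ML.evalMonic (map φ (MK.deflate c (f ∷ fs))) y + φ (MK.evalMonic (f ∷ fs) c)
  evalMonic-deflate c f [] y = begin
    φ f + y * 1#                                      ≈⟨ solve 3 (λ f y c → f :+ y :* con 1ℙ := (y :+ c) :* con 1ℙ :+ (f :+ c :* con 1ℙ)) refl (φ f) y (φ c) ⟩
    (y + φ c) * 1# + (φ f + φ c * 1#)                 ≈⟨ +-congˡ (trans (+-homo f _) (+-congˡ (trans (*-homo c K.1#) (*-congˡ 1-homo)))) ⟨
    (y + φ c) * 1# + φ (f K.+ c K.* K.1#)             ∎
    where open Solver
  evalMonic-deflate c f fs@(g ∷ gs) y = begin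
    φ f + y * ML.evalMonic (map φ fs) y               ≈⟨ +-congˡ (*-congˡ (evalMonic-deflate c g gs y)) ⟩
    φ f + y * ((y + φ c) * Q + φ G)
      ≈⟨ solve 5 (λ f y c Q G → f :+ y :* ((y :+ c) :* Q :+ G) := (y :+ c) :* (G :+ y :* Q) :+ (f :+ c :* G)) refl (φ f) y (φ c) Q (φ G) ⟩
    (y + φ c) * (φ G + y * Q) + (φ f + φ c * φ G)     ≈⟨ +-congˡ (trans (+-homo f _) (+-congˡ (*-homo c G))) ⟨
    (y + φ c) * (φ G + y * Q) + φ (f K.+ c K.* G)     ∎
    where
    open Solver
    Q = ML.evalMonic (map φ (MK.deflate c fs)) y
    G = MK.evalMonic fs c

  root⇒factor : ∀ c f fs y → MK.evalMonic (f ∷ fs) c K.≈ K.0# →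
    ML.evalMonic (map φ (f ∷ fs)) y ≈ (y + φ c) * ML.evalMonic (map φ (MK.deflate c (f ∷ fs))) y
  root⇒factor c f fs y root = trans (evalMonic-deflate c f fs y) (trans (+-congˡ (trans (φ-cong root) 0-homo)) (+-identityʳ _))

idHom : ∀ K → Hom K K
idHom K = record { apply = λ x → x ; cong = λ e → e ; +-homo = λ _ _ → refl ; *-homo = λ _ _ → refl ; 0-homo = refl ; 1-homo = refl }
  where open CharTwoRing K

module _ {K L : CharTwoRing} (h : Hom K L) where
  open CharTwoRing L
  private
    module K = CharTwoRing K
    module MK = Monic K
    module ML = Monic L

  -- Over a ring with zero divisors, n roots of a monic polynomial of degree n need not factor it.
  -- Regular differences repair this: after division by y + c every other root c′ satisfies (c′ +
  -- c)·Q(c′) = 0, hence is a root of the quotient Q.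
  factorization : ∀ fs cs → length fs ≡ length cs → AllPairs (λ c c′ → MK.Regular (c′ K.+ c)) cs →
    All (λ c → MK.evalMonic fs c K.≈ K.0#) cs → ∀ y → ML.evalMonic (map (Hom.apply h) fs) y ≈ product-of-roots h cs y
  factorization []       []       _   _           _               y = refl
  factorization (f ∷ fs) (c ∷ cs) len (reg ∷ regs) (root ∷ roots) y =
    trans (root⇒factor h c f fs y root)
      (*-congˡ (factorization (MK.deflate c (f ∷ fs)) cs (≡.trans (MK.deflate-length c f fs) (ℕₚ.suc-injective len)) regs
        (deflated-roots cs reg roots) y))
    where
    map-id : ∀ gs → map (λ x → x) gs ≡ gs
    map-id []       = ≡.refl
    map-id (g ∷ gs) = ≡.cong (g ∷_) (map-id gs)

    deflated-roots : ∀ cs → All (λ c′ → MK.Regular (c′ K.+ c)) cs → All (λ c′ → MK.evalMonic (f ∷ fs) c′ K.≈ K.0#) cs →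
      All (λ c′ → MK.evalMonic (MK.deflate c (f ∷ fs)) c′ K.≈ K.0#) cs
    deflated-roots []        []           []              = []
    deflated-roots (c′ ∷ cs) (reg ∷ regs) (root′ ∷ roots) =
      reg _ (K.trans (K.sym factor) root′) ∷ deflated-roots cs regs roots
      where
      factor : MK.evalMonic (f ∷ fs) c′ K.≈ (c′ K.+ c) K.* MK.evalMonic (MK.deflate c (f ∷ fs)) c′
      factor = ≡.subst₂ (λ gs gs′ → MK.evalMonic gs c′ K.≈ (c′ K.+ c) K.* MK.evalMonic gs′ c′)
        (map-id (f ∷ fs)) (map-id (MK.deflate c (f ∷ fs))) (root⇒factor (idHom K) c f fs c′ root)

module PowerSums (K : CharTwoRing) where
  open CharTwoRing K
  open CharTwo K using (⟨_⟩; ⟨⟩-+)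
  open Monic K
  open Series K
  open import Relation.Binary.Reasoning.Setoid setoid
  private
    module K₂ = CharTwo K
    module S₂ = CharTwo series
    module MS = Monic series

  constant : Carrier → Seq
  constant x = x ▹ 0ₛ

  constant-* : ∀ x f n → (constant x *ₛ f) n ≈ x * f n
  constant-* x f zero    = refl
  constant-* x f (suc n) = trans (+-congˡ (zeroₛ n f)) (+-identityʳ _)

  constantHom : Hom K series
  constantHom = record
    { apply  = constant
    ; cong   = λ e → ext λ { zero → e ; (suc n) → refl }
    ; +-homo = λ x y → ext λ { zero → refl ; (suc n) → sym (+-identityˡ _) }
    ; *-homo = λ x y → ext λ { zero → refl ; (suc n) → sym (trans (constant-* x (constant y) (suc n)) (zeroʳ x)) }
    ; 0-homo = ext λ { zero → refl ; (suc n) → refl }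
    ; 1-homo = S.refl
    }

  -- f ↦ q df/dq
  θ : Seq → Seq
  θ f n = ⟨ parity n ⟩ * f n

  ⟨parity-suc⟩ : ∀ n → ⟨ parity (suc n) ⟩ ≈ 1# + ⟨ parity n ⟩
  ⟨parity-suc⟩ n = trans (reflexive (≡.cong ⟨_⟩ (ℙₚ.+-homo-+ 1 n))) (⟨⟩-+ 1ℙ (parity n))

  θ-suc : ∀ f n → θ f (suc n) ≈ (f ∘ suc) n + θ (f ∘ suc) n
  θ-suc f n = trans (*-congʳ (⟨parity-suc⟩ n)) (trans (distribʳ _ _ _) (+-congʳ (*-identityˡ _)))

  θ-* : ∀ f g n → θ (f *ₛ g) n ≈ (θ f *ₛ g +ₛ f *ₛ θ g) n
  θ-* f g zero    = solve 2 (λ f g → con 0ℙ :* (f :* g) := con 0ℙ :* f :* g :+ f :* (con 0ℙ :* g)) refl (f 0) (g 0)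
    where open K₂.Solver
  θ-* f g (suc n) = begin
    θ (f *ₛ g) (suc n)
      ≈⟨ trans (*-congʳ (⟨parity-suc⟩ n)) (distribʳ _ _ _) ⟩
    1# * (f 0 * g (suc n) + (f′ *ₛ g) n) + e * (f 0 * g (suc n) + (f′ *ₛ g) n)
      ≈⟨ solve 4 (λ e a b c → con 1ℙ :* (a :* b :+ c) :+ e :* (a :* b :+ c) := (con 0ℙ :* a :* b :+ c) :+ (a :* ((con 1ℙ :+ e) :* b) :+ e :* c))
           refl e (f 0) (g (suc n)) ((f′ *ₛ g) n) ⟩
    (0# * f 0 * g (suc n) + (f′ *ₛ g) n) + (f 0 * ((1# + e) * g (suc n)) + θ (f′ *ₛ g) n)
      ≈⟨ +-congˡ (+-cong (*-congˡ (*-congʳ (sym (⟨parity-suc⟩ n)))) (θ-* f′ g n)) ⟩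
    (0# * f 0 * g (suc n) + (f′ *ₛ g) n) + (f 0 * θ g (suc n) + ((θ f′ *ₛ g) n + (f′ *ₛ θ g) n))
      ≈⟨ solve 5 (λ a b c d e → (a :+ b) :+ (c :+ (d :+ e)) := (a :+ (b :+ d)) :+ (c :+ e)) refl
           (0# * f 0 * g (suc n)) ((f′ *ₛ g) n) (f 0 * θ g (suc n)) ((θ f′ *ₛ g) n) ((f′ *ₛ θ g) n) ⟩
    (0# * f 0 * g (suc n) + ((f′ *ₛ g) n + (θ f′ *ₛ g) n)) + (f *ₛ θ g) (suc n)
      ≈⟨ +-congʳ (+-congˡ (trans (sym (distribₛ n g f′ (θ f′))) (*ₛ-cong n (λ k → sym (θ-suc f k)) (λ _ → refl)))) ⟩
    (θ f *ₛ g +ₛ f *ₛ θ g) (suc n) ∎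
    where
    open K₂.Solver
    e = ⟨ parity n ⟩
    f′ = f ∘ suc

  module _ (σ : Carrier) where
    -- With cd = σ and y = σX, the fraction y/(y + c) expands as the sum of dⁿXⁿ over n ≥ 1. Scaling
    -- the variable by σ replaces the inverses of the roots, which need not be power series, by the
    -- multiples d = σ/c.
    y : Seq
    y = constant σ *ₛ X

    y*-zero : ∀ f → (y *ₛ f) 0 ≈ 0#
    y*-zero f = trans (*-congʳ (zeroʳ σ)) (zeroˡ _)

    y*-suc : ∀ f n → (y *ₛ f) (suc n) ≈ σ * f n
    y*-suc f n = trans (assocₛ (suc n) (constant σ) X f) (trans (constant-* σ (X *ₛ f) (suc n)) (*-congˡ (X*-suc f n)))

    powers : Carrier → Seq
    powers d = 0# ▹ λ n → d ^ suc n

    linear-powers : ∀ {c d} → c * d ≈ σ → (y +ₛ constant c) *ₛ powers d ≋ y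
    linear-powers {c} {d} cd≈σ = ext λ n → trans (distribₛ n (powers d) y (constant c)) (go n)
      where
      go : ∀ n → (y *ₛ powers d) n + (constant c *ₛ powers d) n ≈ y n
      go zero          = trans (+-cong (y*-zero (powers d)) (zeroʳ c)) (trans (+-identityˡ _) (sym (zeroʳ σ)))
      go (suc zero)    = begin
        (y *ₛ powers d) 1 + (constant c *ₛ powers d) 1
          ≈⟨ +-cong (trans (y*-suc (powers d) 0) (zeroʳ σ)) (trans (constant-* c (powers d) 1) (*-congˡ (*-identityʳ d))) ⟩
        0# + c * d      ≈⟨ +-identityˡ _ ⟩
        c * d           ≈⟨ cd≈σ ⟩
        σ               ≈⟨ *-identityʳ σ ⟨
        σ * 1#          ≈⟨ constant-* σ X 1 ⟨
        y 1             ∎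
      go (suc (suc n)) = begin
        (y *ₛ powers d) (2 ℕ.+ n) + (constant c *ₛ powers d) (2 ℕ.+ n)
          ≈⟨ +-cong (y*-suc (powers d) (suc n)) (constant-* c (powers d) (2 ℕ.+ n)) ⟩
        σ * d ^ suc n + c * (d * d ^ suc n)    ≈⟨ +-congˡ (trans (sym (*-assoc c d _)) (*-congʳ cd≈σ)) ⟩
        σ * d ^ suc n + σ * d ^ suc n          ≈⟨ x+x≈0 _ ⟩
        0#                                     ≈⟨ zeroʳ σ ⟨
        σ * 0#                                 ≈⟨ constant-* σ X (2 ℕ.+ n) ⟨
        y (2 ℕ.+ n)                            ∎

    θ-linear : ∀ c → θ (y +ₛ constant c) ≋ y
    θ-linear c = ext go
      where
      go : ∀ n → θ (y +ₛ constant c) n ≈ y n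
      go zero          = trans (zeroˡ _) (sym (zeroʳ σ))
      go (suc zero)    = trans (*-identityˡ _) (+-identityʳ _)
      go (suc (suc n)) = trans (*-congˡ (trans (+-identityʳ _) y≈0)) (trans (zeroʳ _) (sym y≈0))
        where
        y≈0 : y (2 ℕ.+ n) ≈ 0#
        y≈0 = trans (constant-* σ X (2 ℕ.+ n)) (zeroʳ σ)

    Π : List Carrier → Seq
    Π cs = product-of-roots constantHom cs y

    powerSum : List Carrier → ℕ → Carrier
    powerSum ds t = foldr (λ d s → d ^ t + s) 0# ds

    powerSums : List Carrier → Seq
    powerSums ds = 0# ▹ (powerSum ds ∘ suc)

    powerSums-∷ : ∀ d ds → powerSums (d ∷ ds) ≋ powers d +ₛ powerSums ds
    powerSums-∷ d ds = ext λ { zero → sym (+-identityˡ _) ; (suc n) → refl }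

    θ-1 : ∀ n → θ 1ₛ n ≈ 0#
    θ-1 zero    = zeroˡ _
    θ-1 (suc n) = zeroʳ _

    -- Logarithmic differentiation: θ(y + c) = y = (y + c)·`powers d`, so the product rule
    -- contributes one geometric series per root.
    newton : ∀ (rs : List (Carrier × Carrier)) → All (λ r → proj₁ r * proj₂ r ≈ σ) rs →
      θ (Π (map proj₁ rs)) ≋ Π (map proj₁ rs) *ₛ powerSums (map proj₂ rs)
    newton []             []          = ext λ n → trans (θ-1 n) (sym (trans (identityₛ n (powerSums [])) (no-powers n)))
      where
      no-powers : ∀ n → powerSums [] n ≈ 0#
      no-powers zero    = refl
      no-powers (suc n) = refl
    newton ((c , d) ∷ rs) (cd≈σ ∷ es) =
      S.trans (ext (θ-* l (Π cs)))
      (S.trans (S.+-cong (S.*-congʳ {Π cs} (S.trans (θ-linear c) (S.sym (linear-powers cd≈σ)))) (S.*-congˡ {l} (newton rs es)))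
      (S.trans (solve 4 (λ l p Π s → l :* p :* Π :+ l :* (Π :* s) := l :* Π :* (p :+ s)) S.refl l (powers d) (Π cs) (powerSums ds))
      (S.*-congˡ {l *ₛ Π cs} (S.sym (powerSums-∷ d ds)))))
      where
      open S₂.Solver
      l = y +ₛ constant c
      cs = map proj₁ rs
      ds = map proj₂ rs

    evalMonic-coefficient : ∀ fs n → MS.evalMonic (map constant fs) y n ≈ σ ^ n * coefficient fs n
    evalMonic-coefficient []       zero    = sym (*-identityˡ _)
    evalMonic-coefficient []       (suc n) = sym (zeroʳ _)
    evalMonic-coefficient (f ∷ fs) zero    = trans (+-congˡ (y*-zero (MS.evalMonic (map constant fs) y))) (trans (+-identityʳ _) (sym (*-identityˡ _)))
    evalMonic-coefficient (f ∷ fs) (suc n) = trans (+-identityˡ _)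
      (trans (y*-suc (MS.evalMonic (map constant fs) y) n) (trans (*-congˡ (evalMonic-coefficient fs n)) (sym (*-assoc _ _ _))))

    -- The gap makes F agree with the linear polynomial f₀ + f₁y through degree t + 1 in X, so to
    -- that order the power sums are those of one inverse root, w = σf₁/f₀.
    module _ (f₀ f₁ : Carrier) (fs : List Carrier) (rs : List (Carrier × Carrier)) (w : Carrier) (t : ℕ)
      (len : length (f₀ ∷ f₁ ∷ fs) ≡ length (map proj₁ rs))
      (distinct : AllPairs (λ c c′ → Regular (c′ + c)) (map proj₁ rs))
      (roots : All (λ c → evalMonic (f₀ ∷ f₁ ∷ fs) c ≈ 0#) (map proj₁ rs))
      (inverses : All (λ r → proj₁ r * proj₂ r ≈ σ) rs)
      (gap : ∀ {n} → n ℕ.< t → coefficient fs n ≈ 0#)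
      (f₀-regular : Regular f₀) (f₀w≈σf₁ : f₀ * w ≈ σ * f₁) where

      private
        F = MS.evalMonic (map constant (f₀ ∷ f₁ ∷ fs)) y
        p = powerSum (map proj₂ rs)

        identity : θ F ≋ F *ₛ powerSums (map proj₂ rs)
        identity = S.trans (ext λ n → *-congˡ (at F≋Π n)) (S.trans (newton rs inverses) (S.*-congʳ {powerSums (map proj₂ rs)} (S.sym F≋Π)))
          where F≋Π = factorization constantHom (f₀ ∷ f₁ ∷ fs) (map proj₁ rs) len distinct roots y

        G : Seq
        G = constant f₀ +ₛ y *ₛ constant f₁

        F≋G : F ≋[ 2 ℕ.+ t ] G
        F≋G {zero}        _             = +-congˡ (trans (y*-zero (MS.evalMonic (map constant (f₁ ∷ fs)) y)) (sym (y*-zero (constant f₁))))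
        F≋G {suc n} (s≤s (s≤s n≤t)) = +-congˡ (trans (y*-suc (MS.evalMonic (map constant (f₁ ∷ fs)) y) n)
          (trans (*-congˡ (tail n n≤t)) (sym (y*-suc (constant f₁) n))))
          where
          tail : ∀ n → n ℕ.≤ t → MS.evalMonic (map constant (f₁ ∷ fs)) y n ≈ constant f₁ n
          tail zero    _   = trans (+-congˡ (y*-zero (MS.evalMonic (map constant fs) y))) (+-identityʳ _)
          tail (suc n) n<t = trans (evalMonic-coefficient (f₁ ∷ fs) (suc n)) (trans (*-congˡ (gap n<t)) (zeroʳ _))

        G*-suc : ∀ h n → (G *ₛ h) (suc n) ≈ f₀ * h (suc n) + σ * f₁ * h n
        G*-suc h n = begin
          (G *ₛ h) (suc n)                                              ≈⟨ distribₛ (suc n) h (constant f₀) (y *ₛ constant f₁) ⟩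
          (constant f₀ *ₛ h) (suc n) + (y *ₛ constant f₁ *ₛ h) (suc n)    ≈⟨ +-cong (constant-* f₀ h (suc n)) (assocₛ (suc n) y (constant f₁) h) ⟩
          f₀ * h (suc n) + (y *ₛ (constant f₁ *ₛ h)) (suc n)            ≈⟨ +-congˡ (y*-suc (constant f₁ *ₛ h) n) ⟩
          f₀ * h (suc n) + σ * (constant f₁ *ₛ h) n                     ≈⟨ +-congˡ (trans (*-congˡ (constant-* f₁ h n)) (sym (*-assoc _ _ _))) ⟩
          f₀ * h (suc n) + σ * f₁ * h n                                 ∎

        recursion : ∀ {n} → n ℕ.≤ t → θ G (suc n) ≈ f₀ * p (suc n) + σ * f₁ * powerSums (map proj₂ rs) n
        recursion {n} n≤t = begin
          θ G (suc n)                                  ≈⟨ *-congˡ (F≋G (s≤s (s≤s n≤t))) ⟨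
          θ F (suc n)                                  ≈⟨ at identity (suc n) ⟩
          (F *ₛ powerSums (map proj₂ rs)) (suc n)      ≈⟨ *ₛ-cong[] F≋G (λ _ → refl) (s≤s (s≤s n≤t)) ⟩
          (G *ₛ powerSums (map proj₂ rs)) (suc n)      ≈⟨ G*-suc (powerSums (map proj₂ rs)) n ⟩
          f₀ * p (suc n) + σ * f₁ * powerSums (map proj₂ rs) n ∎

      -- θG has only its linear term: the recursion starts with f₀p(1) = σf₁ = f₀w, and from then on
      -- f₀p(n + 1) = σf₁p(n) = f₀w·p(n).
      power-sum : ∀ {n} → n ℕ.≤ t → p (suc n) ≈ w ^ suc n
      power-sum {zero} 0≤t = regular-cancel f₀-regular (begin
        f₀ * p 1                    ≈⟨ +-identityʳ _ ⟨
        f₀ * p 1 + 0#               ≈⟨ +-congˡ (zeroʳ _) ⟨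
        f₀ * p 1 + σ * f₁ * 0#      ≈⟨ recursion 0≤t ⟨
        1# * G 1                    ≈⟨ trans (*-identityˡ _) (+-identityˡ _) ⟩
        (y *ₛ constant f₁) 1        ≈⟨ y*-suc (constant f₁) 0 ⟩
        σ * f₁                      ≈⟨ f₀w≈σf₁ ⟨
        f₀ * w                      ≈⟨ *-congˡ (*-identityʳ w) ⟨
        f₀ * (w * 1#)               ∎)
      power-sum {suc n} n<t = regular-cancel f₀-regular (begin
        f₀ * p (2 ℕ.+ n)            ≈⟨ K₂.x+y≈0⇒x≈y (trans (sym (recursion n<t)) θG≈0) ⟩
        σ * f₁ * p (suc n)          ≈⟨ *-cong (sym f₀w≈σf₁) (power-sum (ℕₚ.<⇒≤ n<t)) ⟩
        f₀ * w * w ^ suc n          ≈⟨ *-assoc _ _ _ ⟩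
        f₀ * (w * w ^ suc n)        ∎)
        where
        θG≈0 : θ G (2 ℕ.+ n) ≈ 0#
        θG≈0 = trans (*-congˡ (trans (+-identityˡ _) (trans (y*-suc (constant f₁) (suc n)) (zeroʳ σ)))) (zeroʳ _)

module 𝔽 = Series 𝔽₂

ones : 𝔽.Seq
ones _ = 1ℙ

-- 1/(1 - q^d)
geometric : ℕ → 𝔽.Seq
geometric d = 𝔽.sub d ones

double : ℕ → ℕ
double zero    = 0
double (suc n) = suc (suc (double n))

double≡ : ∀ n → double n ≡ n ℕ.+ n
double≡ zero    = ≡.refl
double≡ (suc n) = ≡.cong suc (≡.trans (≡.cong suc (double≡ n)) (≡.sym (ℕₚ.+-suc n n)))

-- The ring of cyclotomic integers modulo 2

private
  module F = CharTwoRing 𝔽₂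
  open import Algebra.Properties.CommutativeSemigroup F.+-commutativeSemigroup using () renaming (interchange to +-interchange)

  x+y≡0⇒x≡y : ∀ x y → x ℙ.+ y ≡ 0ℙ → x ≡ y
  x+y≡0⇒x≡y x y = CharTwo.x+y≈0⇒x≈y 𝔽₂

window : ℕ → 𝔽.Seq → Parity
window zero    g = 0ℙ
window (suc k) g = g 0 ℙ.+ window k (g ∘ suc)

window-cong : ∀ k {g h} → (∀ n → g n ≡ h n) → window k g ≡ window k h
window-cong zero    e = ≡.refl
window-cong (suc k) e = ≡.cong₂ ℙ._+_ (e 0) (window-cong k (e ∘ suc))

window-+ : ∀ k g h → window k (λ n → g n ℙ.+ h n) ≡ window k g ℙ.+ window k h
window-+ zero    g h = ≡.refl
window-+ (suc k) g h = ≡.trans (≡.cong (g 0 ℙ.+ h 0 ℙ.+_) (window-+ k (g ∘ suc) (h ∘ suc))) (+-interchange (g 0) (h 0) _ _)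

window-0 : ∀ k → window k (λ _ → 0ℙ) ≡ 0ℙ
window-0 zero    = ≡.refl
window-0 (suc k) = window-0 k

window-last : ∀ k g → window (suc k) g ≡ window k g ℙ.+ g k
window-last zero    g = ≡.trans (ℙₚ.+-identityʳ (g 0)) ≡.refl
window-last (suc k) g = ≡.trans (≡.cong (g 0 ℙ.+_) (window-last k (g ∘ suc))) (≡.sym (ℙₚ.+-assoc (g 0) _ _))

-- 𝔽₂[ζ]/(1 + ζ + … + ζ^a′), a′ = a - 1: polynomial expressions in the shift operator,
-- acting on the sequences all of whose sums over windows of length a vanish.
module Cyclotomic (a′ : ℕ) where

  a : ℕ
  a = suc a′

  Balanced : 𝔽.Seq → Set
  Balanced g = ∀ n → window a (λ i → g (n ℕ.+ i)) ≡ 0ℙ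

  infixl 6 _⊞_
  infixl 7 _⊠_
  data Operator : Set where
    𝟘 𝟙 ζ   : Operator
    _⊞_ _⊠_ : Operator → Operator → Operator

  act : Operator → 𝔽.Seq → 𝔽.Seq
  act 𝟘       g n = 0ℙ
  act 𝟙       g n = g n
  act ζ       g n = g (suc n)
  act (p ⊞ q) g n = act p g n ℙ.+ act q g n
  act (p ⊠ q) g   = act p (act q g)

  act-cong : ∀ p {g h} → (∀ n → g n ≡ h n) → ∀ n → act p g n ≡ act p h n
  act-cong 𝟘       e n = ≡.refl
  act-cong 𝟙       e n = e n
  act-cong ζ       e n = e (suc n)
  act-cong (p ⊞ q) e n = ≡.cong₂ ℙ._+_ (act-cong p e n) (act-cong q e n)
  act-cong (p ⊠ q) e   = act-cong p (act-cong q e)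

  act-+ : ∀ p g h n → act p (λ k → g k ℙ.+ h k) n ≡ act p g n ℙ.+ act p h n
  act-+ 𝟘       g h n = ≡.refl
  act-+ 𝟙       g h n = ≡.refl
  act-+ ζ       g h n = ≡.refl
  act-+ (p ⊞ q) g h n = ≡.trans (≡.cong₂ ℙ._+_ (act-+ p g h n) (act-+ q g h n)) (+-interchange (act p g n) (act p h n) _ _)
  act-+ (p ⊠ q) g h n = ≡.trans (act-cong p (act-+ q g h) n) (act-+ p (act q g) (act q h) n)

  act-0 : ∀ p n → act p (λ _ → 0ℙ) n ≡ 0ℙ
  act-0 𝟘       n = ≡.refl
  act-0 𝟙       n = ≡.refl
  act-0 ζ       n = ≡.refl
  act-0 (p ⊞ q) n = ≡.cong₂ ℙ._+_ (act-0 p n) (act-0 q n)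
  act-0 (p ⊠ q) n = ≡.trans (act-cong p (act-0 q) n) (act-0 p n)

  act-shift : ∀ p g n → act p (g ∘ suc) n ≡ act p g (suc n)
  act-shift 𝟘       g n = ≡.refl
  act-shift 𝟙       g n = ≡.refl
  act-shift ζ       g n = ≡.refl
  act-shift (p ⊞ q) g n = ≡.cong₂ ℙ._+_ (act-shift p g n) (act-shift q g n)
  act-shift (p ⊠ q) g n = ≡.trans (act-cong p (act-shift q g) n) (act-shift p (act q g) n)

  act-comm : ∀ p q g n → act p (act q g) n ≡ act q (act p g) n
  act-comm 𝟘        q g n = ≡.sym (act-0 q n)
  act-comm 𝟙        q g n = ≡.refl
  act-comm ζ        q g n = ≡.sym (act-shift q g n)
  act-comm (p ⊞ p′) q g n = ≡.trans (≡.cong₂ ℙ._+_ (act-comm p q g n) (act-comm p′ q g n)) (≡.sym (act-+ q (act p g) (act p′ g) n))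
  act-comm (p ⊠ p′) q g n = ≡.trans (act-cong p (act-comm p′ q g) n) (act-comm p q (act p′ g) n)

  act-balanced : ∀ p {g} → Balanced g → Balanced (act p g)
  act-balanced 𝟘           b n = window-0 a
  act-balanced 𝟙           b n = b n
  act-balanced ζ           b n = b (suc n)
  act-balanced (p ⊞ q) {g} b n = ≡.trans (window-+ a (λ i → act p g (n ℕ.+ i)) (λ i → act q g (n ℕ.+ i)))
    (≡.cong₂ ℙ._+_ (act-balanced p {g} b n) (act-balanced q {g} b n))
  act-balanced (p ⊠ q) {g} b = act-balanced p {act q g} (act-balanced q {g} b)

  infix 4 _≃_
  -- Comparing operators by their action on balanced sequences performs the quotient without normal
  -- forms or division, and makes most ring axioms hold by computation.
  record _≃_ (p q : Operator) : Set where
    constructor mk≃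
    field same : ∀ {g} → Balanced g → ∀ n → act p g n ≡ act q g n
  open _≃_ public

  ring : CharTwoRing
  ring = record
    { commutativeSemiring = record
      { Carrier = Operator ; _≈_ = _≃_ ; _+_ = _⊞_ ; _*_ = _⊠_ ; 0# = 𝟘 ; 1# = 𝟙
      ; isCommutativeSemiring = isCommutativeSemiringˡ record
        { +-isCommutativeMonoid = record
          { isMonoid = record
            { isSemigroup = record
              { isMagma = record
                { isEquivalence = isEquivalence
                ; ∙-cong = λ e e′ → mk≃ λ b n → ≡.cong₂ ℙ._+_ (same e b n) (same e′ b n) }
              ; assoc = λ p q r → mk≃ λ {g} b n → ℙₚ.+-assoc (act p g n) _ _ }
            ; identity = (λ p → mk≃ λ b n → ≡.refl) , (λ p → mk≃ λ b n → ℙₚ.+-identityʳ _) }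
          ; comm = λ p q → mk≃ λ {g} b n → ℙₚ.+-comm (act p g n) _ }
        ; *-isCommutativeMonoid = record
          { isMonoid = record
            { isSemigroup = record
              { isMagma = record
                { isEquivalence = isEquivalence
                ; ∙-cong = λ {p} {p′} {q} {q′} e e′ → mk≃ λ {g} b n →
                    ≡.trans (act-cong p (same e′ {g} b) n) (same e {act q′ g} (act-balanced q′ {g} b) n) }
              ; assoc = λ p q r → mk≃ λ b n → ≡.refl }
            ; identity = (λ p → mk≃ λ b n → ≡.refl) , (λ p → mk≃ λ b n → ≡.refl) }
          ; comm = λ p q → mk≃ λ {g} b n → act-comm p q g n }
        ; distribʳ = λ r p q → mk≃ λ b n → ≡.refl
        ; zeroˡ = λ p → mk≃ λ b n → ≡.refl
        }
      }
    ; x+x≈0 = λ p → mk≃ λ {g} b n → F.x+x≈0 (act p g n)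
    }
    where
    isEquivalence : IsEquivalence _≃_
    isEquivalence = record
      { refl  = mk≃ λ b n → ≡.refl
      ; sym   = λ e → mk≃ λ b n → ≡.sym (same e b n)
      ; trans = λ e e′ → mk≃ λ b n → ≡.trans (same e b n) (same e′ b n) }

  open CharTwoRing ring
  open CharTwo ring
  open import Relation.Binary.Reasoning.Setoid setoid

  act-ζ^ : ∀ k g n → act (ζ ^ k) g n ≡ g (n ℕ.+ k)
  act-ζ^ zero    g n = ≡.cong g (≡.sym (ℕₚ.+-identityʳ n))
  act-ζ^ (suc k) g n = ≡.trans (act-ζ^ k g (suc n)) (≡.cong g (≡.sym (ℕₚ.+-suc n k)))

  -- The windows starting at n and at n + 1 differ only in g(n) and g(n + a), and both have sum
  -- zero.
  ζ^a≈1 : ζ ^ a ≈ 1#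
  ζ^a≈1 = mk≃ λ {g} b n → ≡.trans (act-ζ^ a g n) (x+y≡0⇒x≡y _ _ (
    ≡.trans (cancel (g (n ℕ.+ a)) (M g n) (g n)) (≡.cong₂ ℙ._+_ (upper g b n) (lower g b n))))
    where
    M : 𝔽.Seq → ℕ → Parity
    M g n = window a′ (λ i → g (n ℕ.+ suc i))
    cancel : ∀ x m y → x ℙ.+ y ≡ (m ℙ.+ x) ℙ.+ (y ℙ.+ m)
    cancel 0ℙ 0ℙ 0ℙ = ≡.refl
    cancel 0ℙ 0ℙ 1ℙ = ≡.refl
    cancel 0ℙ 1ℙ 0ℙ = ≡.refl
    cancel 0ℙ 1ℙ 1ℙ = ≡.refl
    cancel 1ℙ 0ℙ 0ℙ = ≡.refl
    cancel 1ℙ 0ℙ 1ℙ = ≡.refl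
    cancel 1ℙ 1ℙ 0ℙ = ≡.refl
    cancel 1ℙ 1ℙ 1ℙ = ≡.refl
    lower : ∀ g → Balanced g → ∀ n → g n ℙ.+ M g n ≡ 0ℙ
    lower g b n = ≡.trans (≡.cong (λ m → g m ℙ.+ M g n) (≡.sym (ℕₚ.+-identityʳ n))) (b n)
    upper : ∀ g → Balanced g → ∀ n → M g n ℙ.+ g (n ℕ.+ a) ≡ 0ℙ
    upper g b n = ≡.trans (≡.sym (window-last a′ (λ i → g (n ℕ.+ suc i))))
      (≡.trans (window-cong a (λ i → ≡.cong g (ℕₚ.+-suc n i))) (b (suc n)))

  geometricSum : Carrier → ℕ → Carrier
  geometricSum z zero    = 0#
  geometricSum z (suc n) = geometricSum z n + z ^ n

  [1+z]*geometricSum : ∀ z n → (1# + z) * geometricSum z n ≈ 1# + z ^ n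
  [1+z]*geometricSum z zero    = trans (zeroʳ _) (sym (x+x≈0 1#))
  [1+z]*geometricSum z (suc n) = begin
    (1# + z) * (geometricSum z n + z ^ n)                ≈⟨ distribˡ _ _ _ ⟩
    (1# + z) * geometricSum z n + (1# + z) * z ^ n       ≈⟨ +-congʳ ([1+z]*geometricSum z n) ⟩
    1# + z ^ n + (1# + z) * z ^ n                        ≈⟨ solve 2 (λ z w → con 1ℙ :+ w :+ (con 1ℙ :+ z) :* w := con 1ℙ :+ z :* w) refl z (z ^ n) ⟩
    1# + z ^ suc n                                       ∎
    where open Solver

  geometricSum-ζ : geometricSum ζ a ≈ 0#
  geometricSum-ζ = mk≃ λ {g} b n → ≡.trans (go a g n) (b n)
    where
    go : ∀ k g n → act (geometricSum ζ k) g n ≡ window k (λ i → g (n ℕ.+ i))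
    go zero    g n = ≡.refl
    go (suc k) g n = ≡.trans (≡.cong₂ ℙ._+_ (go k g n) (act-ζ^ k g n)) (≡.sym (window-last k (λ i → g (n ℕ.+ i))))

  oddSum : ℕ → Carrier
  oddSum zero    = 0#
  oddSum (suc h) = oddSum h + ζ ^ suc (double h)

  -- For 2h = a - 1 the right-hand side is zero, so `oddSum h` becomes the inverse of 1 + ζ: since a
  -- is odd, the powers ζ, ..., ζ^(a - 1) group into pairs ζʲ(1 + ζ) with j odd.
  [1+ζ]*oddSum : ∀ h → (1# + ζ) * oddSum h + 1# ≈ geometricSum ζ (suc (double h))
  [1+ζ]*oddSum zero    = +-congʳ (zeroʳ _)
  [1+ζ]*oddSum (suc h) = begin
    (1# + ζ) * (oddSum h + w) + 1#             ≈⟨ solve 3 (λ z s w → (con 1ℙ :+ z) :* (s :+ w) :+ con 1ℙ := ((con 1ℙ :+ z) :* s :+ con 1ℙ) :+ w :+ z :* w) refl ζ (oddSum h) w ⟩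
    ((1# + ζ) * oddSum h + 1#) + w + ζ * w     ≈⟨ +-congʳ (+-congʳ ([1+ζ]*oddSum h)) ⟩
    geometricSum ζ (suc (double (suc h)))      ∎
    where
    open Solver
    w = ζ ^ suc (double h)

  Unit : Carrier → Set
  Unit x = ∃ λ y → x * y ≈ 1#

  ζ^a*≈1 : ∀ y → ζ ^ (y ℕ.* a) ≈ 1#
  ζ^a*≈1 y = trans (sym (trans (^-assocʳ ζ a y) (reflexive (≡.cong (ζ ^_) (ℕₚ.*-comm a y))))) (trans (^-congˡ y ζ^a≈1) (1^ y))
    where
    1^ : ∀ y → 1# ^ y ≈ 1#
    1^ zero    = refl
    1^ (suc y) = trans (*-identityˡ _) (1^ y)

  module _ (h : ℕ) (odd : a′ ≡ double h) where

    1+ζ-inverse : (1# + ζ) * oddSum h ≈ 1#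
    1+ζ-inverse = x+y≈0⇒x≈y (trans ([1+ζ]*oddSum h) (trans (reflexive (≡.cong (geometricSum ζ ∘ suc) (≡.sym odd))) geometricSum-ζ))

    -- By Bézout some power of z = ζᵏ is ζ or its inverse, and 1 + z divides 1 + z^y; so 1 + ζᵏ
    -- divides the unit 1 + ζ up to a power of ζ.
    1+ζ^k-unit : ∀ k → Coprime a k → Unit (1# + ζ ^ k)
    1+ζ^k-unit k coprime with coprime-Bézout coprime
    ... | Bézout.-+ x y 1+xa≡yk = geometricSum z y * oddSum h , (begin
      (1# + z) * (geometricSum z y * oddSum h)    ≈⟨ *-assoc _ _ _ ⟨
      (1# + z) * geometricSum z y * oddSum h      ≈⟨ *-congʳ ([1+z]*geometricSum z y) ⟩
      (1# + z ^ y) * oddSum h                     ≈⟨ *-congʳ (+-congˡ z^y≈ζ) ⟩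
      (1# + ζ) * oddSum h                         ≈⟨ 1+ζ-inverse ⟩
      1#                                          ∎)
      where
      z = ζ ^ k
      z^y≈ζ : z ^ y ≈ ζ
      z^y≈ζ = begin
        z ^ y                ≈⟨ ^-assocʳ ζ k y ⟩
        ζ ^ (k ℕ.* y)        ≈⟨ reflexive (≡.cong (ζ ^_) (≡.trans (ℕₚ.*-comm k y) (≡.sym 1+xa≡yk))) ⟩
        ζ * ζ ^ (x ℕ.* a)    ≈⟨ *-congˡ (ζ^a*≈1 x) ⟩
        ζ * 1#               ≈⟨ *-identityʳ ζ ⟩
        ζ                    ∎
    -- Here z^y is the inverse of ζ, and the extra factor ζ turns 1 + z^y into ζ + 1.
    ... | Bézout.+- x y 1+yk≡xa = geometricSum z y * (ζ * oddSum h) , (begin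
      (1# + z) * (geometricSum z y * (ζ * oddSum h))  ≈⟨ *-assoc _ _ _ ⟨
      (1# + z) * geometricSum z y * (ζ * oddSum h)    ≈⟨ *-congʳ ([1+z]*geometricSum z y) ⟩
      (1# + z ^ y) * (ζ * oddSum h)                   ≈⟨ solve 3 (λ w z s → (con 1ℙ :+ w) :* (z :* s) := (z :* w :+ z) :* s) refl (z ^ y) ζ (oddSum h) ⟩
      (ζ * z ^ y + ζ) * oddSum h                      ≈⟨ *-congʳ (+-congʳ ζz^y≈1) ⟩
      (1# + ζ) * oddSum h                             ≈⟨ 1+ζ-inverse ⟩
      1#                                              ∎)
      where
      open Solver
      z = ζ ^ k
      ζz^y≈1 : ζ * z ^ y ≈ 1#
      ζz^y≈1 = begin
        ζ * z ^ y            ≈⟨ *-congˡ (^-assocʳ ζ k y) ⟩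
        ζ ^ suc (k ℕ.* y)    ≈⟨ reflexive (≡.cong (ζ ^_) (≡.trans (≡.cong suc (ℕₚ.*-comm k y)) 1+yk≡xa)) ⟩
        ζ ^ (x ℕ.* a)        ≈⟨ ζ^a*≈1 x ⟩
        1#                   ∎

  -- The sequence s(n) + s(n + 1), with s the indicator of the multiples of a, is balanced.
  faithful : ∀ b → a′ ≡ suc b → ∀ c → ⟨ c ⟩ ≈ 0# → c ≡ 0ℙ
  faithful b a′≡1+b 0ℙ _ = ≡.refl
  faithful b a′≡1+b 1ℙ e = ≡.trans (≡.sym g0≡1) (same e {g} balanced 0)
    where
    s g : 𝔽.Seq
    s = geometric a
    g n = s n ℙ.+ s (suc n)

    telescope : ∀ k n → window k (λ i → g (n ℕ.+ i)) ≡ s n ℙ.+ s (n ℕ.+ k)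
    telescope zero    n = ≡.sym (≡.trans (≡.cong (λ m → s n ℙ.+ s m) (ℕₚ.+-identityʳ n)) (F.x+x≈0 (s n)))
    telescope (suc k) n = ≡.trans (window-last k (λ i → g (n ℕ.+ i)))
      (≡.trans (≡.cong (ℙ._+ g (n ℕ.+ k)) (telescope k n)) (≡.trans (cancel (s n) (s (n ℕ.+ k)) (s (suc (n ℕ.+ k))))
        (≡.cong (λ m → s n ℙ.+ s m) (≡.sym (ℕₚ.+-suc n k)))))
      where
      cancel : ∀ x y z → (x ℙ.+ y) ℙ.+ (y ℙ.+ z) ≡ x ℙ.+ z
      cancel 0ℙ 0ℙ z  = ≡.refl
      cancel 0ℙ 1ℙ 0ℙ = ≡.refl
      cancel 0ℙ 1ℙ 1ℙ = ≡.refl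
      cancel 1ℙ 0ℙ z  = ≡.refl
      cancel 1ℙ 1ℙ z  = ≡.refl

    balanced : Balanced g
    balanced n = ≡.trans (telescope a n) (≡.trans
      (≡.cong (s n ℙ.+_) (≡.trans (≡.cong s (ℕₚ.+-comm n a)) (𝔽.spread-strip a′ ones a′ n))) (F.x+x≈0 (s n)))

    -- This uses a ≥ 2: then s(0) = 1 while s(1) = 0.
    g0≡1 : g 0 ≡ 1ℙ
    g0≡1 rewrite a′≡1+b = ≡.refl

-- The trace of a modular equation

module Twist (K : CharTwoRing) where
  open CharTwoRing K
  open CharTwo K
  open Series K
  open import Relation.Binary.Reasoning.Setoid setoid
  open import Algebra.Properties.CommutativeSemigroup *-commutativeSemigroup using (interchange; x∙yz≈y∙xz)

  1^ : ∀ n → 1# ^ n ≈ 1#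
  1^ zero    = refl
  1^ (suc n) = trans (*-identityˡ _) (1^ n)

  twist : Carrier → 𝔽.Seq → Seq
  twist z f n = ⟨ f n ⟩ * z ^ n

  twist-* : ∀ z f g n → (twist z f *ₛ twist z g) n ≈ twist z (f 𝔽.*ₛ g) n
  twist-* z f g zero    = trans (interchange _ _ _ _) (*-cong (sym (⟨⟩-* (f 0) (g 0))) (*-identityˡ _))
  twist-* z f g (suc n) = begin
    ⟨ f 0 ⟩ * 1# * (⟨ g (suc n) ⟩ * z ^ suc n) + ((twist z f ∘ suc) *ₛ twist z g) n
      ≈⟨ +-cong (trans (interchange _ _ _ _) (*-cong (sym (⟨⟩-* (f 0) (g (suc n)))) (*-identityˡ _)))
                (trans (*ₛ-cong n (λ k → x∙yz≈y∙xz _ _ _) (λ _ → refl)) (scaleₛ n z (twist z (f ∘ suc)) (twist z g))) ⟩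
    ⟨ f 0 ℙ.* g (suc n) ⟩ * z ^ suc n + z * (twist z (f ∘ suc) *ₛ twist z g) n
      ≈⟨ +-congˡ (trans (*-congˡ (twist-* z (f ∘ suc) g n)) (x∙yz≈y∙xz _ _ _)) ⟩
    ⟨ f 0 ℙ.* g (suc n) ⟩ * z ^ suc n + ⟨ ((f ∘ suc) 𝔽.*ₛ g) n ⟩ * z ^ suc n
      ≈⟨ trans (*-congʳ (⟨⟩-+ (f 0 ℙ.* g (suc n)) _)) (distribʳ _ _ _) ⟨
    ⟨ (f 𝔽.*ₛ g) (suc n) ⟩ * z ^ suc n ∎

  twistHom : Carrier → Hom 𝔽.series series
  twistHom z = record
    { apply  = twist z
    ; cong   = λ f≋g → ext λ n → reflexive (≡.cong (λ c → ⟨ c ⟩ * z ^ n) (𝔽.at f≋g n))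
    ; +-homo = λ f g → ext λ n → trans (*-congʳ (⟨⟩-+ (f n) (g n))) (distribʳ _ _ _)
    ; *-homo = λ f g → ext λ n → sym (twist-* z f g n)
    ; 0-homo = ext λ n → zeroˡ _
    ; 1-homo = ext λ { zero → *-identityˡ _ ; (suc n) → zeroˡ _ }
    }

  twist-spread : ∀ z m f c n → z ^ suc m ≈ 1# → ⟨ 𝔽.spread m f c n ⟩ * z ^ n ≈ ⟨ 𝔽.spread m f c n ⟩ * z ^ c
  twist-spread z m f zero    zero    e = refl
  twist-spread z m f zero    (suc n) e = begin
    ⟨ 𝔽.spread m (f ∘ suc) m n ⟩ * (z * z ^ n)  ≈⟨ x∙yz≈y∙xz _ _ _ ⟩
    z * (⟨ 𝔽.spread m (f ∘ suc) m n ⟩ * z ^ n)  ≈⟨ *-congˡ (twist-spread z m (f ∘ suc) m n e) ⟩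
    z * (⟨ 𝔽.spread m (f ∘ suc) m n ⟩ * z ^ m)  ≈⟨ x∙yz≈y∙xz _ _ _ ⟩
    ⟨ 𝔽.spread m (f ∘ suc) m n ⟩ * z ^ suc m    ≈⟨ *-congˡ e ⟩
    ⟨ 𝔽.spread m (f ∘ suc) m n ⟩ * 1#           ∎
  twist-spread z m f (suc c) zero    e = trans (zeroˡ _) (sym (zeroˡ _))
  twist-spread z m f (suc c) (suc n) e = trans (x∙yz≈y∙xz _ _ _) (trans (*-congˡ (twist-spread z m f c n e)) (x∙yz≈y∙xz _ _ _))

  -- A series in q^(1 + m) does not see the substitution q ↦ zq when z^(1 + m) = 1; `twist-spread`
  -- carries the offset that the induction needs.
  twist-sub : ∀ z m f → z ^ suc m ≈ 1# → twist z (𝔽.sub (suc m) f) ≋ twist 1# (𝔽.sub (suc m) f)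
  twist-sub z m f e = ext λ n → trans (twist-spread z m f 0 n e) (*-congˡ (sym (1^ n)))

  *ₛ-drop : ∀ k f x j → f ≋[ k ] 0ₛ → (f *ₛ x) (k ℕ.+ j) ≈ ((λ n → f (k ℕ.+ n)) *ₛ x) j
  *ₛ-drop zero    f x j p = refl
  *ₛ-drop (suc k) f x j p = begin
    f 0 * x (suc (k ℕ.+ j)) + ((f ∘ suc) *ₛ x) (k ℕ.+ j)
      ≈⟨ +-cong (trans (*-congʳ (p (s≤s z≤n))) (zeroˡ _)) (*ₛ-drop k (f ∘ suc) x j (λ i<k → p (s≤s i<k))) ⟩
    0# + ((λ n → f (suc k ℕ.+ n)) *ₛ x) j   ≈⟨ +-identityˡ _ ⟩
    ((λ n → f (suc k ℕ.+ n)) *ₛ x) j        ∎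

  -- Removing the factor q^k leaves a series with invertible constant term.
  leading-unit⇒regular : ∀ k f {u} → f ≋[ k ] 0ₛ → f k * u ≈ 1# → Monic.Regular series f
  leading-unit⇒regular k f {u} vanish unit x fx≋0 = ≋[]⇒≋ λ n → cancel-unit {f = x} {g} {u} g-unit λ {j} _ → begin
    (x *ₛ g) j             ≈⟨ commₛ j x g ⟩
    (g *ₛ x) j             ≈⟨ *ₛ-drop k f x j vanish ⟨
    (f *ₛ x) (k ℕ.+ j)     ≈⟨ at fx≋0 (k ℕ.+ j) ⟩
    0#                     ∎
    where
    g : Seq
    g n = f (k ℕ.+ n)
    g-unit : g 0 * u ≈ 1#
    g-unit = trans (*-congʳ (reflexive (≡.cong f (ℕₚ.+-identityʳ k)))) unit

module Regularity (K : CharTwoRing) where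
  open CharTwoRing K
  open Monic K

  regular-^ : ∀ {c} n → Regular c → Regular (c ^ n)
  regular-^ zero    reg x e = trans (sym (*-identityˡ x)) e
  regular-^ (suc n) reg x e = regular-^ n reg x (reg _ (trans (sym (*-assoc _ _ _)) e))

  regular-cong : ∀ {c d} → c ≈ d → Regular c → Regular d
  regular-cong c≈d reg x e = reg x (trans (*-congʳ c≈d) e)

-- The polynomial x^(a+1) + xy + … + y^(a+1) with the given coefficients of y², …, y^a.
monicEquation : ℕ → Poly₂ → Poly₂
monicEquation a rows = (replicate (suc a) 0ℙ ++ 1ℙ ∷ []) ∷ (0ℙ ∷ 1ℙ ∷ []) ∷ rows ++ (1ℙ ∷ []) ∷ []

-- Used twice: with φ = η and m = 24, and with φ = η³ and m = 8. The series ψ is 1/φ. The exponent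
-- of the resulting congruence is t + 1, because the t coefficients of y², ..., y^(t + 1) are asked
-- to vanish.
module Trace
  (b h m′ : ℕ) (a-odd : suc b ≡ double h) (a-prime : Prime (2 ℕ.+ b))
  (φ ψ : 𝔽.Seq) (φ-unit : φ 0 ≡ 1ℙ) (ψ*φ≋1 : ψ 𝔽.*ₛ φ 𝔽.≋ 𝔽.1ₛ)
  (rows : Poly₂) (t : ℕ)
  where

  a m : ℕ
  a = 2 ℕ.+ b
  m = suc m′

  H : 𝔽.Seq
  H = 𝔽.X 𝔽.*ₛ 𝔽.sub m φ

  equation : Poly₂
  equation = monicEquation a rows

  module E𝔽 = Evaluation 𝔽.series

  module _
    (degree : length rows ≡ suc b)
    (below : E𝔽.eval₂ equation H (𝔽.sub a H) 𝔽.≋ 𝔽.0ₛ)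
    (above : E𝔽.eval₂ equation (𝔽.sub a H) H 𝔽.≋ 𝔽.0ₛ)
    (gap : T (isZero₂ (take t rows))) (t≤ : t ℕ.≤ length rows)
    where

    open Cyclotomic (suc b) using (ζ; ζ^a*≈1; 1+ζ^k-unit; faithful; Unit) renaming (ring to R)
    private
      module R = CharTwoRing R
      module R₂ = CharTwo R
    open Series R
    open Twist R
    open PowerSums series using (powerSum; power-sum)
    open Monic series
    open Regularity series
    private
      module EL = Evaluation series
      module L₂ = CharTwo series
    import Relation.Binary.Reasoning.Setoid S.setoid as ≋-Reasoning
    import Relation.Binary.Reasoning.Setoid R.setoid as ≃-Reasoning

    private
      r₀ r₁ : Poly₁
      r₀ = replicate (suc a) 0ℙ ++ 1ℙ ∷ []
      r₁ = 0ℙ ∷ 1ℙ ∷ []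

      subₐ : 𝔽.Seq → 𝔽.Seq
      subₐ = 𝔽.sub a

      z^a≈1 : ∀ i → (ζ R.^ i) R.^ a R.≈ R.1#
      z^a≈1 i = R.trans (R.^-assocʳ ζ i a) (ζ^a*≈1 i)

      -- This is q^(a²)/H; the exponent of q is (a - 1)(a + 1) = a² - 1, written without
      -- subtraction.
      D : 𝔽.Seq
      D = 𝔽.X 𝔽.S.^ (suc b ℕ.+ a ℕ.* suc b) 𝔽.*ₛ 𝔽.sub m ψ

      w d : ℕ → Seq
      w i = twist (ζ R.^ i) H
      d i = twist (ζ R.^ i) D

      ι : 𝔽.Seq → Seq
      ι = twist R.1#
      module ι = Hom (twistHom R.1#)

      -- Over the base e = H(qᵃ) the roots are x₀ = H(q^(a²)) and the conjugates H(ζⁱq). The factor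
      -- σ = q^(a²) clears the denominators of their inverses, and v = σ/eᵃ is the expected value of
      -- the first power sum.
      x₀ d₀ e σ v : Seq
      x₀ = ι (subₐ (subₐ H))
      d₀ = ι (subₐ (subₐ (𝔽.sub m ψ)))
      e  = ι (subₐ H)
      σ  = ι (subₐ (subₐ 𝔽.X))
      v  = ι (subₐ (𝔽.sub m ψ)) S.^ a

      H*ψ≋X : H 𝔽.*ₛ 𝔽.sub m ψ 𝔽.≋ 𝔽.X
      H*ψ≋X = S′.trans (S′.*-assoc 𝔽.X _ _) (S′.trans (S′.*-congˡ {𝔽.X} (S′.trans (S′.sym (Hom.*-homo (𝔽.subHom m′) φ ψ))
        (S′.trans (Hom.cong (𝔽.subHom m′) (S′.trans (S′.*-comm φ ψ) ψ*φ≋1)) (Hom.1-homo (𝔽.subHom m′))))) (S′.*-identityʳ 𝔽.X))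
        where module S′ = 𝔽.S

      module subₐ = Hom (𝔽.subHom (suc b))

      inverse₀ : x₀ *ₛ d₀ ≋ σ
      inverse₀ = S.trans (S.sym (ι.*-homo (subₐ (subₐ H)) (subₐ (subₐ (𝔽.sub m ψ)))))
        (ι.cong (𝔽.S.trans (𝔽.S.sym (subₐ.*-homo (subₐ H) (subₐ (𝔽.sub m ψ))))
          (subₐ.cong (𝔽.S.trans (𝔽.S.sym (subₐ.*-homo H (𝔽.sub m ψ))) (subₐ.cong H*ψ≋X)))))

      H*D≋ : H 𝔽.*ₛ D 𝔽.≋ subₐ (subₐ 𝔽.X)
      H*D≋ = begin
        H 𝔽.*ₛ (Xⁿ 𝔽.*ₛ 𝔽.sub m ψ)         ≈⟨ solve 3 (λ H X ψ → H :* (X :* ψ) := (H :* ψ) :* X) 𝔽.S.refl H Xⁿ (𝔽.sub m ψ) ⟩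
        (H 𝔽.*ₛ 𝔽.sub m ψ) 𝔽.*ₛ Xⁿ         ≈⟨ 𝔽.S.*-congʳ {Xⁿ} H*ψ≋X ⟩
        𝔽.X 𝔽.*ₛ Xⁿ                        ≈⟨ 𝔽.S.reflexive (≡.cong (𝔽.X 𝔽.S.^_) (≡.sym (ℕₚ.*-suc a (suc b)))) ⟩
        𝔽.X 𝔽.S.^ (a ℕ.* a)                ≈⟨ 𝔽.S.^-assocʳ 𝔽.X a a ⟨
        (𝔽.X 𝔽.S.^ a) 𝔽.S.^ a              ≈⟨ 𝔽.S.^-congˡ a (𝔽.sub-X (suc b)) ⟨
        subₐ 𝔽.X 𝔽.S.^ a                   ≈⟨ subₐ.^-homo 𝔽.X a ⟨
        subₐ (𝔽.X 𝔽.S.^ a)                 ≈⟨ subₐ.cong (𝔽.sub-X (suc b)) ⟨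
        subₐ (subₐ 𝔽.X)                    ∎
        where
        open import Relation.Binary.Reasoning.Setoid 𝔽.S.setoid
        open CharTwo.Solver 𝔽.series
        Xⁿ = 𝔽.X 𝔽.S.^ (suc b ℕ.+ a ℕ.* suc b)

      inverseᵢ : ∀ i → w i *ₛ d i ≋ σ
      inverseᵢ i = S.trans (S.sym (Hom.*-homo (twistHom (ζ R.^ i)) H D))
        (S.trans (Hom.cong (twistHom (ζ R.^ i)) H*D≋) (twist-sub (ζ R.^ i) (suc b) (subₐ 𝔽.X) (z^a≈1 i)))

      roots-list : List (Seq × Seq)
      roots-list = (x₀ , d₀) ∷ applyUpTo (λ i → w i , d i) a

      fs : List Seq
      fs = map (λ r → EL.eval₁ r e) (r₀ ∷ r₁ ∷ rows)

      evalMonic≋ : ∀ rs x y → evalMonic (map (λ r → EL.eval₁ r x) rs) y ≋ EL.eval₂ (rs ++ (1ℙ ∷ []) ∷ []) x y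
      evalMonic≋ []       x y = solve 2 (λ x y → con 1ℙ := (con 1ℙ :+ x :* con 0ℙ) :+ y :* con 0ℙ) S.refl x y
        where open L₂.Solver
      evalMonic≋ (r ∷ rs) x y = S.+-congˡ {EL.eval₁ r x} (S.*-congˡ {y} (evalMonic≋ rs x y))

      -- The equation at (H(qᵃ), H(q)) is conjugated by q ↦ ζⁱq, which fixes H(qᵃ). The remaining
      -- root comes from the equation at (H(q), H(qᵃ)) by q ↦ qᵃ, which is why both orders of the
      -- arguments are needed.
      rootᵢ : ∀ i → evalMonic fs (w i) ≋ 0ₛ
      rootᵢ i = begin
        evalMonic fs (w i)                                      ≈⟨ evalMonic≋ (r₀ ∷ r₁ ∷ rows) e (w i) ⟩
        EL.eval₂ equation e (w i)
          ≈⟨ EL.eval-cong equation (S.sym (twist-sub (ζ R.^ i) (suc b) H (z^a≈1 i))) (S.refl {w i}) ⟩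
        EL.eval₂ equation (twist (ζ R.^ i) (subₐ H)) (w i)      ≈⟨ eval₂-hom (twistHom (ζ R.^ i)) equation (subₐ H) H ⟨
        twist (ζ R.^ i) (E𝔽.eval₂ equation (subₐ H) H)          ≈⟨ Hom.cong (twistHom (ζ R.^ i)) above ⟩
        twist (ζ R.^ i) 𝔽.0ₛ                                    ≈⟨ Hom.0-homo (twistHom (ζ R.^ i)) ⟩
        0ₛ                                                      ∎
        where open ≋-Reasoning

      root₀ : evalMonic fs x₀ ≋ 0ₛ
      root₀ = begin
        evalMonic fs x₀                                         ≈⟨ evalMonic≋ (r₀ ∷ r₁ ∷ rows) e x₀ ⟩
        EL.eval₂ equation e x₀                                  ≈⟨ eval₂-hom (twistHom R.1#) equation (subₐ H) (subₐ (subₐ H)) ⟨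
        ι (E𝔽.eval₂ equation (subₐ H) (subₐ (subₐ H)))
          ≈⟨ ι.cong (𝔽.S.trans (𝔽.S.sym (eval₂-hom (𝔽.subHom (suc b)) equation H (subₐ H))) (𝔽.S.trans (subₐ.cong below) subₐ.0-homo)) ⟩
        ι 𝔽.0ₛ                                                  ≈⟨ ι.0-homo ⟩
        0ₛ                                                      ∎
        where open ≋-Reasoning

      H₁≡1 : H 1 ≡ 1ℙ
      H₁≡1 = φ-unit

      w-0 : ∀ i → w i 0 R.≈ R.0#
      w-0 i = R.zeroˡ _

      w-1 : ∀ i → w i 1 R.≈ ζ R.^ i
      w-1 i = R.trans (R.*-congʳ (R.reflexive (≡.cong R₂.⟨_⟩ H₁≡1))) (R.trans (R.*-identityˡ _) (R.*-identityʳ _))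

      ζ^-inverse : ∀ i → ζ R.^ i R.* ζ R.^ (i ℕ.* suc b) R.≈ R.1#
      ζ^-inverse i = R.trans (R.sym (R.^-homo-* ζ i (i ℕ.* suc b)))
        (R.trans (R.reflexive (≡.cong (ζ R.^_) (≡.sym (ℕₚ.*-suc i (suc b))))) (ζ^a*≈1 i))

      regularᵢ : ∀ i → Regular (w i +ₛ x₀)
      regularᵢ i = leading-unit⇒regular 1 (w i +ₛ x₀) {ζ R.^ (i ℕ.* suc b)}
        (λ { {zero} _ → R.trans (R.+-cong (w-0 i) (R.zeroˡ _)) (R.+-identityˡ _) ; {suc _} (s≤s ()) })
        (R.trans (R.*-congʳ (R.trans (R.+-cong (w-1 i) (R.zeroˡ _)) (R.+-identityʳ _))) (ζ^-inverse i))

      -- The coefficient of q in the difference is ζʲ + ζⁱ = ζⁱ(1 + ζ^(j - i)), a unit because a is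
      -- prime and 0 < j - i < a.
      regularᵢⱼ : ∀ {i j} → i ℕ.< j → j ℕ.< a → Regular (w j +ₛ w i)
      regularᵢⱼ {i} {j} i<j j<a = leading-unit⇒regular 1 (w j +ₛ w i) {ζ R.^ (i ℕ.* suc b) R.* y}
        (λ { {zero} _ → R.trans (R.+-cong (w-0 j) (w-0 i)) (R.+-identityˡ _) ; {suc _} (s≤s ()) })
        (begin
          (w j 1 R.+ w i 1) R.* (ζ R.^ (i ℕ.* suc b) R.* y)            ≈⟨ R.*-congʳ (R.+-cong (w-1 j) (w-1 i)) ⟩
          (ζ R.^ j R.+ ζ R.^ i) R.* (ζ R.^ (i ℕ.* suc b) R.* y)        ≈⟨ R.*-congʳ (R.+-congʳ (R.trans (R.reflexive (≡.cong (ζ R.^_) (≡.sym (ℕₚ.m+[n∸m]≡n (ℕₚ.<⇒≤ i<j))))) (R.^-homo-* ζ i k))) ⟩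
          (ζ R.^ i R.* ζ R.^ k R.+ ζ R.^ i) R.* (ζ R.^ (i ℕ.* suc b) R.* y)
            ≈⟨ solve 4 (λ z w u y → (z :* w :+ z) :* (u :* y) := (z :* u) :* ((con 1ℙ :+ w) :* y)) R.refl (ζ R.^ i) (ζ R.^ k) (ζ R.^ (i ℕ.* suc b)) y ⟩
          (ζ R.^ i R.* ζ R.^ (i ℕ.* suc b)) R.* ((R.1# R.+ ζ R.^ k) R.* y)
            ≈⟨ R.*-cong (ζ^-inverse i) (proj₂ unit) ⟩
          R.1# R.* R.1#                                                ≈⟨ R.*-identityˡ _ ⟩
          R.1#                                                         ∎)
        where
        open ≃-Reasoning
        open R₂.Solver
        k = j ℕ.∸ i
        k<a : k ℕ.< a
        k<a = ℕₚ.≤-<-trans (ℕₚ.m∸n≤m j i) j<a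
        unit : Unit (R.1# R.+ ζ R.^ k)
        unit = 1+ζ^k-unit h a-odd k (prime⇒coprime a-prime {{ℕ.>-nonZero (ℕₚ.m<n⇒0<n∸m i<j)}} k<a)
        y = proj₁ unit

      distinct : AllPairs (λ c c′ → Regular (c′ +ₛ c)) (map proj₁ roots-list)
      distinct = AllPairsₚ.map⁺ {xs = roots-list} (Allₚ.applyUpTo⁺₂ (λ i → w i , d i) a regularᵢ ∷ AllPairsₚ.applyUpTo⁺₁ (λ i → w i , d i) a regularᵢⱼ)

      f₀≋ : EL.eval₁ r₀ e ≋ e S.^ suc a
      f₀≋ = EL.eval₁-monomial (suc a) e

      f₁≋ : EL.eval₁ r₁ e ≋ e
      f₁≋ = solve 1 (λ e → con 0ℙ :+ e :* (con 1ℙ :+ e :* con 0ℙ) := e) S.refl e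
        where open L₂.Solver

      coefficient-gap : ∀ t rs → t ℕ.≤ length rs → T (isZero₂ (take t rs)) → ∀ {n} → n ℕ.< t →
        coefficient (map (λ r → EL.eval₁ r e) rs) n ≋ 0ₛ
      coefficient-gap (suc t) (r ∷ rs) _        z {zero}  _         = EL.isZero₁-sound r e (proj₁ (Equivalence.to T-∧ z))
      coefficient-gap (suc t) (r ∷ rs) (s≤s t≤) z {suc n} (s≤s n<t) = coefficient-gap t rs t≤ (proj₂ (Equivalence.to T-∧ z)) n<t

      e≋ : e ≋ X S.^ a *ₛ ι (subₐ (𝔽.sub m φ))
      e≋ = begin
        ι (subₐ H)                                              ≈⟨ ι.cong (𝔽.sub-X* (suc b) (𝔽.sub m φ)) ⟩
        ι (𝔽.X 𝔽.S.^ a 𝔽.*ₛ subₐ (𝔽.sub m φ))                    ≈⟨ ι.*-homo (𝔽.X 𝔽.S.^ a) (subₐ (𝔽.sub m φ)) ⟩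
        ι (𝔽.X 𝔽.S.^ a) *ₛ ι (subₐ (𝔽.sub m φ))                 ≈⟨ S.*-congʳ {ι (subₐ (𝔽.sub m φ))} (S.trans (ι.^-homo 𝔽.X a) (S.^-congˡ a ι-X)) ⟩
        X S.^ a *ₛ ι (subₐ (𝔽.sub m φ))                         ∎
        where
        open ≋-Reasoning
        ι-X : ι 𝔽.X ≋ X
        ι-X = ext λ { zero → R.zeroˡ _ ; (suc zero) → R.trans (R.*-identityˡ _) (R.*-identityˡ _) ; (suc (suc n)) → R.zeroˡ _ }

      e-regular : Regular e
      e-regular = regular-cong (S.sym e≋) (leading-unit⇒regular a (X S.^ a *ₛ u) {R.1#} (X^*-vanish a u)
        (R.trans (R.*-identityʳ _) (R.trans (R.reflexive (≡.cong (X S.^ a *ₛ u) (≡.sym (ℕₚ.+-identityʳ a))))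
          (R.trans (X^-coefficient a u 0) (R.trans (R.*-identityʳ _) (R.reflexive (≡.cong R₂.⟨_⟩ φ-unit)))))))
        where u = ι (subₐ (𝔽.sub m φ))

      e*ψ≋ : e *ₛ ι (subₐ (𝔽.sub m ψ)) ≋ ι (subₐ 𝔽.X)
      e*ψ≋ = S.trans (S.sym (ι.*-homo (subₐ H) (subₐ (𝔽.sub m ψ))))
        (ι.cong (𝔽.S.trans (𝔽.S.sym (subₐ.*-homo H (𝔽.sub m ψ))) (subₐ.cong H*ψ≋X)))

      e^a*v≋σ : e S.^ a *ₛ v ≋ σ
      e^a*v≋σ = begin
        e S.^ a *ₛ v                                   ≈⟨ S.^-distrib-* e (ι (subₐ (𝔽.sub m ψ))) a ⟨
        (e *ₛ ι (subₐ (𝔽.sub m ψ))) S.^ a              ≈⟨ S.^-congˡ a e*ψ≋ ⟩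
        ι (subₐ 𝔽.X) S.^ a                             ≈⟨ ι.^-homo (subₐ 𝔽.X) a ⟨
        ι (subₐ 𝔽.X 𝔽.S.^ a)                           ≈⟨ ι.cong (𝔽.S.trans (𝔽.S.sym (subₐ.^-homo 𝔽.X a)) (subₐ.cong (𝔽.S.sym (𝔽.sub-X (suc b))))) ⟩
        σ                                              ∎
        where open ≋-Reasoning

      length≡ : length fs ≡ length (map proj₁ roots-list)
      length≡ = ≡.trans (Listₚ.length-map _ (r₀ ∷ r₁ ∷ rows)) (≡.trans (≡.cong (2 ℕ.+_) degree)
        (≡.sym (≡.trans (Listₚ.length-map proj₁ roots-list) (≡.cong suc (Listₚ.length-applyUpTo (λ i → w i , d i) a)))))

      trace : powerSum σ (map proj₂ roots-list) (suc t) ≋ v S.^ suc t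
      trace = power-sum σ (EL.eval₁ r₀ e) (EL.eval₁ r₁ e) (map (λ r → EL.eval₁ r e) rows) roots-list v t
        length≡ distinct
        (Allₚ.map⁺ {xs = roots-list} {f = proj₁} (root₀ ∷ Allₚ.applyUpTo⁺₂ (λ i → w i , d i) a rootᵢ))
        (inverse₀ ∷ Allₚ.applyUpTo⁺₂ (λ i → w i , d i) a inverseᵢ)
        (coefficient-gap t rows t≤ gap)
        (regular-cong (S.sym f₀≋) (regular-^ (suc a) e-regular))
        (begin
          EL.eval₁ r₀ e *ₛ v       ≈⟨ S.*-congʳ {v} f₀≋ ⟩
          e *ₛ e S.^ a *ₛ v        ≈⟨ S.*-assoc e (e S.^ a) v ⟩
          e *ₛ (e S.^ a *ₛ v)      ≈⟨ S.*-congˡ {e} e^a*v≋σ ⟩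
          e *ₛ σ                   ≈⟨ S.*-comm e σ ⟩
          σ *ₛ e                   ≈⟨ S.*-congˡ {σ} f₁≋ ⟨
          σ *ₛ EL.eval₁ r₁ e       ∎)
        ℕₚ.≤-refl
        where open ≋-Reasoning

      -- At the exponents considered below all conjugates have the same coefficient; there are a of
      -- them and a is odd, so in characteristic two they add up to a single one.
      constant-sum : ∀ k (f : ℕ → Seq × Seq) N c → (∀ i → (proj₂ (f i) S.^ suc t) N R.≈ c) →
        powerSum σ (map proj₂ (applyUpTo f k)) (suc t) N R.≈ R₂.⟨ parity k ⟩ R.* c
      constant-sum zero    f N c e = R.sym (R.zeroˡ c)
      constant-sum (suc k) f N c e = begin
        (proj₂ (f 0) S.^ suc t) N R.+ powerSum σ (map proj₂ (applyUpTo (f ∘ suc) k)) (suc t) N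
          ≈⟨ R.+-cong (e 0) (constant-sum k (f ∘ suc) N c (e ∘ suc)) ⟩
        c R.+ R₂.⟨ parity k ⟩ R.* c
          ≈⟨ R.trans (R.distribʳ c R.1# R₂.⟨ parity k ⟩) (R.+-congʳ (R.*-identityˡ c)) ⟨
        (R.1# R.+ R₂.⟨ parity k ⟩) R.* c
          ≈⟨ R.*-congʳ (R.trans (R.reflexive (≡.cong R₂.⟨_⟩ (ℙₚ.+-homo-+ 1 k))) (R₂.⟨⟩-+ 1ℙ (parity k))) ⟨
        R₂.⟨ parity (suc k) ⟩ R.* c ∎
        where open ≃-Reasoning

      parity-a : parity a ≡ 1ℙ
      parity-a = ≡.trans (≡.cong (parity ∘ suc) a-odd) (odd h)
        where
        odd : ∀ h → parity (suc (double h)) ≡ 1ℙ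
        odd zero    = ≡.refl
        odd (suc h) = odd h

      -- Coefficients are compared only at q^(nam): the factor a makes the twists by ζⁱ invisible,
      -- and the factor m undoes the substitution q ↦ q^m.
      N : ℕ → ℕ
      N n = n ℕ.* a ℕ.* m

      z^N≈1 : ∀ i n → (ζ R.^ i) R.^ N n R.≈ R.1#
      z^N≈1 i n = R.trans (R.^-assocʳ ζ i (N n)) (R.trans (R.reflexive (≡.cong (ζ R.^_) (reorder i n a m))) (ζ^a*≈1 (i ℕ.* n ℕ.* m)))
        where
        reorder : ∀ i n a m → i ℕ.* (n ℕ.* a ℕ.* m) ≡ i ℕ.* n ℕ.* m ℕ.* a
        reorder = solve-∀

      twist-coefficient : ∀ i f n → (twist (ζ R.^ i) f S.^ suc t) (N n) R.≈ R₂.⟨ (f 𝔽.S.^ suc t) (N n) ⟩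
      twist-coefficient i f n = R.trans (R.sym (at (Hom.^-homo (twistHom (ζ R.^ i)) f (suc t)) (N n)))
        (R.trans (R.*-congˡ (z^N≈1 i n)) (R.*-identityʳ _))

      ι-coefficient : ∀ f n → ι f n R.≈ R₂.⟨ f n ⟩
      ι-coefficient f n = R.trans (R.*-congˡ (1^ n)) (R.*-identityʳ _)

      sub-m-a : ∀ f n → subₐ (𝔽.sub m f) (N n) ≡ f n
      sub-m-a f n = ≡.trans (𝔽.at (𝔽.sub-comm (suc b) m′ f) (N n)) (≡.trans (𝔽.sub-coefficient m′ (subₐ f) (n ℕ.* a)) (𝔽.sub-coefficient (suc b) f n))

      d₀-coefficient : ∀ n → (d₀ S.^ suc t) (N n) R.≈ R₂.⟨ subₐ (ψ 𝔽.S.^ suc t) n ⟩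
      d₀-coefficient n = begin
        (d₀ S.^ suc t) (N n)                                               ≈⟨ at (ι.^-homo (subₐ (subₐ (𝔽.sub m ψ))) (suc t)) (N n) ⟨
        ι (subₐ (subₐ (𝔽.sub m ψ)) 𝔽.S.^ suc t) (N n)                      ≈⟨ at (ι.cong d₀≋) (N n) ⟩
        ι (subₐ (𝔽.sub m (subₐ (ψ 𝔽.S.^ suc t)))) (N n)                    ≈⟨ ι-coefficient (subₐ (𝔽.sub m (subₐ (ψ 𝔽.S.^ suc t)))) (N n) ⟩
        R₂.⟨ subₐ (𝔽.sub m (subₐ (ψ 𝔽.S.^ suc t))) (N n) ⟩                 ≈⟨ R.reflexive (≡.cong R₂.⟨_⟩ (sub-m-a (subₐ (ψ 𝔽.S.^ suc t)) n)) ⟩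
        R₂.⟨ subₐ (ψ 𝔽.S.^ suc t) n ⟩                                      ∎
        where
        open ≃-Reasoning
        d₀≋ : subₐ (subₐ (𝔽.sub m ψ)) 𝔽.S.^ suc t 𝔽.≋ subₐ (𝔽.sub m (subₐ (ψ 𝔽.S.^ suc t)))
        d₀≋ = 𝔽.S.trans (𝔽.S.sym (subₐ.^-homo (subₐ (𝔽.sub m ψ)) (suc t))) (subₐ.cong
          (𝔽.S.trans (𝔽.S.sym (subₐ.^-homo (𝔽.sub m ψ) (suc t))) (𝔽.S.trans (subₐ.cong (𝔽.S.sym (Hom.^-homo (𝔽.subHom m′) ψ (suc t))))
            (𝔽.sub-comm (suc b) m′ (ψ 𝔽.S.^ suc t)))))

      v-coefficient : ∀ n → (v S.^ suc t) (N n) R.≈ R₂.⟨ (ψ 𝔽.S.^ (a ℕ.* suc t)) n ⟩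
      v-coefficient n = begin
        (v S.^ suc t) (N n)                                               ≈⟨ at v≋ (N n) ⟩
        ι (subₐ (𝔽.sub m (ψ 𝔽.S.^ (a ℕ.* suc t)))) (N n)                  ≈⟨ ι-coefficient (subₐ (𝔽.sub m (ψ 𝔽.S.^ (a ℕ.* suc t)))) (N n) ⟩
        R₂.⟨ subₐ (𝔽.sub m (ψ 𝔽.S.^ (a ℕ.* suc t))) (N n) ⟩               ≈⟨ R.reflexive (≡.cong R₂.⟨_⟩ (sub-m-a (ψ 𝔽.S.^ (a ℕ.* suc t)) n)) ⟩
        R₂.⟨ (ψ 𝔽.S.^ (a ℕ.* suc t)) n ⟩                                  ∎
        where
        open ≃-Reasoning
        v≋ : v S.^ suc t ≋ ι (subₐ (𝔽.sub m (ψ 𝔽.S.^ (a ℕ.* suc t))))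
        v≋ = S.trans (S.^-assocʳ (ι (subₐ (𝔽.sub m ψ))) a (suc t)) (S.trans (S.sym (ι.^-homo (subₐ (𝔽.sub m ψ)) (a ℕ.* suc t)))
          (ι.cong (𝔽.S.trans (𝔽.S.sym (subₐ.^-homo (𝔽.sub m ψ) (a ℕ.* suc t))) (subₐ.cong (𝔽.S.sym (Hom.^-homo (𝔽.subHom m′) ψ (a ℕ.* suc t)))))))

      in-R : ∀ n → R₂.⟨ subₐ (ψ 𝔽.S.^ suc t) n ⟩ R.+ R₂.⟨ (D 𝔽.S.^ suc t) (N n) ⟩ R.≈ R₂.⟨ (ψ 𝔽.S.^ (a ℕ.* suc t)) n ⟩
      in-R n = begin
        R₂.⟨ subₐ (ψ 𝔽.S.^ suc t) n ⟩ R.+ c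
          ≈⟨ R.+-cong (R.sym (d₀-coefficient n)) (R.sym (R.trans (R.*-congʳ (R.reflexive (≡.cong R₂.⟨_⟩ parity-a))) (R.*-identityˡ c))) ⟩
        (d₀ S.^ suc t) (N n) R.+ R₂.⟨ parity a ⟩ R.* c
          ≈⟨ R.+-congˡ (constant-sum a (λ i → w i , d i) (N n) c (λ i → twist-coefficient i D n)) ⟨
        powerSum σ (map proj₂ roots-list) (suc t) (N n)       ≈⟨ at trace (N n) ⟩
        (v S.^ suc t) (N n)                                   ≈⟨ v-coefficient n ⟩
        R₂.⟨ (ψ 𝔽.S.^ (a ℕ.* suc t)) n ⟩                      ∎
        where
        open ≃-Reasoning
        c = R₂.⟨ (D 𝔽.S.^ suc t) (N n) ⟩

      in-𝔽₂ : ∀ n → (D 𝔽.S.^ suc t) (N n) ≡ (ψ 𝔽.S.^ (a ℕ.* suc t)) n ℙ.+ subₐ (ψ 𝔽.S.^ suc t) n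
      in-𝔽₂ n = rearrange A B C (faithful b ≡.refl (A ℙ.+ B ℙ.+ C) (R.trans (R₂.⟨⟩-+ (A ℙ.+ B) C)
        (R₂.x≈y⇒x+y≈0 (R.trans (R₂.⟨⟩-+ A B) (in-R n)))))
        where
        A = subₐ (ψ 𝔽.S.^ suc t) n
        B = (D 𝔽.S.^ suc t) (N n)
        C = (ψ 𝔽.S.^ (a ℕ.* suc t)) n
        rearrange : ∀ x y z → x ℙ.+ y ℙ.+ z ≡ 0ℙ → y ≡ z ℙ.+ x
        rearrange 0ℙ 0ℙ 0ℙ _ = ≡.refl
        rearrange 0ℙ 1ℙ 1ℙ _ = ≡.refl
        rearrange 1ℙ 0ℙ 1ℙ _ = ≡.refl
        rearrange 1ℙ 1ℙ 0ℙ _ = ≡.refl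

      D^ : D 𝔽.S.^ suc t 𝔽.≋ 𝔽.X 𝔽.S.^ ((suc b ℕ.+ a ℕ.* suc b) ℕ.* suc t) 𝔽.*ₛ 𝔽.sub m (ψ 𝔽.S.^ suc t)
      D^ = 𝔽.S.trans (𝔽.S.^-distrib-* (𝔽.X 𝔽.S.^ k) (𝔽.sub m ψ) (suc t))
        (𝔽.S.*-cong (𝔽.S.^-assocʳ 𝔽.X k (suc t)) (𝔽.S.sym (Hom.^-homo (𝔽.subHom m′) ψ (suc t))))
        where k = suc b ℕ.+ a ℕ.* suc b

    -- D^(t + 1) is divisible by q, which matches the factor q on the left of the congruence.
    at-zero : 0ℙ ≡ (ψ 𝔽.S.^ (a ℕ.* suc t)) 0 ℙ.+ 𝔽.sub a (ψ 𝔽.S.^ suc t) 0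
    at-zero = ≡.trans (≡.sym (≡.trans (𝔽.at D^ 0) (𝔽.X^*-vanish ((suc b ℕ.+ a ℕ.* suc b) ℕ.* suc t) (𝔽.sub m (ψ 𝔽.S.^ suc t)) {0} (s≤s z≤n)))) (in-𝔽₂ 0)

    -- The exponent (n + 1)am splits as γm + (an + β)m, and γm is exactly the power of q in front of
    -- ψ(q^m)^(t + 1) in D^(t + 1). This determines the residue β.
    at-suc : ∀ β γ → a ≡ β ℕ.+ γ → (suc b ℕ.+ a ℕ.* suc b) ℕ.* suc t ≡ γ ℕ.* m →
      ∀ n → (ψ 𝔽.S.^ suc t) (a ℕ.* n ℕ.+ β) ≡ (ψ 𝔽.S.^ (a ℕ.* suc t)) (suc n) ℙ.+ 𝔽.sub a (ψ 𝔽.S.^ suc t) (suc n)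
    at-suc β γ a≡β+γ shift n = ≡.trans (≡.sym D-coefficient) (in-𝔽₂ (suc n))
      where
      k = (suc b ℕ.+ a ℕ.* suc b) ℕ.* suc t
      index : N (suc n) ≡ k ℕ.+ (a ℕ.* n ℕ.+ β) ℕ.* m
      index = ≡.trans (≡.cong (λ c → (c ℕ.+ n ℕ.* a) ℕ.* m) a≡β+γ) (≡.trans (expand β γ n a m) (≡.cong (ℕ._+ (a ℕ.* n ℕ.+ β) ℕ.* m) (≡.sym shift)))
        where
        expand : ∀ β γ n a m → (β ℕ.+ γ ℕ.+ n ℕ.* a) ℕ.* m ≡ γ ℕ.* m ℕ.+ (a ℕ.* n ℕ.+ β) ℕ.* m
        expand = solve-∀
      D-coefficient : (D 𝔽.S.^ suc t) (N (suc n)) ≡ (ψ 𝔽.S.^ suc t) (a ℕ.* n ℕ.+ β)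
      D-coefficient = ≡.trans (𝔽.at D^ (N (suc n))) (≡.trans (≡.cong (𝔽.X 𝔽.S.^ k 𝔽.*ₛ 𝔽.sub m (ψ 𝔽.S.^ suc t)) index)
        (≡.trans (𝔽.X^-coefficient k (𝔽.sub m (ψ 𝔽.S.^ suc t)) ((a ℕ.* n ℕ.+ β) ℕ.* m)) (𝔽.sub-coefficient m′ (ψ 𝔽.S.^ suc t) (a ℕ.* n ℕ.+ β))))

open 𝔽
open CharTwo series
open Evaluation series
import Relation.Binary.Reasoning.Setoid S.setoid as ≋-Reasoning

-- Modular equations

-- If Φ = P₀ + P₁ + P₂ and the norm P₀³ + P₁³ + P₂³ + P₀P₁P₂ is Φ(q³)h, then Φ(q)·G = Φ(q³)h where G has
-- order exactly 2n; since Φ has order > n, comparing orders shows that it is divisible by every power of q.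
contraction : ∀ {Φ g₀ g₁ g₂ h} n → Φ ≋ X S.^ n *ₛ (g₀ +ₛ g₁ +ₛ g₂) →
  g₀ 0 ≡ 1ℙ → g₁ 0 ≡ 1ℙ → g₂ 0 ≡ 0ℙ →
  (let p₀ = X S.^ n *ₛ g₀ ; p₁ = X S.^ n *ₛ g₁ ; p₂ = X S.^ n *ₛ g₂) →
  p₀ *ₛ p₀ *ₛ p₀ +ₛ p₁ *ₛ p₁ *ₛ p₁ +ₛ p₂ *ₛ p₂ *ₛ p₂ +ₛ p₀ *ₛ p₁ *ₛ p₂ ≋ sub 3 Φ *ₛ h →
  Φ ≋ 0ₛ
contraction {Φ} {g₀} {g₁} {g₂} {h} n Φ≋ e₀ e₁ e₂ norm≋ = ≋[]⇒≋ (λ k → ≤-≋[] (s≤s (ℕₚ.m≤n+m k n)) (below k))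
  where
  z = X S.^ n
  G = g₀ *ₛ g₀ +ₛ g₁ *ₛ g₁ +ₛ g₂ *ₛ g₂ +ₛ g₀ *ₛ g₁ +ₛ g₀ *ₛ g₂ +ₛ g₁ *ₛ g₂

  G-unit : G 0 ℙ.* 1ℙ ≡ 1ℙ
  G-unit rewrite e₀ | e₁ | e₂ = ≡.refl

  -- In characteristic two, where -3 = 1, the norm a³ + b³ + c³ + abc factors as a + b + c times the
  -- quadratic form defining `G`.
  factored : (z *ₛ (z *ₛ Φ)) *ₛ G ≋ sub 3 Φ *ₛ h
  factored = begin
    (z *ₛ (z *ₛ Φ)) *ₛ G                             ≈⟨ S.*-congʳ {G} (S.*-congˡ {z} (S.*-congˡ {z} Φ≋)) ⟩
    (z *ₛ (z *ₛ (z *ₛ (g₀ +ₛ g₁ +ₛ g₂)))) *ₛ G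
      ≈⟨ solve 4 (λ z a b c →
           (z :* (z :* (z :* (a :+ b :+ c)))) :* (a :* a :+ b :* b :+ c :* c :+ a :* b :+ a :* c :+ b :* c) :=
           (z :* a) :* (z :* a) :* (z :* a) :+ (z :* b) :* (z :* b) :* (z :* b) :+
           (z :* c) :* (z :* c) :* (z :* c) :+ (z :* a) :* (z :* b) :* (z :* c)) S.refl z g₀ g₁ g₂ ⟩
    _                                                ≈⟨ norm≋ ⟩
    sub 3 Φ *ₛ h                                     ∎
    where
    open ≋-Reasoning
    open Solver

  below : ∀ k → Φ ≋[ suc (n ℕ.+ k) ] 0ₛ
  below zero {j} j<1+n+0 with ℕₚ.m<1+n⇒m<n∨m≡n j<1+n+0
  ... | inj₁ j<n+0 = ≡.trans (at Φ≋ j) (X^*-vanish n (g₀ +ₛ g₁ +ₛ g₂) (≡.subst (j ℕ.<_) (ℕₚ.+-identityʳ n) j<n+0))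
  ... | inj₂ ≡.refl = ≡.trans (at Φ≋ (n ℕ.+ 0)) (≡.trans (X^-coefficient n _ 0) sum≡0)
    where
    sum≡0 : g₀ 0 ℙ.+ g₁ 0 ℙ.+ g₂ 0 ≡ 0ℙ
    sum≡0 rewrite e₀ | e₁ | e₂ = ≡.refl
  below (suc k) {j} j< = begin
    Φ j                                ≡⟨ X^-coefficient n Φ j ⟨
    (z *ₛ Φ) (n ℕ.+ j)                 ≡⟨ X^-coefficient n (z *ₛ Φ) (n ℕ.+ j) ⟨
    (z *ₛ (z *ₛ Φ)) (n ℕ.+ (n ℕ.+ j))  ≡⟨ cancel-unit {g = G} G-unit product-vanishes index< ⟩
    0ℙ                                 ∎
    where
    open ≡.≡-Reasoning
    product-vanishes : (z *ₛ (z *ₛ Φ)) *ₛ G ≋[ suc (n ℕ.+ k) ℕ.* 3 ] 0ₛ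
    product-vanishes = trans[] (≋⇒≋[] factored) (*ₛ-vanish h (sub-vanish 2 (below k)))

    -- If Φ has order at least n + k + 1, then Φ(q³) has order at least 3(n + k + 1); after
    -- subtracting 2n at least n + k + 2 remains, so every round gains a coefficient.
    arithmetic : ∀ n k → suc (n ℕ.+ (n ℕ.+ suc (n ℕ.+ suc k))) ℕ.+ (k ℕ.+ k) ≡ suc (n ℕ.+ k) ℕ.* 3
    arithmetic = solve-∀

    index< : n ℕ.+ (n ℕ.+ j) ℕ.< suc (n ℕ.+ k) ℕ.* 3
    index< = ≡.subst (suc (n ℕ.+ (n ℕ.+ j)) ℕ.≤_) (arithmetic n k)
      (ℕₚ.≤-trans (s≤s (ℕₚ.+-monoʳ-≤ n (ℕₚ.+-monoʳ-≤ n (ℕₚ.<⇒≤ j<)))) (ℕₚ.m≤m+n _ (k ℕ.+ k)))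

-- The product of p₀ + ωp₁ + ω²p₂ over ω³ = 1, in which the coefficient -3 of p₀p₁p₂ has become 1.
norm : Poly₂ → Poly₂ → Poly₂ → Poly₂
norm p₀ p₁ p₂ = p₀ ⊗₂ p₀ ⊗₂ p₀ ⊕₂ p₁ ⊗₂ p₁ ⊗₂ p₁ ⊕₂ p₂ ⊗₂ p₂ ⊗₂ p₂ ⊕₂ p₀ ⊗₂ p₁ ⊗₂ p₂

part : ℕ → List (ℕ × ℕ) → Poly₂
part k ms = fromMonomials (filter (λ ij → proj₂ ij % 3 ℕ.≟ k) ms)

row₁ : Poly₂ → Poly₁
row₁ (_ ∷ r ∷ _) = r
row₁ _           = []

-- Collects the multiples of x²y and of y². At x = r(q) and y = r(qᵃ) these have orders at least a +
-- 2 and 2a, above the order a + 1 of x^(a + 1) and xy.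
higher : Poly₂ → Poly₂
higher p = monomial 2 1 ⊗₂ (drop 2 (row₁ p) ∷ []) ⊕₂ monomial 0 2 ⊗₂ drop 2 p

x³ y³ Ux Uy x+x⁴ y+y⁴ : Poly₂
x³   = monomial 3 0
y³   = monomial 0 3
Ux   = fromMonomials ((1 , 0) ∷ (2 , 0) ∷ (3 , 0) ∷ [])
Uy   = fromMonomials ((0 , 1) ∷ (0 , 2) ∷ (0 , 3) ∷ [])
x+x⁴ = fromMonomials ((1 , 0) ∷ (4 , 0) ∷ [])
y+y⁴ = fromMonomials ((0 , 1) ∷ (0 , 4) ∷ [])

-- The cubic equation P relates u = r(q) and v = r(q^a). Its norm ∏ P(u, ωv) over ω³ = 1 is a polynomial N in
-- u³ = U(r(q³)) and v³ = U(r(q³ᵃ)), where U(x) = x + x² + x³, and N(U(x), U(y)) turns out to be divisible by P(x, y).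
-- Since q η(q²⁴) = r + r⁴, the Schläfli equation follows from P dividing F(x + x⁴, y + y⁴).
module Equations (a : ℕ) (cubic : List (ℕ × ℕ)) (schläfli : Poly₂) where
  P p₀ p₁ p₂ N N′ F′ : Poly₂
  P  = fromMonomials cubic
  p₀ = part 0 cubic
  p₁ = part 1 cubic
  p₂ = part 2 cubic
  N  = map everyThird (everyThird (norm p₀ p₁ p₂))
  N′ = compose N Ux Uy
  F′ = compose schläfli x+x⁴ y+y⁴

  -- The `leading` fields isolate x^(a + 1) and xy, whose lowest terms cancel at order a + 1. For
  -- the data below `cubes` holds because r is q times a series in q³: every term xⁱyʲ of P has i +
  -- aj congruent to a + 1 modulo 3, so only cubes survive in the norm.
  record Certificate : Set where
    field
      splitting : T (isZero₂ (P ⊕₂ (p₀ ⊕₂ p₁ ⊕₂ p₂)))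
      leading₀  : T (isZero₂ (p₀ ⊕₂ (monomial (suc a) 0 ⊕₂ higher p₀)))
      leading₁  : T (isZero₂ (p₁ ⊕₂ (monomial 1 1 ⊕₂ higher p₁)))
      leading₂  : T (isZero₂ (p₂ ⊕₂ higher p₂))
      cubes     : T (isZero₂ (norm p₀ p₁ p₂ ⊕₂ compose N x³ y³))
      tripling  : T (isZero₂ (N′ ⊕₂ P ⊗₂ quotient N′ P))
      descent   : T (isZero₂ (F′ ⊕₂ P ⊗₂ quotient F′ P))


  module _ (certificate : Certificate) where
    open Certificate certificate
    open ≋-Reasoning

    zero-sum : ∀ p q x y → T (isZero₂ (p ⊕₂ q)) → eval₂ p x y ≋ eval₂ q x y
    zero-sum p q x y h = x+y≈0⇒x≈y (S.trans (S.sym (eval-⊕ p q x y)) (isZero-sound (p ⊕₂ q) x y h))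

    eval-norm : ∀ x y → let e = λ p → eval₂ p x y in
      eval₂ (norm p₀ p₁ p₂) x y ≋
      e p₀ *ₛ e p₀ *ₛ e p₀ +ₛ e p₁ *ₛ e p₁ *ₛ e p₁ +ₛ e p₂ *ₛ e p₂ *ₛ e p₂ +ₛ e p₀ *ₛ e p₁ *ₛ e p₂
    eval-norm x y =
      S.trans (eval-⊕ (p₀ ⊗₂ p₀ ⊗₂ p₀ ⊕₂ p₁ ⊗₂ p₁ ⊗₂ p₁ ⊕₂ p₂ ⊗₂ p₂ ⊗₂ p₂) (p₀ ⊗₂ p₁ ⊗₂ p₂) x y) (S.+-cong
        (S.trans (eval-⊕ (p₀ ⊗₂ p₀ ⊗₂ p₀ ⊕₂ p₁ ⊗₂ p₁ ⊗₂ p₁) (p₂ ⊗₂ p₂ ⊗₂ p₂) x y) (S.+-cong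
          (S.trans (eval-⊕ (p₀ ⊗₂ p₀ ⊗₂ p₀) (p₁ ⊗₂ p₁ ⊗₂ p₁) x y) (S.+-cong (triple p₀ p₀ p₀) (triple p₁ p₁ p₁)))
          (triple p₂ p₂ p₂)))
        (triple p₀ p₁ p₂))
      where
      triple : ∀ p q r → eval₂ (p ⊗₂ q ⊗₂ r) x y ≋ eval₂ p x y *ₛ eval₂ q x y *ₛ eval₂ r x y
      triple p q r = S.trans (eval-⊗ (p ⊗₂ q) r x y) (S.*-congʳ {eval₂ r x y} (eval-⊗ p q x y))

    module _ (u v u′ v′ : Seq) (b : ℕ) (a≡2+b : a ≡ 2 ℕ.+ b)
             (u≋ : u ≋ X *ₛ u′) (v≋ : v ≋ X S.^ a *ₛ v′) (u′≡1 : u′ 0 ≡ 1ℙ) (v′≡1 : v′ 0 ≡ 1ℙ)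
             (u-triple : u S.^ 3 ≋ eval₂ Ux (sub 3 u) (sub 3 v))
             (v-triple : v S.^ 3 ≋ eval₂ Uy (sub 3 u) (sub 3 v)) where

      private
        Φ = eval₂ P u v
        z = X S.^ suc a

        1^ : ∀ n → (u′ S.^ n) 0 ≡ 1ℙ
        1^ zero    = ≡.refl
        1^ (suc n) rewrite u′≡1 | 1^ n = ≡.refl

        tail : Poly₂ → Seq
        tail p = u′ S.^ 2 *ₛ v′ *ₛ eval₂ (drop 2 (row₁ p) ∷ []) u v +ₛ X S.^ b *ₛ v′ S.^ 2 *ₛ eval₂ (drop 2 p) u v

        higher≋ : ∀ p → eval₂ (higher p) u v ≋ z *ₛ (X *ₛ tail p)
        higher≋ p = begin
          eval₂ (higher p) u v
            ≈⟨ eval-⊕ (monomial 2 1 ⊗₂ (drop 2 (row₁ p) ∷ [])) (monomial 0 2 ⊗₂ drop 2 p) u v ⟩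
          eval₂ (monomial 2 1 ⊗₂ (drop 2 (row₁ p) ∷ [])) u v +ₛ eval₂ (monomial 0 2 ⊗₂ drop 2 p) u v
            ≈⟨ S.+-cong (S.trans (eval-⊗ (monomial 2 1) (drop 2 (row₁ p) ∷ []) u v) (S.*-congʳ {A} (eval-monomial 2 1 u v)))
                        (S.trans (eval-⊗ (monomial 0 2) (drop 2 p) u v) (S.*-congʳ {B} (eval-monomial 0 2 u v))) ⟩
          u S.^ 2 *ₛ v S.^ 1 *ₛ A +ₛ u S.^ 0 *ₛ v S.^ 2 *ₛ B
            ≈⟨ S.+-cong (S.*-congʳ {A} (S.*-cong (S.^-congˡ 2 u≋) (S.^-congˡ 1 v≋)))
                        (S.*-congʳ {B} (S.*-congˡ {1ₛ} (S.^-congˡ 2 v≋))) ⟩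
          (X *ₛ u′) S.^ 2 *ₛ (Xᵃ *ₛ v′) S.^ 1 *ₛ A +ₛ 1ₛ *ₛ (Xᵃ *ₛ v′) S.^ 2 *ₛ B
            ≈⟨ solve 6 (λ X Xᵃ u v A B →
                 (X :* u) :^ 2 :* (Xᵃ :* v) :^ 1 :* A :+ con 1ℙ :* (Xᵃ :* v) :^ 2 :* B :=
                 X :* Xᵃ :* (X :* (u :^ 2 :* v :* A)) :+ Xᵃ :* (Xᵃ :* (v :^ 2 :* B))) S.refl X Xᵃ u′ v′ A B ⟩
          X *ₛ Xᵃ *ₛ (X *ₛ (u′ S.^ 2 *ₛ v′ *ₛ A)) +ₛ Xᵃ *ₛ (Xᵃ *ₛ (v′ S.^ 2 *ₛ B))
            ≈⟨ S.+-congˡ {X *ₛ Xᵃ *ₛ (X *ₛ (u′ S.^ 2 *ₛ v′ *ₛ A))}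
                 (S.*-congˡ {Xᵃ} (S.*-congʳ {v′ S.^ 2 *ₛ B} (S.reflexive (≡.cong (X S.^_) a≡2+b)))) ⟩
          X *ₛ Xᵃ *ₛ (X *ₛ (u′ S.^ 2 *ₛ v′ *ₛ A)) +ₛ Xᵃ *ₛ (X *ₛ (X *ₛ X S.^ b) *ₛ (v′ S.^ 2 *ₛ B))
            ≈⟨ solve 7 (λ X Xᵃ Xᵇ u v A B →
                 X :* Xᵃ :* (X :* (u :^ 2 :* v :* A)) :+ Xᵃ :* (X :* (X :* Xᵇ) :* (v :^ 2 :* B)) :=
                 X :* Xᵃ :* (X :* (u :^ 2 :* v :* A :+ Xᵇ :* v :^ 2 :* B))) S.refl X Xᵃ (X S.^ b) u′ v′ A B ⟩
          z *ₛ (X *ₛ tail p) ∎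
          where
          open Solver
          Xᵃ = X S.^ a
          A = eval₂ (drop 2 (row₁ p) ∷ []) u v
          B = eval₂ (drop 2 p) u v

        -- Once q^(a + 1) is taken out, the constant terms are 1 (from x^(a + 1)), 1 (from xy) and
        -- 0, as `contraction` requires.
        g₀ g₁ g₂ : Seq
        g₀ = u′ S.^ suc a +ₛ X *ₛ tail p₀
        g₁ = u′ *ₛ v′ +ₛ X *ₛ tail p₁
        g₂ = X *ₛ tail p₂

        p₀≋ : eval₂ p₀ u v ≋ z *ₛ g₀
        p₀≋ = begin
          eval₂ p₀ u v                                      ≈⟨ zero-sum p₀ (monomial (suc a) 0 ⊕₂ higher p₀) u v leading₀ ⟩
          eval₂ (monomial (suc a) 0 ⊕₂ higher p₀) u v        ≈⟨ eval-⊕ (monomial (suc a) 0) (higher p₀) u v ⟩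
          eval₂ (monomial (suc a) 0) u v +ₛ eval₂ (higher p₀) u v
            ≈⟨ S.+-cong (S.trans (eval-monomial (suc a) 0 u v) (S.*-identityʳ (u S.^ suc a))) (higher≋ p₀) ⟩
          u S.^ suc a +ₛ z *ₛ (X *ₛ tail p₀)
            ≈⟨ S.+-congʳ {z *ₛ (X *ₛ tail p₀)} (S.trans (S.^-congˡ (suc a) u≋) (S.^-distrib-* X u′ (suc a))) ⟩
          z *ₛ u′ S.^ suc a +ₛ z *ₛ (X *ₛ tail p₀)          ≈⟨ S.distribˡ z (u′ S.^ suc a) (X *ₛ tail p₀) ⟨
          z *ₛ g₀                                           ∎

        p₁≋ : eval₂ p₁ u v ≋ z *ₛ g₁
        p₁≋ = begin
          eval₂ p₁ u v                                      ≈⟨ zero-sum p₁ (monomial 1 1 ⊕₂ higher p₁) u v leading₁ ⟩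
          eval₂ (monomial 1 1 ⊕₂ higher p₁) u v             ≈⟨ eval-⊕ (monomial 1 1) (higher p₁) u v ⟩
          eval₂ (monomial 1 1) u v +ₛ eval₂ (higher p₁) u v
            ≈⟨ S.+-cong (S.trans (eval-monomial 1 1 u v) (S.*-cong (S.^-congˡ 1 u≋) (S.^-congˡ 1 v≋))) (higher≋ p₁) ⟩
          (X *ₛ u′) S.^ 1 *ₛ (X S.^ a *ₛ v′) S.^ 1 +ₛ z *ₛ (X *ₛ tail p₁)
            ≈⟨ solve 5 (λ X Xᵃ u v t → (X :* u) :^ 1 :* (Xᵃ :* v) :^ 1 :+ X :* Xᵃ :* (X :* t) :=
                                       X :* Xᵃ :* (u :* v :+ X :* t)) S.refl X (X S.^ a) u′ v′ (tail p₁) ⟩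
          z *ₛ g₁                                           ∎
          where open Solver

        p₂≋ : eval₂ p₂ u v ≋ z *ₛ g₂
        p₂≋ = S.trans (zero-sum p₂ (higher p₂) u v leading₂) (higher≋ p₂)

        Φ≋ : Φ ≋ z *ₛ (g₀ +ₛ g₁ +ₛ g₂)
        Φ≋ = begin
          Φ                                                   ≈⟨ zero-sum P (p₀ ⊕₂ p₁ ⊕₂ p₂) u v splitting ⟩
          eval₂ (p₀ ⊕₂ p₁ ⊕₂ p₂) u v                          ≈⟨ eval-⊕ (p₀ ⊕₂ p₁) p₂ u v ⟩
          eval₂ (p₀ ⊕₂ p₁) u v +ₛ eval₂ p₂ u v                ≈⟨ S.+-cong (S.trans (eval-⊕ p₀ p₁ u v) (S.+-cong p₀≋ p₁≋)) p₂≋ ⟩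
          z *ₛ g₀ +ₛ z *ₛ g₁ +ₛ z *ₛ g₂
            ≈⟨ solve 4 (λ z a b c → z :* a :+ z :* b :+ z :* c := z :* (a :+ b :+ c)) S.refl z g₀ g₁ g₂ ⟩
          z *ₛ (g₀ +ₛ g₁ +ₛ g₂)                               ∎
          where open Solver

        x y h : Seq
        x = sub 3 u
        y = sub 3 v
        h = eval₂ (quotient N′ P) x y

        norm≋ : eval₂ (norm p₀ p₁ p₂) u v ≋ sub 3 Φ *ₛ h
        norm≋ = begin
          eval₂ (norm p₀ p₁ p₂) u v               ≈⟨ zero-sum (norm p₀ p₁ p₂) (compose N x³ y³) u v cubes ⟩
          eval₂ (compose N x³ y³) u v             ≈⟨ eval-compose N x³ y³ u v ⟩
          eval₂ N (eval₂ x³ u v) (eval₂ y³ u v)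
            ≈⟨ eval-cong N (S.trans (eval-monomial 3 0 u v) (S.trans (S.*-identityʳ (u S.^ 3)) u-triple))
                           (S.trans (eval-monomial 0 3 u v) (S.trans (S.*-identityˡ (v S.^ 3)) v-triple)) ⟩
          eval₂ N (eval₂ Ux x y) (eval₂ Uy x y)   ≈⟨ eval-compose N Ux Uy x y ⟨
          eval₂ N′ x y                            ≈⟨ zero-sum N′ (P ⊗₂ quotient N′ P) x y tripling ⟩
          eval₂ (P ⊗₂ quotient N′ P) x y          ≈⟨ eval-⊗ P (quotient N′ P) x y ⟩
          eval₂ P x y *ₛ h                        ≈⟨ S.*-congʳ {h} (eval₂-hom (subHom 2) P u v) ⟨
          sub 3 Φ *ₛ h                            ∎

      cubic-equation : eval₂ P u v ≋ 0ₛ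
      cubic-equation = contraction {g₀ = g₀} {g₁} {g₂} {h} (suc a) Φ≋ g₀≡1 g₁≡1 ≡.refl
        (S.trans (S.sym (S.trans (eval-norm u v) parts≋)) norm≋)
        where
        cube : ∀ {s t} → s ≋ t → s *ₛ s *ₛ s ≋ t *ₛ t *ₛ t
        cube s≋t = S.*-cong (S.*-cong s≋t s≋t) s≋t
        parts≋ = S.+-cong (S.+-cong (S.+-cong (cube p₀≋) (cube p₁≋)) (cube p₂≋)) (S.*-cong (S.*-cong p₀≋ p₁≋) p₂≋)
        g₀≡1 : g₀ 0 ≡ 1ℙ
        g₀≡1 rewrite 1^ (suc a) = ≡.refl
        g₁≡1 : g₁ 0 ≡ 1ℙ
        g₁≡1 rewrite u′≡1 | v′≡1 = ≡.refl

      schläfli-equation : eval₂ schläfli (eval₂ x+x⁴ u v) (eval₂ y+y⁴ u v) ≋ 0ₛ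
      schläfli-equation = begin
        eval₂ schläfli (eval₂ x+x⁴ u v) (eval₂ y+y⁴ u v)  ≈⟨ eval-compose schläfli x+x⁴ y+y⁴ u v ⟨
        eval₂ F′ u v                                      ≈⟨ zero-sum F′ (P ⊗₂ quotient F′ P) u v descent ⟩
        eval₂ (P ⊗₂ quotient F′ P) u v                    ≈⟨ eval-⊗ P (quotient F′ P) u v ⟩
        eval₂ P u v *ₛ k                                  ≈⟨ S.*-congʳ {k} cubic-equation ⟩
        0ₛ *ₛ k                                           ≈⟨ S.zeroˡ k ⟩
        0ₛ                                                ∎
        where k = eval₂ (quotient F′ P) u v

-- Theta series

geometric-inverse : ∀ m → geometric (suc m) *ₛ (1ₛ +ₛ X S.^ suc m) ≋ 1ₛ
geometric-inverse m = begin
  sub (suc m) ones *ₛ (1ₛ +ₛ X S.^ suc m)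
    ≈⟨ S.*-congˡ {geometric (suc m)} (S.+-cong 1-homo (sub-X m)) ⟨
  sub (suc m) ones *ₛ (sub (suc m) 1ₛ +ₛ sub (suc m) X)
    ≈⟨ S.*-congˡ {geometric (suc m)} (+-homo 1ₛ X) ⟨
  sub (suc m) ones *ₛ sub (suc m) (1ₛ +ₛ X)
    ≈⟨ *-homo ones (1ₛ +ₛ X) ⟨
  sub (suc m) (ones *ₛ (1ₛ +ₛ X))
    ≈⟨ cong (S.trans (S.*-comm ones (1ₛ +ₛ X)) (S.trans (S.distribʳ ones 1ₛ X) (S.+-cong (S.*-identityˡ ones) (X*f≋0▹f ones)))) ⟩
  sub (suc m) (ones +ₛ (0ℙ ▹ ones))
    ≈⟨ cong (ext λ { zero → ≡.refl ; (suc n) → ≡.refl }) ⟩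
  sub (suc m) 1ₛ
    ≈⟨ 1-homo ⟩
  1ₛ ∎
  where
  open ≋-Reasoning
  open Hom (subHom m)

geometric≋[]1 : ∀ d → geometric d ≋[ d ] 1ₛ
geometric≋[]1 (suc m) {zero}  _         = ≡.refl
geometric≋[]1 (suc m) {suc n} (s≤s n<m) = ≡.trans (spread-cong[] m {0} {ones} {0ₛ} m (λ ()) (≡.subst (n ℕ.<_) (≡.sym (ℕₚ.+-identityʳ m)) n<m)) (spread-0 m m n)

η : Seq
η = limit (λ i → 1ₛ +ₛ X S.^ i)

𝓟 : Seq
𝓟 = limit geometric

η-approx : ∀ n → η ≋[ suc n ] product (λ i → 1ₛ +ₛ X S.^ i) 0 n
η-approx = limit-approx _ 1+X^≋[]1

𝓟-approx : ∀ n → 𝓟 ≋[ suc n ] product geometric 0 n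
𝓟-approx = limit-approx geometric geometric≋[]1

𝓟*η≋1 : 𝓟 *ₛ η ≋ 1ₛ
𝓟*η≋1 = ≋[]⇒≋ λ n → trans[] (*ₛ-cong[] (𝓟-approx n) (η-approx n)) (≋⇒≋[] (
  S.trans (S.sym (product-* geometric _ 0 n)) (S.trans (product-cong geometric-inverse 0 n) (product-1 0 n))))

-- diagonal g k s is the sum of g s′ k′ over s′ + k′ = s + k, s′ ≥ s.
diagonal : (ℕ → ℕ → Seq) → ℕ → ℕ → Seq
diagonal g zero    s = g s 0
diagonal g (suc k) s = g s (suc k) +ₛ diagonal g k (suc s)

-- The half W⁺ of the term at s cancels the half W of the term at s + 1; only the two ends of the
-- diagonal survive.
diagonal-telescope : ∀ {g g′ W W⁺ : ℕ → ℕ → Seq} →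
  (∀ s k → g s k +ₛ g′ s k ≋ W s k +ₛ W⁺ s k) → (∀ s k → W⁺ s (suc k) ≋ W (suc s) k) →
  ∀ k s → diagonal g k s +ₛ diagonal g′ k s ≋ W s k +ₛ W⁺ (k ℕ.+ s) 0
diagonal-telescope e c zero    s = e s 0
diagonal-telescope {g} {g′} {W} {W⁺} e c (suc k) s = begin
  (g s (suc k) +ₛ diagonal g k (suc s)) +ₛ (g′ s (suc k) +ₛ diagonal g′ k (suc s))
    ≈⟨ solve 4 (λ a b c d → (a :+ b) :+ (c :+ d) := (a :+ c) :+ (b :+ d)) S.refl (g s (suc k)) (diagonal g k (suc s)) (g′ s (suc k)) (diagonal g′ k (suc s)) ⟩
  (g s (suc k) +ₛ g′ s (suc k)) +ₛ (diagonal g k (suc s) +ₛ diagonal g′ k (suc s))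
    ≈⟨ S.+-cong (S.trans (e s (suc k)) (S.+-congˡ {W s (suc k)} (c s k))) (diagonal-telescope {g} {g′} {W} {W⁺} e c k (suc s)) ⟩
  (W s (suc k) +ₛ W (suc s) k) +ₛ (W (suc s) k +ₛ W⁺ (k ℕ.+ suc s) 0)
    ≈⟨ solve 3 (λ a b c → (a :+ b) :+ (b :+ c) := a :+ c) S.refl (W s (suc k)) (W (suc s) k) (W⁺ (k ℕ.+ suc s) 0) ⟩
  W s (suc k) +ₛ W⁺ (k ℕ.+ suc s) 0
    ≈⟨ S.+-congˡ {W s (suc k)} (S.reflexive (≡.cong (λ n → W⁺ n 0) (ℕₚ.+-suc k s))) ⟩
  W s (suc k) +ₛ W⁺ (suc k ℕ.+ s) 0 ∎
  where
  open ≋-Reasoning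
  open Solver

diagonal-last : ∀ g k s → diagonal g (suc k) s ≋ diagonal (λ s k → g s (suc k)) k s +ₛ g (suc k ℕ.+ s) 0
diagonal-last g zero    s = S.refl
diagonal-last g (suc k) s = begin
  g s (2 ℕ.+ k) +ₛ diagonal g (suc k) (suc s)
    ≈⟨ S.+-congˡ {g s (2 ℕ.+ k)} (diagonal-last g k (suc s)) ⟩
  g s (2 ℕ.+ k) +ₛ (diagonal (λ s k → g s (suc k)) k (suc s) +ₛ g (suc k ℕ.+ suc s) 0)
    ≈⟨ S.+-assoc (g s (2 ℕ.+ k)) _ _ ⟨
  diagonal (λ s k → g s (suc k)) (suc k) s +ₛ g (suc k ℕ.+ suc s) 0
    ≈⟨ S.+-congˡ {diagonal (λ s k → g s (suc k)) (suc k) s} (S.reflexive (≡.cong (λ n → g (suc n) 0) (ℕₚ.+-suc k s))) ⟩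
  diagonal (λ s k → g s (suc k)) (suc k) s +ₛ g (2 ℕ.+ k ℕ.+ s) 0 ∎
  where open ≋-Reasoning

diagonal-vanish : ∀ g → (∀ s k → g (suc s) k ≋[ suc (suc s ℕ.+ k) ] 0ₛ) → ∀ k s → diagonal g k (suc s) ≋[ suc (suc s ℕ.+ k) ] 0ₛ
diagonal-vanish g p zero    s = p s 0
diagonal-vanish g p (suc k) s {n} n< =
  ≡.cong₂ ℙ._+_ (p s (suc k) n<) (diagonal-vanish g p k (suc s) (≡.subst (n ℕ.<_) (≡.cong (2 ℕ.+_) (ℕₚ.+-suc s k)) n<))

diagonal-approx : ∀ g → (∀ s k → g (suc s) k ≋[ suc (suc s ℕ.+ k) ] 0ₛ) → ∀ n → diagonal g n 0 ≋[ suc n ] g 0 n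
diagonal-approx g p zero    _ = ≡.refl
diagonal-approx g p (suc n) {k} k< =
  ≡.trans (≡.cong (g 0 (suc n) k ℙ.+_) (diagonal-vanish g p n 0 k<)) (ℙₚ.+-identityʳ _)

q^ : ℕ → Seq
q^ n = X S.^ n

q^-vanish : ∀ {m n} f → m ℕ.≤ n → f *ₛ q^ n ≋[ m ] 0ₛ
q^-vanish {m} {n} f m≤n {k} k<m = ≡.trans (at (S.*-comm f (q^ n)) k) (X^*-vanish n f (ℕₚ.<-≤-trans k<m m≤n))

q^-+ : ∀ {l} m n → l ≡ m ℕ.+ n → q^ l ≋ q^ m *ₛ q^ n
q^-+ m n e = S.trans (S.reflexive (≡.cong q^ e)) (S.^-homo-* X m n)

triangular : ℕ → ℕ
triangular zero    = 0
triangular (suc n) = suc n ℕ.+ triangular n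

-- The finite pentagonal and triangular number identities are due to Shanks.
module Pentagonal where
  ρ : ℕ → Seq
  ρ i = 1ₛ +ₛ q^ i

  exponent : ℕ → ℕ → ℕ
  exponent s k = s ℕ.* (s ℕ.+ k) ℕ.+ triangular s

  g W W⁺ : ℕ → ℕ → Seq
  g  s k = product ρ s k *ₛ q^ (exponent s k)
  W  s k = product ρ s k *ₛ (1ₛ +ₛ q^ s) *ₛ q^ (exponent s k)
  W⁺ s k = product ρ s k *ₛ q^ (suc s ℕ.* (s ℕ.+ k) ℕ.+ triangular (suc s))

  step : ∀ s k → g s k +ₛ g s (suc k) ≋ W s k +ₛ W⁺ s k
  step s k = begin
    R *ₛ Q +ₛ R *ₛ (1ₛ +ₛ Qₙ) *ₛ q^ (exponent s (suc k))
      ≈⟨ S.+-congˡ {R *ₛ Q} (S.*-congˡ {R *ₛ (1ₛ +ₛ Qₙ)} (q^-+ (exponent s k) s (exponent-suc s k (triangular s)))) ⟩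
    R *ₛ Q +ₛ R *ₛ (1ₛ +ₛ Qₙ) *ₛ (Q *ₛ Qₛ)
      ≈⟨ solve 4 (λ R Q Qₙ Qₛ → R :* Q :+ R :* (con 1ℙ :+ Qₙ) :* (Q :* Qₛ) :=
                               R :* (con 1ℙ :+ Qₛ) :* Q :+ R :* (Q :* (Qₙ :* Qₛ))) S.refl R Q Qₙ Qₛ ⟩
    R *ₛ (1ₛ +ₛ Qₛ) *ₛ Q +ₛ R *ₛ (Q *ₛ (Qₙ *ₛ Qₛ))
      ≈⟨ S.+-congˡ {W s k} (S.*-congˡ {R} (S.trans (q^-+ (exponent s k) (suc (s ℕ.+ k) ℕ.+ s) (exponent-W s k (triangular s))) (S.*-congˡ {Q} (S.^-homo-* X (suc (s ℕ.+ k)) s)))) ⟨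
    W s k +ₛ W⁺ s k ∎
    where
    open ≋-Reasoning
    open Solver
    R = product ρ s k
    Q = q^ (exponent s k)
    Qₙ = q^ (suc (s ℕ.+ k))
    Qₛ = q^ s
    exponent-suc : ∀ s k t → s ℕ.* (s ℕ.+ suc k) ℕ.+ t ≡ s ℕ.* (s ℕ.+ k) ℕ.+ t ℕ.+ s
    exponent-suc = solve-∀
    exponent-W : ∀ s k t → suc s ℕ.* (s ℕ.+ k) ℕ.+ (suc s ℕ.+ t) ≡ s ℕ.* (s ℕ.+ k) ℕ.+ t ℕ.+ (suc (s ℕ.+ k) ℕ.+ s)
    exponent-W = solve-∀

  shift : ∀ s k → W⁺ s (suc k) ≋ W (suc s) k
  shift s k = S.*-cong
    (S.trans (product-head ρ s k) (S.*-comm (ρ (suc s)) (product ρ (suc s) k)))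
    (S.reflexive (≡.cong q^ (exponent-shift s k (triangular s))))
    where
    exponent-shift : ∀ s k t → suc s ℕ.* (s ℕ.+ suc k) ℕ.+ (suc s ℕ.+ t) ≡ suc s ℕ.* (suc s ℕ.+ k) ℕ.+ (suc s ℕ.+ t)
    exponent-shift = solve-∀

  partial : ℕ → Seq
  partial zero    = 1ₛ
  partial (suc n) = partial n +ₛ (q^ (suc n ℕ.* n ℕ.+ triangular (suc n)) +ₛ q^ (suc n ℕ.* suc n ℕ.+ triangular (suc n)))

  -- Passing from n to n + 1 adds `W 0 n`, `W⁺ n 0` and `g (suc n) 0`. The first vanishes, having
  -- the factor 1 + q⁰ = 0; the other two are q^(m(3m - 1)/2) and q^(m(3m + 1)/2) with m = n + 1.
  identity : ∀ n → diagonal g n 0 ≋ partial n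
  identity zero    = S.*-identityˡ 1ₛ
  identity (suc n) = begin
    diagonal g (suc n) 0                                   ≈⟨ diagonal-last g n 0 ⟩
    D′ +ₛ g (suc n ℕ.+ 0) 0                                ≈⟨ solve 3 (λ D D′ g → D′ :+ g := D :+ ((D :+ D′) :+ g)) S.refl D D′ (g (suc n ℕ.+ 0) 0) ⟩
    D +ₛ ((D +ₛ D′) +ₛ g (suc n ℕ.+ 0) 0)
      ≈⟨ S.+-cong (identity n) (S.+-congʳ {g (suc n ℕ.+ 0) 0} (diagonal-telescope {g} {λ s k → g s (suc k)} {W} {W⁺} step shift n 0)) ⟩
    partial n +ₛ ((W 0 n +ₛ W⁺ (n ℕ.+ 0) 0) +ₛ g (suc n ℕ.+ 0) 0)
      ≈⟨ S.reflexive (≡.cong (λ m → partial n +ₛ ((W 0 n +ₛ W⁺ m 0) +ₛ g (suc m) 0)) (ℕₚ.+-identityʳ n)) ⟩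
    partial n +ₛ ((W 0 n +ₛ W⁺ n 0) +ₛ g (suc n) 0)
      ≈⟨ solve 5 (λ p R Q a b → p :+ ((R :* (con 1ℙ :+ con 1ℙ) :* Q :+ con 1ℙ :* a) :+ con 1ℙ :* b) := p :+ (a :+ b)) S.refl
           (partial n) (product ρ 0 n) (q^ (exponent 0 n)) (q^ (suc n ℕ.* (n ℕ.+ 0) ℕ.+ triangular (suc n))) (q^ (exponent (suc n) 0)) ⟩
    partial n +ₛ (q^ (suc n ℕ.* (n ℕ.+ 0) ℕ.+ triangular (suc n)) +ₛ q^ (suc n ℕ.* (suc n ℕ.+ 0) ℕ.+ triangular (suc n)))
      ≈⟨ S.reflexive (≡.cong (λ m → partial n +ₛ (q^ (suc n ℕ.* m ℕ.+ triangular (suc n)) +ₛ q^ (suc n ℕ.* suc m ℕ.+ triangular (suc n)))) (ℕₚ.+-identityʳ n)) ⟩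
    partial (suc n) ∎
    where
    open ≋-Reasoning
    open Solver
    D D′ : Seq
    D  = diagonal g n 0
    D′ = diagonal (λ s k → g s (suc k)) n 0

  -- All summands with s ≥ 1 have order above n, so modulo q^(n + 1) the diagonal reduces to the
  -- bare product at s = 0.
  η-partial : ∀ n → η ≋[ suc n ] partial n
  η-partial n = trans[] (η-approx n) (trans[] (≋⇒≋[] (S.sym (S.*-identityʳ (product ρ 0 n))))
    (trans[] (sym[] (diagonal-approx g g-vanish n)) (≋⇒≋[] (identity n))))
    where
    g-vanish : ∀ s k → g (suc s) k ≋[ suc (suc s ℕ.+ k) ] 0ₛ
    g-vanish s k = q^-vanish (product ρ (suc s) k)
      (≡.subst (suc (suc s ℕ.+ k) ℕ.≤_) (large s k (triangular s)) (ℕₚ.m≤m+n _ _))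
      where
      large : ∀ s k t → suc (suc s ℕ.+ k) ℕ.+ (s ℕ.* (suc s ℕ.+ k) ℕ.+ s ℕ.+ t) ≡ suc s ℕ.* (suc s ℕ.+ k) ℕ.+ (suc s ℕ.+ t)
      large = solve-∀

module Triangular where
  -- For j ≥ 1 the factor ρ j is (1 - q^(2j))/(1 - q^(2j - 1)), as in Gauss's product for the sum of
  -- all q^(n(n + 1)/2).
  γ ρ : ℕ → Seq
  γ j = geometric (suc (double j))
  ρ zero    = 1ₛ
  ρ (suc j) = (1ₛ +ₛ q^ (double (suc j))) *ₛ γ j

  exponent : ℕ → ℕ → ℕ
  exponent s k = s ℕ.* suc (double (s ℕ.+ k))

  g W W⁺ : ℕ → ℕ → Seq
  g  s k = product ρ s k *ₛ q^ (exponent s k)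
  W  s k = product ρ s k *ₛ (1ₛ +ₛ q^ (double s)) *ₛ γ (s ℕ.+ k) *ₛ q^ (exponent s k)
  W⁺ s k = product ρ s k *ₛ (1ₛ +ₛ q^ (suc (double s))) *ₛ γ (s ℕ.+ k) *ₛ q^ (suc s ℕ.* suc (double (s ℕ.+ k)))

  step : ∀ s k → g s k +ₛ g s (suc k) ≋ W s k +ₛ W⁺ s k
  step s k = begin
    R *ₛ Q +ₛ R *ₛ ((1ₛ +ₛ X *ₛ O) *ₛ c) *ₛ q^ (exponent s (suc k))
      ≈⟨ S.+-cong (S.trans (S.sym (S.*-identityˡ (R *ₛ Q))) (S.*-congʳ {R *ₛ Q} (S.sym (geometric-inverse (double n)))))
                  (S.*-congˡ {R *ₛ ((1ₛ +ₛ X *ₛ O) *ₛ c)} (q^-+ (exponent s k) (double s) exponent-suc)) ⟩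
    c *ₛ (1ₛ +ₛ O) *ₛ (R *ₛ Q) +ₛ R *ₛ ((1ₛ +ₛ X *ₛ O) *ₛ c) *ₛ (Q *ₛ E)
      ≈⟨ solve 6 (λ X R Q O c E →
           c :* (con 1ℙ :+ O) :* (R :* Q) :+ R :* ((con 1ℙ :+ X :* O) :* c) :* (Q :* E) :=
           R :* (con 1ℙ :+ E) :* c :* Q :+ R :* (con 1ℙ :+ X :* E) :* c :* (O :* Q)) S.refl X R Q O c E ⟩
    R *ₛ (1ₛ +ₛ E) *ₛ c *ₛ Q +ₛ R *ₛ (1ₛ +ₛ X *ₛ E) *ₛ c *ₛ (O *ₛ Q)
      ≈⟨ S.+-congˡ {W s k} (S.*-congˡ {R *ₛ (1ₛ +ₛ X *ₛ E) *ₛ c} (S.^-homo-* X (suc (double n)) (exponent s k))) ⟨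
    W s k +ₛ W⁺ s k ∎
    where
    open ≋-Reasoning
    open Solver
    n = s ℕ.+ k
    R = product ρ s k
    Q = q^ (exponent s k)
    O = q^ (suc (double n))
    E = q^ (double s)
    c = γ n
    exponent-suc : exponent s (suc k) ≡ exponent s k ℕ.+ double s
    exponent-suc rewrite double≡ (s ℕ.+ suc k) | double≡ (s ℕ.+ k) | double≡ s = arithmetic s k
      where
      arithmetic : ∀ s k → s ℕ.* suc (s ℕ.+ suc k ℕ.+ (s ℕ.+ suc k)) ≡ s ℕ.* suc (s ℕ.+ k ℕ.+ (s ℕ.+ k)) ℕ.+ (s ℕ.+ s)
      arithmetic = solve-∀

  shift : ∀ s k → W⁺ s (suc k) ≋ W (suc s) k
  shift s k = begin
    product ρ s (suc k) *ₛ (1ₛ +ₛ O) *ₛ γ (s ℕ.+ suc k) *ₛ q^ (suc s ℕ.* suc (double (s ℕ.+ suc k)))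
      ≈⟨ S.reflexive (≡.cong (λ m → product ρ s (suc k) *ₛ (1ₛ +ₛ O) *ₛ γ m *ₛ q^ (suc s ℕ.* suc (double m))) (ℕₚ.+-suc s k)) ⟩
    product ρ s (suc k) *ₛ (1ₛ +ₛ O) *ₛ c *ₛ Q
      ≈⟨ S.*-congʳ {Q} (S.*-congʳ {c} (S.*-congʳ {1ₛ +ₛ O} (product-head ρ s k))) ⟩
    (1ₛ +ₛ E) *ₛ γ s *ₛ R *ₛ (1ₛ +ₛ O) *ₛ c *ₛ Q
      ≈⟨ solve 6 (λ E a R O c Q → (con 1ℙ :+ E) :* a :* R :* (con 1ℙ :+ O) :* c :* Q :=
                                  (a :* (con 1ℙ :+ O)) :* (R :* (con 1ℙ :+ E) :* c :* Q)) S.refl E (γ s) R O c Q ⟩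
    γ s *ₛ (1ₛ +ₛ O) *ₛ W (suc s) k
      ≈⟨ S.*-congʳ {W (suc s) k} (geometric-inverse (double s)) ⟩
    1ₛ *ₛ W (suc s) k
      ≈⟨ S.*-identityˡ (W (suc s) k) ⟩
    W (suc s) k ∎
    where
    open ≋-Reasoning
    open Solver
    R = product ρ (suc s) k
    O = q^ (suc (double s))
    E = q^ (double (suc s))
    c = γ (suc s ℕ.+ k)
    Q = q^ (exponent (suc s) k)

  partial : ℕ → Seq
  partial zero    = 0ₛ
  partial (suc n) = partial n +ₛ q^ (triangular n)

  W⁺-last : ∀ n → W⁺ n 0 ≋ q^ (triangular (suc (double n)))
  W⁺-last n = begin
    1ₛ *ₛ (1ₛ +ₛ O) *ₛ γ (n ℕ.+ 0) *ₛ q^ (suc n ℕ.* suc (double (n ℕ.+ 0)))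
      ≈⟨ S.reflexive (≡.cong (λ m → 1ₛ *ₛ (1ₛ +ₛ O) *ₛ γ m *ₛ q^ (suc n ℕ.* suc (double m))) (ℕₚ.+-identityʳ n)) ⟩
    1ₛ *ₛ (1ₛ +ₛ O) *ₛ γ n *ₛ Q
      ≈⟨ solve 3 (λ O a Q → con 1ℙ :* (con 1ℙ :+ O) :* a :* Q := (a :* (con 1ℙ :+ O)) :* Q) S.refl O (γ n) Q ⟩
    γ n *ₛ (1ₛ +ₛ O) *ₛ Q
      ≈⟨ S.trans (S.*-congʳ {Q} (geometric-inverse (double n))) (S.*-identityˡ Q) ⟩
    Q
      ≈⟨ S.reflexive (≡.cong q^ (triangular-odd n)) ⟨
    q^ (triangular (suc (double n))) ∎
    where
    open ≋-Reasoning
    open Solver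
    O = q^ (suc (double n))
    Q = q^ (suc n ℕ.* suc (double n))
    triangular-odd : ∀ n → triangular (suc (double n)) ≡ suc n ℕ.* suc (double n)
    triangular-odd zero    = ≡.refl
    triangular-odd (suc n) = ≡.trans (≡.cong (λ t → suc (suc (suc d)) ℕ.+ (suc (suc d) ℕ.+ t)) (triangular-odd n))
      (≡.trans (≡.cong (λ d → suc (suc (suc d)) ℕ.+ (suc (suc d) ℕ.+ suc n ℕ.* suc d)) (double≡ n))
        (≡.trans (arithmetic n) (≡.cong (λ d → suc (suc n) ℕ.* suc (suc (suc d))) (≡.sym (double≡ n)))))
      where
      d = double n
      arithmetic : ∀ n → suc (suc (suc (n ℕ.+ n))) ℕ.+ (suc (suc (n ℕ.+ n)) ℕ.+ suc n ℕ.* suc (n ℕ.+ n)) ≡ suc (suc n) ℕ.* suc (suc (suc (n ℕ.+ n)))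
      arithmetic = solve-∀

  triangular-even : ∀ n → triangular (double n) ≡ n ℕ.* suc (double n)
  triangular-even zero    = ≡.refl
  triangular-even (suc n) = ≡.trans (≡.cong (λ t → suc (suc d) ℕ.+ (suc d ℕ.+ t)) (triangular-even n))
    (≡.trans (≡.cong (λ d → suc (suc d) ℕ.+ (suc d ℕ.+ n ℕ.* suc d)) (double≡ n))
      (≡.trans (arithmetic n) (≡.cong (λ d → suc n ℕ.* suc (suc (suc d))) (≡.sym (double≡ n)))))
    where
    d = double n
    arithmetic : ∀ n → suc (suc (n ℕ.+ n)) ℕ.+ (suc (n ℕ.+ n) ℕ.+ n ℕ.* suc (n ℕ.+ n)) ≡ suc n ℕ.* suc (suc (suc (n ℕ.+ n)))
    arithmetic = solve-∀

  g-last : ∀ n → g n 0 ≋ q^ (triangular (double n))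
  g-last n = S.trans (S.*-identityˡ (q^ (exponent n 0)))
    (S.reflexive (≡.cong q^ (≡.trans (≡.cong (λ m → n ℕ.* suc (double m)) (ℕₚ.+-identityʳ n)) (≡.sym (triangular-even n)))))

  -- As in the pentagonal case, `W 0 n` vanishes; `W⁺ n 0` and `g (suc n) 0` supply the triangular
  -- numbers of index 2n + 1 and 2n + 2, so two terms appear per step.
  identity : ∀ n → diagonal g n 0 ≋ partial (suc (double n))
  identity zero    = S.trans (g-last 0) (S.sym (S.+-identityˡ 1ₛ))
  identity (suc n) = begin
    diagonal g (suc n) 0                   ≈⟨ diagonal-last g n 0 ⟩
    D′ +ₛ g (suc n ℕ.+ 0) 0                ≈⟨ solve 3 (λ D D′ g → D′ :+ g := D :+ (D :+ D′) :+ g) S.refl D D′ (g (suc n ℕ.+ 0) 0) ⟩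
    D +ₛ (D +ₛ D′) +ₛ g (suc n ℕ.+ 0) 0
      ≈⟨ S.+-congʳ {g (suc n ℕ.+ 0) 0} (S.+-cong (identity n) (diagonal-telescope {g} {λ s k → g s (suc k)} {W} {W⁺} step shift n 0)) ⟩
    partial (suc (double n)) +ₛ (W 0 n +ₛ W⁺ (n ℕ.+ 0) 0) +ₛ g (suc n ℕ.+ 0) 0
      ≈⟨ S.reflexive (≡.cong (λ m → partial (suc (double n)) +ₛ (W 0 n +ₛ W⁺ m 0) +ₛ g (suc m) 0) (ℕₚ.+-identityʳ n)) ⟩
    partial (suc (double n)) +ₛ (W 0 n +ₛ W⁺ n 0) +ₛ g (suc n) 0
      ≈⟨ S.+-cong (S.+-congˡ {partial (suc (double n))} (S.+-cong W₀≋0 (W⁺-last n))) (g-last (suc n)) ⟩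
    partial (suc (double n)) +ₛ (0ₛ +ₛ q^ (triangular (suc (double n)))) +ₛ q^ (triangular (double (suc n)))
      ≈⟨ S.+-congʳ {q^ (triangular (double (suc n)))} (S.+-congˡ {partial (suc (double n))} (S.+-identityˡ (q^ (triangular (suc (double n)))))) ⟩
    partial (suc (double (suc n))) ∎
    where
    open ≋-Reasoning
    open Solver
    D D′ : Seq
    D  = diagonal g n 0
    D′ = diagonal (λ s k → g s (suc k)) n 0
    W₀≋0 : W 0 n ≋ 0ₛ
    W₀≋0 = solve 3 (λ R c Q → R :* (con 1ℙ :+ con 1ℙ) :* c :* Q := con 0ℙ) S.refl (product ρ 0 n) (γ n) (q^ (exponent 0 n))

  -- The odd factors of the second product cancel the denominators of the first, and each 1 +
  -- q^(2j), which is (1 + qʲ)² modulo 2, is left twice. In the limit Gauss's product times η is η⁴,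
  -- so Gauss's product is η³.
  product-ρ : ∀ n → product ρ 0 n *ₛ product (λ i → 1ₛ +ₛ q^ i) 0 (double n) ≋ product (λ i → 1ₛ +ₛ q^ i) 0 n S.^ 4
  product-ρ zero    = solve 0 (con 1ℙ :* con 1ℙ := con 1ℙ :^ 4) S.refl
    where open Solver
  product-ρ (suc n) = begin
    R *ₛ ((1ₛ +ₛ q^ (double (suc n))) *ₛ γ n) *ₛ (Π *ₛ (1ₛ +ₛ O) *ₛ (1ₛ +ₛ q^ (double (suc n))))
      ≈⟨ S.reflexive (≡.cong (λ d → R *ₛ ((1ₛ +ₛ q^ d) *ₛ γ n) *ₛ (Π *ₛ (1ₛ +ₛ O) *ₛ (1ₛ +ₛ q^ d))) (double≡ (suc n))) ⟩
    R *ₛ ((1ₛ +ₛ q^ (suc n ℕ.+ suc n)) *ₛ γ n) *ₛ (Π *ₛ (1ₛ +ₛ O) *ₛ (1ₛ +ₛ q^ (suc n ℕ.+ suc n)))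
      ≈⟨ S.*-cong (S.*-congˡ {R} (S.*-congʳ {γ n} (S.+-congˡ {1ₛ} (S.^-homo-* X (suc n) (suc n))))) (S.*-congˡ {Π *ₛ (1ₛ +ₛ O)} (S.+-congˡ {1ₛ} (S.^-homo-* X (suc n) (suc n)))) ⟩
    R *ₛ ((1ₛ +ₛ Q *ₛ Q) *ₛ γ n) *ₛ (Π *ₛ (1ₛ +ₛ O) *ₛ (1ₛ +ₛ Q *ₛ Q))
      ≈⟨ solve 5 (λ R Q a Π O → R :* ((con 1ℙ :+ Q :* Q) :* a) :* (Π :* (con 1ℙ :+ O) :* (con 1ℙ :+ Q :* Q)) :=
                               (R :* Π) :* (a :* (con 1ℙ :+ O)) :* (con 1ℙ :+ Q) :^ 4) S.refl R Q (γ n) Π O ⟩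
    (R *ₛ Π) *ₛ (γ n *ₛ (1ₛ +ₛ O)) *ₛ (1ₛ +ₛ Q) S.^ 4
      ≈⟨ S.*-congʳ {(1ₛ +ₛ Q) S.^ 4} (S.*-cong (product-ρ n) (geometric-inverse (double n))) ⟩
    Π′ S.^ 4 *ₛ 1ₛ *ₛ (1ₛ +ₛ Q) S.^ 4
      ≈⟨ solve 2 (λ P Q → P :^ 4 :* con 1ℙ :* (con 1ℙ :+ Q) :^ 4 := (P :* (con 1ℙ :+ Q)) :^ 4) S.refl Π′ Q ⟩
    (Π′ *ₛ (1ₛ +ₛ Q)) S.^ 4 ∎
    where
    open ≋-Reasoning
    open Solver
    R = product ρ 0 n
    Π = product (λ i → 1ₛ +ₛ q^ i) 0 (double n)
    Π′ = product (λ i → 1ₛ +ₛ q^ i) 0 n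
    O = q^ (suc (double n))
    Q = q^ (suc n)

  double-large : ∀ n → n ℕ.≤ double n
  double-large n rewrite double≡ n = ℕₚ.m≤m+n n n

  η³-odd-partial : ∀ n → η S.^ 3 ≋[ suc n ] partial (suc (double n))
  η³-odd-partial n = trans[] (≋⇒≋[] η³≋) (trans[] (*ₛ-cong[] {g = 𝓟} {g′ = 𝓟} η⁴-approx (λ _ → ≡.refl)) (≋⇒≋[] cancel))
    where
    open Solver
    η³≋ : η S.^ 3 ≋ η S.^ 4 *ₛ 𝓟
    η³≋ = S.trans (S.sym (S.*-identityʳ (η S.^ 3))) (S.trans (S.*-congˡ {η S.^ 3} (S.sym 𝓟*η≋1))
      (solve 2 (λ η P → η :^ 3 :* (P :* η) := η :^ 4 :* P) S.refl η 𝓟))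

    g-vanish : ∀ s k → g (suc s) k ≋[ suc (suc s ℕ.+ k) ] 0ₛ
    g-vanish s k = q^-vanish (product ρ (suc s) k)
      (ℕₚ.≤-trans (s≤s (double-large (suc s ℕ.+ k))) (ℕₚ.m≤m+n _ _))

    product-approx : product ρ 0 n ≋[ suc n ] partial (suc (double n))
    product-approx = trans[] (≋⇒≋[] (S.sym (S.*-identityʳ (product ρ 0 n))))
      (trans[] (sym[] (diagonal-approx g g-vanish n)) (≋⇒≋[] (identity n)))

    η⁴-approx : η S.^ 4 ≋[ suc n ] partial (suc (double n)) *ₛ η
    η⁴-approx = trans[] (^-cong[] 4 (η-approx n)) (trans[] (≋⇒≋[] (S.sym (product-ρ n)))
      (*ₛ-cong[] product-approx (sym[] (≤-≋[] (s≤s (double-large n)) (η-approx (double n))))))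

    cancel : partial (suc (double n)) *ₛ η *ₛ 𝓟 ≋ partial (suc (double n))
    cancel = S.trans (solve 3 (λ p η P → p :* η :* P := p :* (P :* η)) S.refl (partial (suc (double n))) η 𝓟)
      (S.trans (S.*-congˡ {partial (suc (double n))} 𝓟*η≋1) (S.*-identityʳ (partial (suc (double n)))))

  partial-stable : ∀ j m → partial (j ℕ.+ m) ≋[ m ] partial m
  partial-stable zero    m _ = ≡.refl
  partial-stable (suc j) m {k} k<m = ≡.trans
    (≡.cong₂ ℙ._+_ (partial-stable j m k<m)
      (≡.trans (≡.sym (at (S.*-identityˡ (q^ (triangular (j ℕ.+ m)))) k))
        (q^-vanish 1ₛ (ℕₚ.≤-trans (ℕₚ.m≤n+m m j) (triangular-large (j ℕ.+ m))) k<m)))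
    (ℙₚ.+-identityʳ _)
    where
    triangular-large : ∀ n → n ℕ.≤ triangular n
    triangular-large zero    = z≤n
    triangular-large (suc n) = ℕₚ.m≤m+n (suc n) _

  η³-partial : ∀ n → η S.^ 3 ≋[ n ] partial n
  η³-partial n = trans[] (≤-≋[] {f = η S.^ 3} (ℕₚ.n≤1+n n) (η³-odd-partial n))
    (≡.subst (λ m → partial m ≋[ n ] partial n) (≡.cong suc (≡.sym (double≡ n))) (partial-stable (suc n) n))

sub-q^ : ∀ m n → sub (suc m) (q^ n) ≋ q^ (suc m ℕ.* n)
sub-q^ m n = S.trans (Hom.^-homo (subHom m) X n) (S.trans (S.^-congˡ n (sub-X m)) (S.^-assocʳ X (suc m) n))

triangular-double : ∀ n → triangular n ℕ.+ triangular n ≡ n ℕ.* suc n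
triangular-double zero    = ≡.refl
triangular-double (suc n) = ≡.trans (expand n (triangular n)) (≡.trans (≡.cong (λ t → suc n ℕ.+ suc n ℕ.+ t) (triangular-double n)) (collect n))
  where
  expand : ∀ n t → suc n ℕ.+ t ℕ.+ (suc n ℕ.+ t) ≡ suc n ℕ.+ suc n ℕ.+ (t ℕ.+ t)
  expand = solve-∀
  collect : ∀ n → suc n ℕ.+ suc n ℕ.+ n ℕ.* suc n ≡ suc n ℕ.* suc (suc n)
  collect = solve-∀

-- Triangular numbers split by index modulo 3: index 3k + 1 gives 1 + 9T, and the two other classes
-- give three times the pentagonal numbers. This is the source of η³ = η(q³) + qη(q⁹)³.
triangular-1+3k : ∀ k → triangular (1 ℕ.+ k ℕ.* 3) ≡ 1 ℕ.+ 9 ℕ.* triangular k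
triangular-1+3k zero    = ≡.refl
triangular-1+3k (suc k) = ≡.trans (≡.cong (λ t → 4 ℕ.+ k ℕ.* 3 ℕ.+ (3 ℕ.+ k ℕ.* 3 ℕ.+ (2 ℕ.+ k ℕ.* 3 ℕ.+ t))) (triangular-1+3k k)) (collect k (triangular k))
  where
  collect : ∀ k t → 4 ℕ.+ k ℕ.* 3 ℕ.+ (3 ℕ.+ k ℕ.* 3 ℕ.+ (2 ℕ.+ k ℕ.* 3 ℕ.+ (1 ℕ.+ 9 ℕ.* t))) ≡ 1 ℕ.+ 9 ℕ.* (suc k ℕ.+ t)
  collect = solve-∀

triangular-2+3k : ∀ k → triangular (2 ℕ.+ k ℕ.* 3) ≡ 3 ℕ.* (suc k ℕ.* k ℕ.+ triangular (suc k))
triangular-2+3k k = ≡.trans (≡.cong (2 ℕ.+ k ℕ.* 3 ℕ.+_) (triangular-1+3k k))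
  (≡.trans (expand k (triangular k)) (≡.trans (≡.cong (λ t → 3 ℕ.+ k ℕ.* 3 ℕ.+ (3 ℕ.* triangular k ℕ.+ 3 ℕ.* t)) (triangular-double k)) (collect k (triangular k))))
  where
  expand : ∀ k t → 2 ℕ.+ k ℕ.* 3 ℕ.+ (1 ℕ.+ 9 ℕ.* t) ≡ 3 ℕ.+ k ℕ.* 3 ℕ.+ (3 ℕ.* t ℕ.+ 3 ℕ.* (t ℕ.+ t))
  expand = solve-∀
  collect : ∀ k t → 3 ℕ.+ k ℕ.* 3 ℕ.+ (3 ℕ.* t ℕ.+ 3 ℕ.* (k ℕ.* suc k)) ≡ 3 ℕ.* (suc k ℕ.* k ℕ.+ (suc k ℕ.+ t))
  collect = solve-∀

triangular-3+3k : ∀ k → triangular (3 ℕ.+ k ℕ.* 3) ≡ 3 ℕ.* (suc k ℕ.* suc k ℕ.+ triangular (suc k))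
triangular-3+3k k = ≡.trans (≡.cong (3 ℕ.+ k ℕ.* 3 ℕ.+_) (triangular-2+3k k)) (collect k (triangular k))
  where
  collect : ∀ k t → 3 ℕ.+ k ℕ.* 3 ℕ.+ 3 ℕ.* (suc k ℕ.* k ℕ.+ (suc k ℕ.+ t)) ≡ 3 ℕ.* (suc k ℕ.* suc k ℕ.+ (suc k ℕ.+ t))
  collect = solve-∀

partial-dissection : ∀ k → Triangular.partial (suc (k ℕ.* 3)) ≋ sub 3 (Pentagonal.partial k) +ₛ X *ₛ sub 9 (Triangular.partial k)
partial-dissection zero    = begin
  0ₛ +ₛ 1ₛ                          ≈⟨ solve 1 (λ X → con 0ℙ :+ con 1ℙ := con 1ℙ :+ X :* con 0ℙ) S.refl X ⟩
  1ₛ +ₛ X *ₛ 0ₛ                     ≈⟨ S.+-cong (Hom.1-homo (subHom 2)) (S.*-congˡ {X} (Hom.0-homo (subHom 8))) ⟨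
  sub 3 1ₛ +ₛ X *ₛ sub 9 0ₛ         ∎
  where
  open ≋-Reasoning
  open Solver
partial-dissection (suc k) = begin
  Triangular.partial (suc (k ℕ.* 3)) +ₛ q^ (triangular (1 ℕ.+ k ℕ.* 3)) +ₛ q^ (triangular (2 ℕ.+ k ℕ.* 3)) +ₛ q^ (triangular (3 ℕ.+ k ℕ.* 3))
    ≈⟨ S.+-cong (S.+-cong (S.+-cong (partial-dissection k)
         (S.trans (S.reflexive (≡.cong q^ (triangular-1+3k k))) (S.*-congˡ {X} (S.sym (sub-q^ 8 (triangular k))))))
         (S.trans (S.reflexive (≡.cong q^ (triangular-2+3k k))) (S.sym (sub-q^ 2 n₁))))
         (S.trans (S.reflexive (≡.cong q^ (triangular-3+3k k))) (S.sym (sub-q^ 2 n₂))) ⟩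
  sub 3 (Pentagonal.partial k) +ₛ X *ₛ sub 9 (Triangular.partial k) +ₛ X *ₛ sub 9 (q^ (triangular k)) +ₛ sub 3 (q^ n₁) +ₛ sub 3 (q^ n₂)
    ≈⟨ solve 6 (λ X a b c d e → a :+ X :* b :+ X :* c :+ d :+ e := (a :+ (d :+ e)) :+ X :* (b :+ c)) S.refl
         X (sub 3 (Pentagonal.partial k)) (sub 9 (Triangular.partial k)) (sub 9 (q^ (triangular k))) (sub 3 (q^ n₁)) (sub 3 (q^ n₂)) ⟩
  (sub 3 (Pentagonal.partial k) +ₛ (sub 3 (q^ n₁) +ₛ sub 3 (q^ n₂))) +ₛ X *ₛ (sub 9 (Triangular.partial k) +ₛ sub 9 (q^ (triangular k)))
    ≈⟨ S.+-cong (S.trans (Hom.+-homo (subHom 2) (Pentagonal.partial k) _) (S.+-congˡ {sub 3 (Pentagonal.partial k)} (Hom.+-homo (subHom 2) (q^ n₁) (q^ n₂))))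
                (S.*-congˡ {X} (Hom.+-homo (subHom 8) (Triangular.partial k) (q^ (triangular k)))) ⟨
  sub 3 (Pentagonal.partial (suc k)) +ₛ X *ₛ sub 9 (Triangular.partial (suc k)) ∎
  where
  open ≋-Reasoning
  open Solver
  n₁ = suc k ℕ.* k ℕ.+ triangular (suc k)
  n₂ = suc k ℕ.* suc k ℕ.+ triangular (suc k)

η-dissection : η S.^ 3 ≋ sub 3 η +ₛ X *ₛ sub 9 η S.^ 3
-- `Triangular.η³-partial k` is valid only below q^k, one order less than `Pentagonal.η-partial k`;
-- hence k = n + 1.
η-dissection = ≋[]⇒≋ λ n → let k = suc n in
  trans[] (≤-≋[] {f = η S.^ 3} (s≤s (ℕₚ.≤-trans (ℕₚ.n≤1+n n) (ℕₚ.m≤m*n k 3))) (Triangular.η³-partial (suc (k ℕ.* 3))))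
  (trans[] (≋⇒≋[] (partial-dissection k)) (λ {j} j<k → ≡.cong₂ ℙ._+_
    (sym[] (sub-cong[] 2 {f = η} {Pentagonal.partial k} (≤-≋[] {f = η} (ℕₚ.n≤1+n k) (Pentagonal.η-partial k))) j<k)
    (≡.trans (*ₛ-cong[] {f = X} (λ _ → ≡.refl) (sym[] (sub-cong[] 8 {f = η S.^ 3} (Triangular.η³-partial k))) j<k)
             (at (S.*-congˡ {X} (Hom.^-homo (subHom 8) η 3)) j))))

-- Relations between η(q), η(q³), η(q⁹) and the function r

η₃ η₉ : Seq
η₃ = sub 3 η
η₉ = sub 9 η

-- Its vanishing serves twice: q ↦ q⁸ gives the equation of degree 3 for qη(q⁸)³, and q ↦ q³ the
-- relation between η(q³) and η(q⁹) behind both identities for r.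
Φ : Seq
Φ = η S.^ 12 +ₛ η S.^ 3 *ₛ η₃ S.^ 3 +ₛ X *ₛ η₃ S.^ 12

Φ₃ : sub 3 Φ ≋ η₃ S.^ 12 +ₛ η₃ S.^ 3 *ₛ η₉ S.^ 3 +ₛ X S.^ 3 *ₛ η₉ S.^ 12
Φ₃ = begin
  sub 3 Φ
    ≈⟨ +-homo (η S.^ 12 +ₛ η S.^ 3 *ₛ η₃ S.^ 3) (X *ₛ η₃ S.^ 12) ⟩
  sub 3 (η S.^ 12 +ₛ η S.^ 3 *ₛ η₃ S.^ 3) +ₛ sub 3 (X *ₛ η₃ S.^ 12)
    ≈⟨ S.+-cong (S.trans (+-homo (η S.^ 12) (η S.^ 3 *ₛ η₃ S.^ 3))
         (S.+-cong (^-homo η 12) (S.trans (*-homo (η S.^ 3) (η₃ S.^ 3)) (S.*-cong (^-homo η 3) (η₃^ 3)))))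
         (S.trans (sub-X* 2 (η₃ S.^ 12)) (S.*-congˡ {X S.^ 3} (η₃^ 12))) ⟩
  η₃ S.^ 12 +ₛ η₃ S.^ 3 *ₛ η₉ S.^ 3 +ₛ X S.^ 3 *ₛ η₉ S.^ 12 ∎
  where
  open ≋-Reasoning
  open Hom (subHom 2)
  η₃^ : ∀ n → sub 3 (η₃ S.^ n) ≋ η₉ S.^ n
  η₃^ n = S.trans (^-homo η₃ n) (S.^-congˡ n (sub-sub 2 2 η))

-- With A = η(q), B = η(q³), C = η(q⁹), substituting A³ = B + qC³ turns Φ into qΦ(q³).
Φ≋0 : Φ ≋ 0ₛ
Φ≋0 = ≋[]⇒≋ λ n → below (suc n)
  where
  Φ≋XΦ₃ : Φ ≋ X *ₛ sub 3 Φ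
  Φ≋XΦ₃ = begin
    η S.^ 12 +ₛ η S.^ 3 *ₛ η₃ S.^ 3 +ₛ X *ₛ η₃ S.^ 12
      ≈⟨ S.+-congʳ {X *ₛ η₃ S.^ 12} (S.+-cong (S.trans (S.sym (S.^-assocʳ η 3 4)) (S.^-congˡ 4 η-dissection)) (S.*-congʳ {η₃ S.^ 3} η-dissection)) ⟩
    (η₃ +ₛ X *ₛ η₉ S.^ 3) S.^ 4 +ₛ (η₃ +ₛ X *ₛ η₉ S.^ 3) *ₛ η₃ S.^ 3 +ₛ X *ₛ η₃ S.^ 12
      ≈⟨ solve 3 (λ X B C → (B :+ X :* C :^ 3) :^ 4 :+ (B :+ X :* C :^ 3) :* B :^ 3 :+ X :* B :^ 12 :=
                            X :* (B :^ 12 :+ B :^ 3 :* C :^ 3 :+ X :^ 3 :* C :^ 12)) S.refl X η₃ η₉ ⟩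
    X *ₛ (η₃ S.^ 12 +ₛ η₃ S.^ 3 *ₛ η₉ S.^ 3 +ₛ X S.^ 3 *ₛ η₉ S.^ 12)
      ≈⟨ S.*-congˡ {X} Φ₃ ⟨
    X *ₛ sub 3 Φ ∎
    where
    open ≋-Reasoning
    open Solver

  below : ∀ n → Φ ≋[ n ] 0ₛ
  below (suc n) {zero}  _         = ≡.trans (at Φ≋XΦ₃ 0) (X*-zero (sub 3 Φ))
  below (suc n) {suc k} (s≤s k<n) = ≡.trans (at Φ≋XΦ₃ (suc k)) (≡.trans (X*-suc (sub 3 Φ) k)
    (≤-≋[] {f = sub 3 Φ} (ℕₚ.m≤m*n n 3) (sub-vanish 2 (below n)) k<n))

-- The mixed terms of a square occur in equal pairs; peeling both factors exhibits the outermost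
-- pair.
frobenius : ∀ f → f *ₛ f ≋ sub 2 f
frobenius f = ext (go f)
  where
  open ≡.≡-Reasoning
  go : ∀ f n → (f *ₛ f) n ≡ sub 2 f n
  go f zero = ℙₚ.*-idem (f 0)
  go f (suc zero) with f 0 | f 1
  ... | 0ℙ | 0ℙ = ≡.refl
  ... | 0ℙ | 1ℙ = ≡.refl
  ... | 1ℙ | 0ℙ = ≡.refl
  ... | 1ℙ | 1ℙ = ≡.refl
  go f (suc (suc n)) = begin
    f 0 ℙ.* f (2 ℕ.+ n) ℙ.+ ((f ∘ suc) *ₛ f) (suc n)
      ≡⟨ ≡.cong (f 0 ℙ.* f (2 ℕ.+ n) ℙ.+_) (*ₛ-sucʳ n (f ∘ suc) f) ⟩
    f 0 ℙ.* f (2 ℕ.+ n) ℙ.+ (f 0 ℙ.* f (2 ℕ.+ n) ℙ.+ ((f ∘ suc) *ₛ (f ∘ suc)) n)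
      ≡⟨ cancel (f 0 ℙ.* f (2 ℕ.+ n)) _ ⟩
    ((f ∘ suc) *ₛ (f ∘ suc)) n
      ≡⟨ go (f ∘ suc) n ⟩
    sub 2 (f ∘ suc) n ∎
    where
    cancel : ∀ x y → x ℙ.+ (x ℙ.+ y) ≡ y
    cancel 0ℙ y  = ≡.refl
    cancel 1ℙ 0ℙ = ≡.refl
    cancel 1ℙ 1ℙ = ≡.refl

frobenius³ : ∀ f → f S.^ 8 ≋ sub 8 f
frobenius³ f = begin
  f S.^ 8                            ≈⟨ solve 1 (λ f → f :^ 8 := let f² = f :* f; f⁴ = f² :* f² in f⁴ :* f⁴) S.refl f ⟩
  (f² *ₛ f²) *ₛ (f² *ₛ f²)           ≈⟨ frobenius (f² *ₛ f²) ⟩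
  sub 2 (f² *ₛ f²)                   ≈⟨ cong (S.trans (frobenius f²) (cong (frobenius f))) ⟩
  sub 2 (sub 2 (sub 2 f))            ≈⟨ S.trans (cong (sub-sub 1 1 f)) (sub-sub 1 3 f) ⟩
  sub 8 f                            ∎
  where
  open ≋-Reasoning
  open Solver
  open Hom (subHom 1)
  f² = f *ₛ f

-- r = q η(q⁹)³ / η(q³)
r : Seq
r = X *ₛ (η₉ S.^ 3 *ₛ sub 3 𝓟)

inverse : ∀ m → sub (suc m) 𝓟 *ₛ sub (suc m) η ≋ 1ₛ
inverse m = S.trans (S.sym (*-homo 𝓟 η)) (S.trans (cong 𝓟*η≋1) 1-homo)
  where open Hom (subHom m)

E : Seq
E = X *ₛ sub 24 η

private
  η-cubic₃ : η₃ S.^ 12 +ₛ η₃ S.^ 3 *ₛ η₉ S.^ 3 +ₛ X S.^ 3 *ₛ η₉ S.^ 12 ≋ 0ₛ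
  η-cubic₃ = S.trans (S.sym Φ₃) (S.trans (Hom.cong (subHom 2) Φ≋0) (Hom.0-homo (subHom 2)))

-- With B = η(q³) and C = η(q⁹), r + r⁴ = q(B³C³ + q³C¹²)/B⁴. The relation Φ(q³) = 0 replaces the
-- bracket by B¹², leaving qB⁸, and B⁸ = η(q²⁴) by Frobenius.
r+r⁴≋E : r +ₛ r S.^ 4 ≋ E
r+r⁴≋E = begin
  r +ₛ r S.^ 4
    ≈⟨ S.+-congʳ {r S.^ 4} (S.trans (S.sym (S.*-identityʳ r)) (S.*-congˡ {r} (S.sym 1≋))) ⟩
  r *ₛ (β *ₛ η₃) S.^ 3 +ₛ r S.^ 4
    ≈⟨ solve 4 (λ X B C β → (X :* (C :^ 3 :* β)) :* (β :* B) :^ 3 :+ (X :* (C :^ 3 :* β)) :^ 4 :=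
         X :* β :^ 4 :* (B :^ 12 :+ B :^ 3 :* C :^ 3 :+ X :^ 3 :* C :^ 12) :+ X :* ((β :* B) :^ 4 :* B :^ 8)) S.refl X η₃ η₉ β ⟩
  X *ₛ β S.^ 4 *ₛ (η₃ S.^ 12 +ₛ η₃ S.^ 3 *ₛ η₉ S.^ 3 +ₛ X S.^ 3 *ₛ η₉ S.^ 12) +ₛ X *ₛ ((β *ₛ η₃) S.^ 4 *ₛ η₃ S.^ 8)
    ≈⟨ S.+-cong (S.*-congˡ {X *ₛ β S.^ 4} η-cubic₃) (S.*-congˡ {X} (S.*-cong (S.^-congˡ 4 (inverse 2)) (S.trans (frobenius³ η₃) (sub-sub 7 2 η)))) ⟩
  X *ₛ β S.^ 4 *ₛ 0ₛ +ₛ X *ₛ (1ₛ S.^ 4 *ₛ sub 24 η)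
    ≈⟨ solve 3 (λ X β e → X :* β :^ 4 :* con 0ℙ :+ X :* (con 1ℙ :^ 4 :* e) := X :* e) S.refl X β (sub 24 η) ⟩
  E ∎
  where
  open ≋-Reasoning
  open Solver
  β = sub 3 𝓟
  1≋ : (β *ₛ η₃) S.^ 3 ≋ 1ₛ
  1≋ = S.trans (S.^-congˡ 3 (inverse 2)) (solve 0 (con 1ℙ :^ 3 := con 1ℙ) S.refl)

-- 1 + r(q³) = η(q³)³ / η(q⁹), by the dissection of η(q³)³.
r-triple : r S.^ 3 ≋ sub 3 r +ₛ sub 3 r S.^ 2 +ₛ sub 3 r S.^ 3
r-triple = begin
  r S.^ 3
    -- Φ(q³) = 0 reads q³C¹² = B¹² + B³C³; so r³ = q³C⁹/B³ = B⁹/C³ + 1 = (1 + r(q³))³ + 1. The terms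
    -- with β and γ express these divisions without inverses.
    ≈⟨ solve 5 (λ X B C β γ → (X :* (C :^ 3 :* β)) :^ 3 :=
         (con 1ℙ :+ (γ :* C) :^ 3) :* ((X :* (C :^ 3 :* β)) :^ 3) :+
         β :^ 3 :* γ :^ 3 :* (B :^ 12 :+ B :^ 3 :* C :^ 3 :+ X :^ 3 :* C :^ 12) :+
         ((β :* B) :^ 3 :* (γ :* B :^ 3) :^ 3 :+ (β :* B) :^ 3 :* (γ :* C) :^ 3)) S.refl X η₃ η₉ β γ ⟩
  (1ₛ +ₛ (γ *ₛ η₉) S.^ 3) *ₛ r S.^ 3 +ₛ
  β S.^ 3 *ₛ γ S.^ 3 *ₛ (η₃ S.^ 12 +ₛ η₃ S.^ 3 *ₛ η₉ S.^ 3 +ₛ X S.^ 3 *ₛ η₉ S.^ 12) +ₛ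
  ((β *ₛ η₃) S.^ 3 *ₛ (γ *ₛ η₃ S.^ 3) S.^ 3 +ₛ (β *ₛ η₃) S.^ 3 *ₛ (γ *ₛ η₉) S.^ 3)
    ≈⟨ S.+-cong (S.+-cong (S.*-congʳ {r S.^ 3} (S.+-congˡ {1ₛ} (S.^-congˡ 3 (inverse 8)))) (S.*-congˡ {β S.^ 3 *ₛ γ S.^ 3} η-cubic₃))
         (S.+-cong (S.*-cong (S.^-congˡ 3 (inverse 2)) (S.^-congˡ 3 1+r₃≋)) (S.*-cong (S.^-congˡ 3 (inverse 2)) (S.^-congˡ 3 (inverse 8)))) ⟩
  (1ₛ +ₛ 1ₛ S.^ 3) *ₛ r S.^ 3 +ₛ β S.^ 3 *ₛ γ S.^ 3 *ₛ 0ₛ +ₛ (1ₛ S.^ 3 *ₛ (1ₛ +ₛ r₃) S.^ 3 +ₛ 1ₛ S.^ 3 *ₛ 1ₛ S.^ 3)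
    ≈⟨ solve 4 (λ r β γ s → (con 1ℙ :+ con 1ℙ :^ 3) :* r :^ 3 :+ β :^ 3 :* γ :^ 3 :* con 0ℙ :+
         (con 1ℙ :^ 3 :* (con 1ℙ :+ s) :^ 3 :+ con 1ℙ :^ 3 :* con 1ℙ :^ 3) := s :+ s :^ 2 :+ s :^ 3) S.refl r β γ r₃ ⟩
  r₃ +ₛ r₃ S.^ 2 +ₛ r₃ S.^ 3 ∎
  where
  open ≋-Reasoning
  open Solver
  open Hom (subHom 2)
  β = sub 3 𝓟
  γ = sub 9 𝓟
  r₃ = sub 3 r
  D = sub 3 η₉

  r₃≋ : r₃ ≋ X S.^ 3 *ₛ (D S.^ 3 *ₛ γ)
  r₃≋ = S.trans (sub-X* 2 (η₉ S.^ 3 *ₛ β)) (S.*-congˡ {X S.^ 3}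
    (S.trans (*-homo (η₉ S.^ 3) β) (S.*-cong (^-homo η₉ 3) (sub-sub 2 2 𝓟))))

  η₃³≋ : η₃ S.^ 3 ≋ η₉ +ₛ X S.^ 3 *ₛ D S.^ 3
  η₃³≋ = begin
    η₃ S.^ 3                              ≈⟨ ^-homo η 3 ⟨
    sub 3 (η S.^ 3)                       ≈⟨ cong η-dissection ⟩
    sub 3 (η₃ +ₛ X *ₛ η₉ S.^ 3)           ≈⟨ +-homo η₃ (X *ₛ η₉ S.^ 3) ⟩
    sub 3 η₃ +ₛ sub 3 (X *ₛ η₉ S.^ 3)     ≈⟨ S.+-cong (sub-sub 2 2 η) (S.trans (sub-X* 2 (η₉ S.^ 3)) (S.*-congˡ {X S.^ 3} (^-homo η₉ 3))) ⟩
    η₉ +ₛ X S.^ 3 *ₛ D S.^ 3              ∎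

  1+r₃≋ : γ *ₛ η₃ S.^ 3 ≋ 1ₛ +ₛ r₃
  1+r₃≋ = begin
    γ *ₛ η₃ S.^ 3                         ≈⟨ S.*-congˡ {γ} η₃³≋ ⟩
    γ *ₛ (η₉ +ₛ X S.^ 3 *ₛ D S.^ 3)
      ≈⟨ solve 4 (λ γ C X D → γ :* (C :+ X :^ 3 :* D :^ 3) := γ :* C :+ X :^ 3 :* (D :^ 3 :* γ)) S.refl γ η₉ X D ⟩
    γ *ₛ η₉ +ₛ X S.^ 3 *ₛ (D S.^ 3 *ₛ γ)  ≈⟨ S.+-cong (inverse 8) (S.sym r₃≋) ⟩
    1ₛ +ₛ r₃                              ∎

eval-fromMonomials : ∀ ms x y → eval₂ (fromMonomials ms) x y ≋ foldr (λ ij s → x S.^ proj₁ ij *ₛ y S.^ proj₂ ij +ₛ s) 0ₛ ms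
eval-fromMonomials []             x y = S.refl
eval-fromMonomials ((i , j) ∷ ms) x y = S.trans (eval-⊕ (monomial i j) (fromMonomials ms) x y) (S.+-cong (eval-monomial i j x y) (eval-fromMonomials ms x y))

E-equation : ∀ b cubic schläfli → Equations.Certificate (2 ℕ.+ b) cubic schläfli → eval₂ schläfli E (sub (2 ℕ.+ b) E) ≋ 0ₛ
E-equation b cubic schläfli certificate = begin
  eval₂ schläfli E (sub a E)
    ≈⟨ eval-cong schläfli x+x⁴≋ y+y⁴≋ ⟨
  eval₂ schläfli (eval₂ x+x⁴ r v) (eval₂ y+y⁴ r v)
    ≈⟨ Equations.schläfli-equation a cubic schläfli certificate r v r′ (sub a r′) b ≡.refl
         S.refl (sub-X* (suc b) r′) ≡.refl ≡.refl u-triple v-triple ⟩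
  0ₛ ∎
  where
  open ≋-Reasoning
  open Solver
  open Hom (subHom (suc b))
  a = 2 ℕ.+ b
  r′ = η₉ S.^ 3 *ₛ sub 3 𝓟
  v = sub a r

  x+x⁴≋ : eval₂ x+x⁴ r v ≋ E
  x+x⁴≋ = S.trans (eval-fromMonomials ((1 , 0) ∷ (4 , 0) ∷ []) r v)
    (S.trans (solve 2 (λ x y → x :^ 1 :* y :^ 0 :+ (x :^ 4 :* y :^ 0 :+ con 0ℙ) := x :+ x :^ 4) S.refl r v) r+r⁴≋E)

  y+y⁴≋ : eval₂ y+y⁴ r v ≋ sub a E
  y+y⁴≋ = S.trans (eval-fromMonomials ((0 , 1) ∷ (0 , 4) ∷ []) r v)
    (S.trans (solve 2 (λ x y → x :^ 0 :* y :^ 1 :+ (x :^ 0 :* y :^ 4 :+ con 0ℙ) := y :+ y :^ 4) S.refl r v)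
    (S.trans (S.sym (S.trans (+-homo r (r S.^ 4)) (S.+-congˡ {v} (^-homo r 4)))) (cong r+r⁴≋E)))

  u-triple : r S.^ 3 ≋ eval₂ Ux (sub 3 r) (sub 3 v)
  u-triple = S.trans r-triple (S.sym (S.trans (eval-fromMonomials ((1 , 0) ∷ (2 , 0) ∷ (3 , 0) ∷ []) (sub 3 r) (sub 3 v))
    (solve 2 (λ x y → x :^ 1 :* y :^ 0 :+ (x :^ 2 :* y :^ 0 :+ (x :^ 3 :* y :^ 0 :+ con 0ℙ)) := x :+ x :^ 2 :+ x :^ 3)
      S.refl (sub 3 r) (sub 3 v))))

  v-triple : v S.^ 3 ≋ eval₂ Uy (sub 3 r) (sub 3 v)
  v-triple = begin
    v S.^ 3                                          ≈⟨ ^-homo r 3 ⟨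
    sub a (r S.^ 3)                                  ≈⟨ cong r-triple ⟩
    sub a (sub 3 r +ₛ sub 3 r S.^ 2 +ₛ sub 3 r S.^ 3)
      ≈⟨ S.trans (+-homo _ (sub 3 r S.^ 3)) (S.+-cong (S.trans (+-homo (sub 3 r) (sub 3 r S.^ 2))
           (S.+-congˡ {sub a (sub 3 r)} (^-homo (sub 3 r) 2))) (^-homo (sub 3 r) 3)) ⟩
    sub a (sub 3 r) +ₛ sub a (sub 3 r) S.^ 2 +ₛ sub a (sub 3 r) S.^ 3
      ≈⟨ S.+-cong (S.+-cong comm (S.^-congˡ 2 comm)) (S.^-congˡ 3 comm) ⟩
    sub 3 v +ₛ sub 3 v S.^ 2 +ₛ sub 3 v S.^ 3
      ≈⟨ S.trans (eval-fromMonomials ((0 , 1) ∷ (0 , 2) ∷ (0 , 3) ∷ []) (sub 3 r) (sub 3 v))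
         (solve 2 (λ x y → x :^ 0 :* y :^ 1 :+ (x :^ 0 :* y :^ 2 :+ (x :^ 0 :* y :^ 3 :+ con 0ℙ)) := y :+ y :^ 2 :+ y :^ 3)
           S.refl (sub 3 r) (sub 3 v)) ⟨
    eval₂ Uy (sub 3 r) (sub 3 v)                     ∎
    where comm = sub-comm (suc b) 2 r

J : Seq
J = X *ₛ sub 8 (η S.^ 3)

degree3 : Poly₂
degree3 = fromMonomials ((1 , 1) ∷ (4 , 0) ∷ (0 , 4) ∷ [])

-- This is q⁴Φ(q⁸) = 0 in terms of x = qη(q⁸)³ and y = q³η(q²⁴)³.
J-equation : eval₂ degree3 J (sub 3 J) ≋ 0ₛ
J-equation = begin
  eval₂ degree3 J (sub 3 J)
    ≈⟨ eval-cong degree3 J≋ J₃≋ ⟩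
  eval₂ degree3 (X *ₛ A S.^ 3) (X S.^ 3 *ₛ B S.^ 3)
    ≈⟨ eval-fromMonomials ((1 , 1) ∷ (4 , 0) ∷ (0 , 4) ∷ []) (X *ₛ A S.^ 3) (X S.^ 3 *ₛ B S.^ 3) ⟩
  _ ≈⟨ solve 3 (λ X A B → let x = X :* A :^ 3 ; y = X :^ 3 :* B :^ 3 in
         x :^ 1 :* y :^ 1 :+ (x :^ 4 :* y :^ 0 :+ (x :^ 0 :* y :^ 4 :+ con 0ℙ)) :=
         X :^ 4 :* (A :^ 12 :+ A :^ 3 :* B :^ 3 :+ X :^ 8 :* B :^ 12)) S.refl X A B ⟩
  X S.^ 4 *ₛ (A S.^ 12 +ₛ A S.^ 3 *ₛ B S.^ 3 +ₛ X S.^ 8 *ₛ B S.^ 12)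
    ≈⟨ S.*-congˡ {X S.^ 4} (S.trans (S.sym Φ₈) (S.trans (cong Φ≋0) 0-homo)) ⟩
  X S.^ 4 *ₛ 0ₛ
    ≈⟨ S.zeroʳ (X S.^ 4) ⟩
  0ₛ ∎
  where
  open ≋-Reasoning
  open Solver
  open Hom (subHom 7)
  A = sub 8 η
  B = sub 8 η₃

  J≋ : J ≋ X *ₛ A S.^ 3
  J≋ = S.*-congˡ {X} (^-homo η 3)

  J₃≋ : sub 3 J ≋ X S.^ 3 *ₛ B S.^ 3
  J₃≋ = S.trans (sub-X* 2 (sub 8 (η S.^ 3))) (S.*-congˡ {X S.^ 3}
    (S.trans (sub-comm 2 7 (η S.^ 3)) (S.trans (cong (Hom.^-homo (subHom 2) η 3)) (^-homo η₃ 3))))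

  Φ₈ : sub 8 Φ ≋ A S.^ 12 +ₛ A S.^ 3 *ₛ B S.^ 3 +ₛ X S.^ 8 *ₛ B S.^ 12
  Φ₈ = S.trans (+-homo (η S.^ 12 +ₛ η S.^ 3 *ₛ η₃ S.^ 3) (X *ₛ η₃ S.^ 12)) (S.+-cong
    (S.trans (+-homo (η S.^ 12) (η S.^ 3 *ₛ η₃ S.^ 3)) (S.+-cong (^-homo η 12)
      (S.trans (*-homo (η S.^ 3) (η₃ S.^ 3)) (S.*-cong (^-homo η 3) (^-homo η₃ 3)))))
    (S.trans (sub-X* 7 (η₃ S.^ 12)) (S.*-congˡ {X S.^ 8} (^-homo η₃ 12))))

-- Reduction modulo 2

open import Defs
open import Data.Nat using (_+_; _*_)

π : ℤ → Parity
π i = parity ∣ i ∣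

π-⊖ : ∀ m n → π (m ℤ.⊖ n) ≡ parity m ℙ.+ parity n
π-⊖ m       zero    = ≡.sym (ℙₚ.+-identityʳ (parity m))
π-⊖ zero    (suc n) = ≡.refl
π-⊖ (suc m) (suc n) = ≡.trans (≡.cong π (ℤₚ.[1+m]⊖[1+n]≡m⊖n m n)) (≡.trans (π-⊖ m n)
  (≡.trans (cancel (parity m) (parity n)) (≡.sym (≡.cong₂ ℙ._+_ (ℙₚ.+-homo-+ 1 m) (ℙₚ.+-homo-+ 1 n)))))
  where
  cancel : ∀ x y → x ℙ.+ y ≡ (1ℙ ℙ.+ x) ℙ.+ (1ℙ ℙ.+ y)
  cancel 0ℙ 0ℙ = ≡.refl
  cancel 0ℙ 1ℙ = ≡.refl
  cancel 1ℙ 0ℙ = ≡.refl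
  cancel 1ℙ 1ℙ = ≡.refl

π-+ : ∀ i j → π (i ℤ.+ j) ≡ π i ℙ.+ π j
π-+ (+ m)    (+ n)    = ℙₚ.+-homo-+ m n
π-+ (+ m)    -[1+ n ] = π-⊖ m (suc n)
π-+ -[1+ m ] (+ n)    = ≡.trans (π-⊖ n (suc m)) (ℙₚ.+-comm (parity n) (parity (suc m)))
π-+ -[1+ m ] -[1+ n ] = ≡.trans (≡.cong (parity ∘ suc) (≡.sym (ℕₚ.+-suc m n))) (ℙₚ.+-homo-+ (suc m) (suc n))

π-* : ∀ i j → π (i ℤ.* j) ≡ π i ℙ.* π j
π-* i j = ≡.trans (≡.cong parity (ℤₚ.abs-* i j)) (ℙₚ.*-homo-* ∣ i ∣ ∣ j ∣)

even⇒2∣ : ∀ n → parity n ≡ 0ℙ → (+ 2) ℤ∣.∣ (+ n)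
even⇒2∣ zero          _ = divides 0 ≡.refl
even⇒2∣ (suc (suc n)) e with even⇒2∣ n e
... | divides q n≡q*2 = divides (suc q) (≡.cong (suc ∘ suc) n≡q*2)

π≡⇒2∣ : ∀ i j → π i ≡ π j → (+ 2) ℤ∣.∣ (i ℤ.- j)
π≡⇒2∣ i j e = even⇒2∣ ∣ i ℤ.- j ∣ (≡.trans (π-+ i (ℤ.- j)) (≡.trans (≡.cong₂ ℙ._+_ e (≡.cong parity (ℤₚ.∣-i∣≡∣i∣ j))) (CharTwoRing.x+x≈0 𝔽₂ (π j))))

sumTo-head : ∀ n h → sumTo (suc n) h ≡ h 0 ℤ.+ sumTo n (h ∘ suc)
sumTo-head zero    h = ≡.refl
sumTo-head (suc n) h = ≡.trans (≡.cong (ℤ._+ h (2 + n)) (sumTo-head n h)) (ℤₚ.+-assoc (h 0) _ _)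

reduce : PS → Seq
reduce f n = π (f n)

reduce-⊛ : ∀ f g → reduce (f ⊛ g) ≋ reduce f *ₛ reduce g
reduce-⊛ f g = ext λ n → go n f
  where
  go : ∀ n f → π (sumTo n (λ k → f k ℤ.* g (n ∸ k))) ≡ (reduce f *ₛ reduce g) n
  go zero    f = π-* (f 0) (g 0)
  go (suc n) f = ≡.trans (≡.cong π (sumTo-head n (λ k → f k ℤ.* g (suc n ∸ k)))) (≡.trans (π-+ (f 0 ℤ.* g (suc n)) _)
    (≡.cong₂ ℙ._+_ (π-* (f 0) (g (suc n))) (go n (f ∘ suc))))

reduce-one : reduce one ≋ 1ₛ
reduce-one = ext λ { zero → ≡.refl ; (suc n) → ≡.refl }

reduce-pow : ∀ f t → reduce (powPS f t) ≋ reduce f S.^ t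
reduce-pow f zero    = reduce-one
reduce-pow f (suc t) = S.trans (reduce-⊛ (powPS f t) f) (S.trans (S.*-congʳ {reduce f} (reduce-pow f t)) (S.*-comm (reduce f S.^ t) (reduce f)))

reduce-prod : ∀ k F → reduce (prodUpTo k F) ≋ product (reduce ∘ F) 0 k
reduce-prod zero    F = reduce-one
reduce-prod (suc k) F = S.trans (reduce-⊛ (prodUpTo k F) (F (suc k))) (S.*-congʳ {reduce (F (suc k))} (reduce-prod k F))

geometric-periodic : ∀ m n → geometric (suc m) (suc m + n) ≡ geometric (suc m) n
geometric-periodic m n = spread-strip m ones m n

reduce-geom : ∀ m → reduce (geom (suc m)) ≋ geometric (suc m)
reduce-geom m = ext λ n → go n n ℕₚ.≤-refl
  where
  geom-% : ∀ {k n} → k % suc m ≡ n % suc m → geom (suc m) k ≡ geom (suc m) n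
  geom-% {k} {n} e with k % suc m | n % suc m | e
  ... | zero  | _ | ≡.refl = ≡.refl
  ... | suc _ | _ | ≡.refl = ≡.refl

  small : ∀ n → n ℕ.< suc m → reduce (geom (suc m)) n ≡ geometric (suc m) n
  small n n<1+m with n % suc m | m<n⇒m%n≡m n<1+m
  small zero    _     | _ | ≡.refl = ≡.refl
  small (suc n) n<1+m | _ | ≡.refl = ≡.sym (geometric≋[]1 (suc m) n<1+m)

  go : ∀ bound n → n ℕ.≤ bound → reduce (geom (suc m)) n ≡ geometric (suc m) n
  go bound n n≤ with ℕₚ.<-≤-connex n (suc m)
  ... | inj₁ n<1+m = small n n<1+m
  ... | inj₂ 1+m≤n with ℕₚ.m≤n⇒∃[o]m+o≡n 1+m≤n
  go zero    _ () | inj₂ _ | k , ≡.refl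
  go (suc bound) _ (s≤s n≤) | inj₂ _ | k , ≡.refl = ≡.trans
    (≡.cong π (geom-% {suc m + k} {k} (≡.trans (≡.cong (_% suc m) (ℕₚ.+-comm (suc m) k)) ([m+n]%n≡m%n k (suc m)))))
    (≡.trans (go bound k (ℕₚ.≤-trans (ℕₚ.m≤n+m k m) n≤)) (≡.sym (geometric-periodic m k)))

-- `etaInvPow` takes the power of a truncated product; the truncation is exact through qⁿ, and
-- taking powers preserves this.
reduce-etaInvPow : ∀ m t n → π (etaInvPow (suc m) t n) ≡ (sub (suc m) 𝓟 S.^ t) n
reduce-etaInvPow m t n = ≡.trans (at (reduce-pow Π t) n) (^-cong[] t approx ℕₚ.≤-refl)
  where
  Π = prodUpTo n (λ i → geom (suc m * i))
  factor : ∀ j → reduce (geom (suc m * suc j)) ≋ sub (suc m) (geometric (suc j))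
  factor j = S.trans (reduce-geom (j + m * suc j)) (S.trans (S.reflexive (≡.cong geometric (ℕₚ.*-comm (suc m) (suc j)))) (S.sym (sub-sub m j ones)))
  approx : reduce Π ≋[ suc n ] sub (suc m) 𝓟
  approx = trans[] (≋⇒≋[] (S.trans (reduce-prod n (λ i → geom (suc m * i)))
    (S.trans (product-cong {reduce ∘ (λ i → geom (suc m * i))} {sub (suc m) ∘ geometric} factor 0 n) (S.sym (product-hom (subHom m) geometric 0 n)))))
    (sym[] (sub-cong[] m (𝓟-approx n)))

sub-1 : ∀ f → sub 1 f ≋ f
sub-1 f = ext (go f)
  where
  go : ∀ f n → spread 0 f 0 n ≡ f n
  go f zero    = ≡.refl
  go f (suc n) = go (f ∘ suc) n

reduce-etaInvPow-1 : ∀ t n → π (etaInvPow 1 t n) ≡ (𝓟 S.^ t) n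
reduce-etaInvPow-1 t n = ≡.trans (reduce-etaInvPow 0 t n) (at (S.^-congˡ t (sub-1 𝓟)) n)

-- From modular equations to the twelve congruences

Congruence : ℕ → ℕ → ℕ → Set
Congruence a b t = qShift (λ n → p t (a * n + b)) ≡₂ (etaInvPow 1 (a * t) ⊕ etaInvPow a t)

congruence : ∀ a′ b t → let a = suc a′ in
  0ℙ ≡ (𝓟 S.^ (a * t)) 0 ℙ.+ sub a (𝓟 S.^ t) 0 →
  (∀ n → (𝓟 S.^ t) (a * n + b) ≡ (𝓟 S.^ (a * t)) (suc n) ℙ.+ sub a (𝓟 S.^ t) (suc n)) →
  Congruence a b t
congruence a′ b t at-zero at-suc n = π≡⇒2∣ (lhs n) (etaInvPow 1 (a * t) n ℤ.+ etaInvPow a t n)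
  (≡.trans (lhs≡ n) (≡.sym (≡.trans (π-+ (etaInvPow 1 (a * t) n) _) (≡.cong₂ ℙ._+_ (reduce-etaInvPow-1 (a * t) n)
    (≡.trans (reduce-etaInvPow a′ t n) (≡.sym (at (Hom.^-homo (subHom a′) 𝓟 t) n)))))))
  where
  a = suc a′
  lhs = qShift (λ n → p t (a * n + b))
  lhs≡ : ∀ n → π (lhs n) ≡ (𝓟 S.^ (a * t)) n ℙ.+ sub a (𝓟 S.^ t) n
  lhs≡ zero    = at-zero
  lhs≡ (suc n) = ≡.trans (reduce-etaInvPow-1 t (a * n + b)) (at-suc n)

eval-swap : ∀ q → T (isZero₂ (q ⊕₂ compose q (monomial 0 1) (monomial 1 0))) → ∀ x y → eval₂ q x y ≋ eval₂ q y x
eval-swap q h x y = S.trans (CharTwo.x+y≈0⇒x≈y series (S.trans (S.sym (eval-⊕ q q′ x y)) (isZero-sound (q ⊕₂ q′) x y h)))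
  (S.trans (eval-compose q (monomial 0 1) (monomial 1 0) x y) (eval-cong q
    (S.trans (eval-monomial 0 1 x y) (solve 2 (λ x y → x :^ 0 :* y :^ 1 := y) S.refl x y))
    (S.trans (eval-monomial 1 0 x y) (solve 2 (λ x y → x :^ 1 :* y :^ 0 := x) S.refl x y))))
  where
  q′ = compose q (monomial 0 1) (monomial 1 0)
  open CharTwo.Solver series

record Shape (a t : ℕ) (rows : Poly₂) : Set where
  field
    degree    : T (length rows ℕ.≡ᵇ (a ∸ 1))
    symmetric : T (isZero₂ (monicEquation a rows ⊕₂ compose (monicEquation a rows) (monomial 0 1) (monomial 1 0)))
    gap       : T (isZero₂ (take t rows))
    t≤        : T (t ℕ.≤ᵇ length rows)

-- With γ = a - β, the last hypothesis is the exponent condition (a² - 1)(t + 1) = 24γ, which fixes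
-- the residue β.
E-congruence : ∀ b h t β γ cubic rows → (let a = 2 + b) → suc b ≡ double h → Prime a →
  Equations.Certificate a cubic (monicEquation a rows) → Shape a t rows →
  a ≡ β + γ → (suc b + a * suc b) * suc t ≡ γ * 24 → Congruence a β (suc t)
E-congruence b h t β γ cubic rows a-odd a-prime certificate shape a≡β+γ exponent =
  congruence (suc b) β (suc t) (M.at-zero d below above gap t≤′) (M.at-suc d below above gap t≤′ β γ a≡β+γ exponent)
  where
  open Shape shape
  q = monicEquation (2 + b) rows
  module M = Trace b h 23 a-odd a-prime η 𝓟 ≡.refl 𝓟*η≋1 rows t
  d = ℕₚ.≡ᵇ⇒≡ (length rows) (suc b) degree
  t≤′ = ℕₚ.≤ᵇ⇒≤ t (length rows) t≤
  below = E-equation b cubic q certificate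
  above = S.trans (eval-swap q symmetric (sub (2 + b) E) E) below

-- Since φ is η³ here, the power t + 1 of 1/φ is the power 3(t + 1) of 1/η. As a² - 1 = 8 equals m,
-- the condition on γ is just γ = t + 1.
J-congruence : ∀ t β γ → Shape 3 t ([] ∷ [] ∷ []) → 3 ≡ β + γ → 8 * suc t ≡ γ * 8 → Congruence 3 β (3 * suc t)
J-congruence t β γ shape 3≡β+γ exponent = congruence 2 β (3 * suc t)
  (≡.trans (M.at-zero ≡.refl below above gap t≤′) (≡.cong₂ ℙ._+_ (powers 0) (powers′ 0)))
  (λ n → ≡.trans (≡.sym (at (S.^-assocʳ 𝓟 3 (suc t)) (3 * n + β)))
    (≡.trans (M.at-suc ≡.refl below above gap t≤′ β γ 3≡β+γ exponent n) (≡.cong₂ ℙ._+_ (powers (suc n)) (powers′ (suc n)))))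
  where
  open Shape shape
  open CharTwo.Solver series
  q = monicEquation 3 ([] ∷ [] ∷ [])
  𝓟³*η³≋1 : 𝓟 S.^ 3 *ₛ η S.^ 3 ≋ 1ₛ
  𝓟³*η³≋1 = S.trans (S.sym (S.^-distrib-* 𝓟 η 3)) (S.trans (S.^-congˡ 3 𝓟*η≋1) (solve 0 (con 1ℙ :^ 3 := con 1ℙ) S.refl))
  module M = Trace 1 1 7 ≡.refl (from-yes (prime? 3)) (η S.^ 3) (𝓟 S.^ 3) ≡.refl 𝓟³*η³≋1 ([] ∷ [] ∷ []) t
  t≤′ = ℕₚ.≤ᵇ⇒≤ t 2 t≤
  below : eval₂ q J (sub 3 J) ≋ 0ₛ
  below = J-equation
  above : eval₂ q (sub 3 J) J ≋ 0ₛ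
  above = S.trans (eval-swap q symmetric (sub 3 J) J) below
  powers : ∀ n → ((𝓟 S.^ 3) S.^ (3 * suc t)) n ≡ (𝓟 S.^ (3 * (3 * suc t))) n
  powers = at (S.^-assocʳ 𝓟 3 (3 * suc t))
  powers′ : ∀ n → sub 3 ((𝓟 S.^ 3) S.^ suc t) n ≡ sub 3 (𝓟 S.^ (3 * suc t)) n
  powers′ = at (Hom.cong (subHom 2) (S.^-assocʳ 𝓟 3 (suc t)))

-- Terms other than x^(a+1), xy and y^(a+1) of the modular equations, found by linear algebra on q-expansions.
schläfli5 : List (ℕ × ℕ)
schläfli5 =
  []

cubic5 : List (ℕ × ℕ)
cubic5 =
  (2 , 2) ∷ (1 , 4) ∷ (4 , 1) ∷ []

schläfli7 : List (ℕ × ℕ)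
schläfli7 =
  (4 , 4) ∷ []

cubic7 : List (ℕ × ℕ)
cubic7 =
  (1 , 4) ∷ (4 , 1) ∷ (4 , 4) ∷ []

schläfli11 : List (ℕ × ℕ)
schläfli11 =
  (3 , 3) ∷ []

cubic11 : List (ℕ × ℕ)
cubic11 =
  (2 , 2) ∷ (1 , 4) ∷ (4 , 1) ∷ (2 , 8) ∷ (8 , 2) ∷ []

schläfli13 : List (ℕ × ℕ)
schläfli13 =
  (2 , 12) ∷ (12 , 2) ∷ []

cubic13 : List (ℕ × ℕ)
cubic13 =
  (1 , 4) ∷ (4 , 1) ∷ (1 , 7) ∷ (3 , 5) ∷ (4 , 4) ∷ (5 , 3) ∷ (7 , 1) ∷ (1 , 10) ∷ (3 , 8) ∷ (4 , 7) ∷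
  (5 , 6) ∷ (6 , 5) ∷ (7 , 4) ∷ (8 , 3) ∷ (10 , 1) ∷ (2 , 12) ∷ (12 , 2) ∷ []

schläfli17 : List (ℕ × ℕ)
schläfli17 =
  (2 , 8) ∷ (8 , 2) ∷ (6 , 12) ∷ (12 , 6) ∷ []

cubic17 : List (ℕ × ℕ)
cubic17 =
  (2 , 2) ∷ (1 , 4) ∷ (4 , 1) ∷ (1 , 7) ∷ (7 , 1) ∷ (1 , 10) ∷ (4 , 7) ∷ (7 , 4) ∷ (10 , 1) ∷ (3 , 9) ∷
  (9 , 3) ∷ (1 , 13) ∷ (4 , 10) ∷ (10 , 4) ∷ (13 , 1) ∷ (3 , 12) ∷ (6 , 9) ∷ (9 , 6) ∷ (12 , 3) ∷ (1 , 16) ∷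
  (4 , 13) ∷ (13 , 4) ∷ (16 , 1) ∷ (6 , 12) ∷ (12 , 6) ∷ []

schläfli19 : List (ℕ × ℕ)
schläfli19 =
  (2 , 6) ∷ (6 , 2) ∷ (3 , 11) ∷ (11 , 3) ∷ (8 , 12) ∷ (12 , 8) ∷ []

cubic19 : List (ℕ × ℕ)
cubic19 =
  (1 , 4) ∷ (4 , 1) ∷ (4 , 4) ∷ (1 , 13) ∷ (5 , 9) ∷ (9 , 5) ∷ (13 , 1) ∷ (1 , 16) ∷ (4 , 13) ∷ (5 , 12) ∷
  (8 , 9) ∷ (9 , 8) ∷ (12 , 5) ∷ (13 , 4) ∷ (16 , 1) ∷ (8 , 12) ∷ (12 , 8) ∷ []

schläfli23 : List (ℕ × ℕ)
schläfli23 =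
  (2 , 2) ∷ (3 , 3) ∷ (6 , 6) ∷ []

cubic23 : List (ℕ × ℕ)
cubic23 =
  (1 , 4) ∷ (4 , 1) ∷ (8 , 8) ∷ (4 , 16) ∷ (16 , 4) ∷ []

allTerms : ℕ → List (ℕ × ℕ) → List (ℕ × ℕ)
allTerms a terms = (suc a , 0) ∷ (1 , 1) ∷ (0 , suc a) ∷ terms

-- Padding by a + 1 zero rows guarantees that all the rows of y², ..., y^a exist. The lists above
-- are short because E is q times a series in q²⁴, which forces i + aj to be a + 1 modulo 24 for
-- every term xⁱyʲ.
middleRows : ℕ → List (ℕ × ℕ) → Poly₂
middleRows a terms = take (a ∸ 1) (drop 2 (fromMonomials terms ⊕₂ replicate (suc a) []))

-- Every field evaluates to the unit type, so the record is inferred by eta; type checking carries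
-- out the polynomial divisions.
certificate5 : Equations.Certificate 5 (allTerms 5 cubic5) (monicEquation 5 (middleRows 5 schläfli5))
certificate5 = _

certificate7 : Equations.Certificate 7 (allTerms 7 cubic7) (monicEquation 7 (middleRows 7 schläfli7))
certificate7 = _

certificate11 : Equations.Certificate 11 (allTerms 11 cubic11) (monicEquation 11 (middleRows 11 schläfli11))
certificate11 = _

certificate13 : Equations.Certificate 13 (allTerms 13 cubic13) (monicEquation 13 (middleRows 13 schläfli13))
certificate13 = _

certificate17 : Equations.Certificate 17 (allTerms 17 cubic17) (monicEquation 17 (middleRows 17 schläfli17))
certificate17 = _

certificate19 : Equations.Certificate 19 (allTerms 19 cubic19) (monicEquation 19 (middleRows 19 schläfli19))
certificate19 = _

certificate23 : Equations.Certificate 23 (allTerms 23 cubic23) (monicEquation 23 (middleRows 23 schläfli23))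
certificate23 = _

theorem1p3 : (a b t : ℕ) →
    (a , b , t) ∈ ((5 , 4 , 1) ∷ (7 , 5 , 1) ∷ (11 , 6 , 1) ∷ (13 , 6 , 1) ∷ (17 , 5 , 1) ∷ (19 , 4 , 1) ∷ (23 , 1 , 1) ∷ (3 , 2 , 3) ∷ (5 , 2 , 3) ∷ (7 , 1 , 3) ∷ (5 , 0 , 5) ∷ (3 , 0 , 9) ∷ []) →
    qShift (λ n → p t (a * n + b)) ≡₂ (etaInvPow 1 (a * t) ⊕ etaInvPow a t)
theorem1p3 _ _ _ (here ≡.refl) =
  -- The numerical arguments are a - 2, (a - 1)/2, t - 1, b and a - b.
  E-congruence 3 2 0 4 1 (allTerms 5 cubic5) (middleRows 5 schläfli5) ≡.refl (from-yes (prime? 5)) certificate5 _ ≡.refl ≡.refl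
theorem1p3 _ _ _ (there (here ≡.refl)) =
  E-congruence 5 3 0 5 2 (allTerms 7 cubic7) (middleRows 7 schläfli7) ≡.refl (from-yes (prime? 7)) certificate7 _ ≡.refl ≡.refl
theorem1p3 _ _ _ (there (there (here ≡.refl))) =
  E-congruence 9 5 0 6 5 (allTerms 11 cubic11) (middleRows 11 schläfli11) ≡.refl (from-yes (prime? 11)) certificate11 _ ≡.refl ≡.refl
theorem1p3 _ _ _ (there (there (there (here ≡.refl)))) =
  E-congruence 11 6 0 6 7 (allTerms 13 cubic13) (middleRows 13 schläfli13) ≡.refl (from-yes (prime? 13)) certificate13 _ ≡.refl ≡.refl
theorem1p3 _ _ _ (there (there (there (there (here ≡.refl))))) =
  E-congruence 15 8 0 5 12 (allTerms 17 cubic17) (middleRows 17 schläfli17) ≡.refl (from-yes (prime? 17)) certificate17 _ ≡.refl ≡.refl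
theorem1p3 _ _ _ (there (there (there (there (there (here ≡.refl)))))) =
  E-congruence 17 9 0 4 15 (allTerms 19 cubic19) (middleRows 19 schläfli19) ≡.refl (from-yes (prime? 19)) certificate19 _ ≡.refl ≡.refl
theorem1p3 _ _ _ (there (there (there (there (there (there (here ≡.refl))))))) =
  E-congruence 21 11 0 1 22 (allTerms 23 cubic23) (middleRows 23 schläfli23) ≡.refl (from-yes (prime? 23)) certificate23 _ ≡.refl ≡.refl
theorem1p3 _ _ _ (there (there (there (there (there (there (there (here ≡.refl)))))))) =
  -- The numerical arguments are t/3 - 1, b and 3 - b.
  J-congruence 0 2 1 _ ≡.refl ≡.refl
theorem1p3 _ _ _ (there (there (there (there (there (there (there (there (here ≡.refl))))))))) =
  E-congruence 3 2 2 2 3 (allTerms 5 cubic5) (middleRows 5 schläfli5) ≡.refl (from-yes (prime? 5)) certificate5 _ ≡.refl ≡.refl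
theorem1p3 _ _ _ (there (there (there (there (there (there (there (there (there (here ≡.refl)))))))))) =
  E-congruence 5 3 2 1 6 (allTerms 7 cubic7) (middleRows 7 schläfli7) ≡.refl (from-yes (prime? 7)) certificate7 _ ≡.refl ≡.refl
theorem1p3 _ _ _ (there (there (there (there (there (there (there (there (there (there (here ≡.refl))))))))))) =
  E-congruence 3 2 4 0 5 (allTerms 5 cubic5) (middleRows 5 schläfli5) ≡.refl (from-yes (prime? 5)) certificate5 _ ≡.refl ≡.refl
theorem1p3 _ _ _ (there (there (there (there (there (there (there (there (there (there (there (here ≡.refl)))))))))))) =
  J-congruence 2 0 3 _ ≡.refl ≡.refl
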